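{- Let $\Gamma$ be a finite abelian group and let $S\subseteq\Gamma$ with $0\notin S$. Then the mixed Cayley graph $\mathrm{Cay}(\Gamma,S)$ is HS-integral if and only if $S\setminus\overline{S}\in\mathbb{B}(\Gamma)$ and $\overline{S}\in\mathbb{E}(\Gamma)$.
   Context: $\Gamma$ is written additively, with identity $0$; for $x\in\Gamma$ and $k\in\mathbb{Z}$, $x^k$ denotes $kx$, and $-x$ is the inverse of $x$. For $S\subseteq\Gamma$ with $0\notin S$, put $S^{ -1}=\{ -s:s\in S\}$ and $\overline{S}=\{u\in S: -u\notin S\}$. A set $S$ is skew-symmetric if $-a\notin S$ for all $a\in S$. The mixed Cayley graph $\mathrm{Cay}(\Gamma,S)$ has vertex set $\Gamma$ and arc set $\{(a,b): b-a\in S\}$. For a mixed graph $G$, the Hermitian adjacency matrix of second kind $\mathcal{H}(G)=(h_{uv})$ is defined by $h_{uv}=1$ if both $(u,v)$ and $(v,u)$ are arcs, $h_{uv}=\frac{1+i\sqrt3}{2}$ if $(u,v)$ is an arc and $(v,u)$ is not, $h_{uv}=\frac{1-i\sqrt3}{2}$ if $(v,u)$ is an arc and $(u,v)$ is not, and $h_{uv}=0$ otherwise. $G$ is HS-integral if all eigenvalues of $\mathcal{H}(G)$ are integers. A simple graph, i.e. one with $S$ symmetric, is integral if all its adjacency eigenvalues are integers. $\mathbb{B}(\Gamma)$ is the Boolean algebra of subsets of $\Gamma$ generated by all subgroups of $\Gamma$ under finite unions, intersections and complements. Its atoms are the sets $[x]=\{y\in\Gamma:\langle y\rangle=\langle x\rangle\}$,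 and every element of $\mathbb{B}(\Gamma)$ is a union of such atoms. $\Gamma(3)$ is the set of $x\in\Gamma$ whose order is divisible by $3$. For $m\equiv0\pmod 3$, put $G^1_{m,3}(1)=\{k:1\le k\le m-1,\ \gcd(k,m)=1,\ k\equiv1\pmod3\}$. For $x\in\Gamma(3)$ with $\mathrm{ord}(x)=m$, put $\langle\!\langle x\rangle\!\rangle=\{x^k:k\in G^1_{m,3}(1)\}$. If $\Gamma(3)\neq\emptyset$, $\mathbb{E}(\Gamma)$ is the set of all skew-symmetric subsets of $\Gamma$ of the form $\langle\!\langle x_1\rangle\!\rangle\cup\cdots\cup\langle\!\langle x_k\rangle\!\rangle$ with $x_1,\dots,x_k\in\Gamma(3)$. If $\Gamma(3)=\emptyset$, then $\mathbb{E}(\Gamma)=\{\emptyset\}$. -}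

module Defs where

open import Level using (0ℓ)
open import Data.Nat as ℕ using (ℕ; zero; suc; _<_; _≤_; _%_)
open import Data.Nat.GCD using (gcd)
open import Data.Nat.Divisibility using (_∣_)
open import Data.Integer as ℤ using (ℤ; +_)
open import Data.Fin using (Fin; zero; suc; toℕ; punchIn)
open import Data.Bool using (Bool; true; false; _∨_; _∧_; not)
open import Data.List using (List; []; _∷_)
open import Data.List.Relation.Unary.All using (All)
open import Data.List.Relation.Unary.Any using (Any)
open import Data.Product using (Σ; ∃; _×_; _,_)
open import Relation.Binary.PropositionalEquality using (_≡_; _≢_)
open import Relation.Nullary using (¬_)
open import Function.Bundles using (_↔_; Inverse)
open import Algebra.Structures using (IsAbelianGroup)

record FiniteAbelianGroup : Set₁ where
  infixl 6 _+_
  field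
    Carrier : Set
    _+_     : Carrier → Carrier → Carrier
    0#      : Carrier
    -_      : Carrier → Carrier
    isAbelianGroup : IsAbelianGroup _≡_ _+_ 0# -_
    order   : ℕ
    enum    : Fin order ↔ Carrier

module _ (Γ : FiniteAbelianGroup) where
  open FiniteAbelianGroup Γ

  -- subsets of Γ (Γ is finite, so subsets are given by characteristic functions)
  Subset : Set
  Subset = Carrier → Bool

  _∈_ : Carrier → Subset → Set
  x ∈ S = S x ≡ true

  _≐_ : Subset → Subset → Set
  S ≐ T = ∀ x → S x ≡ T x

  _·_ : ℕ → Carrier → Carrier
  zero  · x = 0#
  suc k · x = x + (k · x)

  HasOrder : Carrier → ℕ → Set
  HasOrder x m = 1 ≤ m × (m · x ≡ 0#) × (∀ k → 1 ≤ k → k < m → k · x ≢ 0#)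

  InCyclic : Carrier → Carrier → Set
  InCyclic x y = ∃ λ k → y ≡ k · x

  InAtom : Carrier → Carrier → Set
  InAtom x y = ∀ z → (InCyclic y z → InCyclic x z) × (InCyclic x z → InCyclic y z)

  IsSubgroup : Subset → Set
  IsSubgroup H = (0# ∈ H) × (∀ x y → x ∈ H → y ∈ H → (x + y) ∈ H)
                          × (∀ x → x ∈ H → (- x) ∈ H)

  data InB : Subset → Set where
    subgrp : ∀ H → IsSubgroup H → InB H
    union  : ∀ S T → InB S → InB T → InB (λ x → S x ∨ T x)
    inter  : ∀ S T → InB S → InB T → InB (λ x → S x ∧ T x)
    compl  : ∀ S → InB S → InB (λ x → not (S x))
    ext    : ∀ S T → S ≐ T → InB S → InB T

  bar : Subset → Subset
  bar S u = S u ∧ not (S (- u))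

  -- S ∖ S̄ = {u ∈ S : -u ∈ S}
  symPart : Subset → Subset
  symPart S u = S u ∧ S (- u)

  SkewSymmetric : Subset → Set
  SkewSymmetric S = ∀ a → a ∈ S → ¬ ((- a) ∈ S)

  InΓ3 : Carrier → Set
  InΓ3 x = ∃ λ m → HasOrder x m × (3 ∣ m)

  InDoubleBracket : Carrier → Carrier → Set
  InDoubleBracket x y = ∃ λ m → ∃ λ k →
    HasOrder x m × 1 ≤ k × k < m × gcd k m ≡ 1 × k % 3 ≡ 1 × y ≡ k · x

  -- 𝔼(Γ): skew-symmetric finite unions of sets ⟨⟨x_i⟩⟩ with x_i ∈ Γ(3)
  -- (the empty union ∅ is allowed; if Γ(3) = ∅ this gives exactly {∅})
  InE : Subset → Set
  InE T = SkewSymmetric T × Σ (List Carrier) λ xs →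
            All InΓ3 xs ×
            (∀ y → (y ∈ T → Any (λ x → InDoubleBracket x y) xs)
                 × (Any (λ x → InDoubleBracket x y) xs → y ∈ T))

-- Eisenstein integers ℤ[ω], ω = (1 + i√3)/2, ω² = ω - 1.
-- The pair (a , b) represents a + b ω.

infix 5 _+ω_
record ℤω : Set where
  constructor _+ω_
  field
    re : ℤ
    im : ℤ

infixl 6 _⊕_
infixl 7 _⊗_

_⊕_ : ℤω → ℤω → ℤω
(a +ω b) ⊕ (c +ω d) = (a ℤ.+ c) +ω (b ℤ.+ d)

_⊗_ : ℤω → ℤω → ℤω
(a +ω b) ⊗ (c +ω d) = (a ℤ.* c ℤ.- b ℤ.* d) +ω (a ℤ.* d ℤ.+ b ℤ.* c ℤ.+ b ℤ.* d)

⊖_ : ℤω → ℤω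
⊖ (a +ω b) = (ℤ.- a) +ω (ℤ.- b)

ω0 ω1 ωω ωω̄ : ℤω
ω0  = + 0 +ω + 0
ω1  = + 1 +ω + 0
ωω  = + 0 +ω + 1
ωω̄ = + 1 +ω ℤ.-[1+ 0 ]   -- (1 - i√3)/2 = 1 - ω

fromℤ : ℤ → ℤω
fromℤ a = a +ω + 0

Σω : ∀ {n} → (Fin n → ℤω) → ℤω
Σω {zero}  f = ω0
Σω {suc n} f = f zero ⊕ Σω (λ i → f (suc i))

Πω : ∀ {n} → (Fin n → ℤω) → ℤω
Πω {zero}  f = ω1
Πω {suc n} f = f zero ⊗ Πω (λ i → f (suc i))

det : ∀ n → (Fin n → Fin n → ℤω) → ℤω
det zero    M = ω1
det (suc n) M = Σω λ j →
  sign (toℕ j) (M zero j ⊗ det n (λ i k → M (suc i) (punchIn j k)))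
  where
  sign : ℕ → ℤω → ℤω
  sign zero          z = z
  sign (suc zero)    z = ⊖ z
  sign (suc (suc m)) z = sign m z

δ : ∀ {n} → Fin n → Fin n → ℤω
δ zero    zero    = ω1
δ zero    (suc _) = ω0
δ (suc _) zero    = ω0
δ (suc i) (suc j) = δ i j

-- Mixed Cayley graph Cay(Γ,S) and its Hermitian adjacency matrix of the
-- second kind, indexed by Fin (order Γ) via the enumeration of Γ.

module _ (Γ : FiniteAbelianGroup) where
  open FiniteAbelianGroup Γ
  open Inverse enum using (to)

  arc : Subset Γ → Carrier → Carrier → Bool
  arc S a b = S (b + (- a))

  hEntry : Bool → Bool → ℤω
  hEntry true  true  = ω1
  hEntry true  false = ωω
  hEntry false true  = ωω̄
  hEntry false false = ω0

  HS : Subset Γ → Fin order → Fin order → ℤω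
  HS S i j = hEntry (arc S (to i) (to j)) (arc S (to j) (to i))

  charPolyAt : Subset Γ → ℤ → ℤω
  charPolyAt S x = det order (λ i j → fromℤ x ⊗ δ i j ⊕ ⊖ HS S i j)

  -- HS-integral: all eigenvalues of H (roots of the characteristic
  -- polynomial, with multiplicity) are integers, i.e. det(xI - H) =
  -- ∏ᵢ (x - λᵢ) for some integers λ₁..λₙ (identity of polynomials,
  -- checked at all integer points, which determines a polynomial).
  HSIntegral : Subset Γ → Set
  HSIntegral S = ∃ λ (ev : Fin order → ℤ) →
    ∀ x → charPolyAt S x ≡ Πω (λ i → fromℤ (x ℤ.- ev i))

{-# OPTIONS --safe #-}
-- Multiplication by F = Σ f(g) [g], where f(g) is the entry of the Hermitian matrix between 0 and g,
-- acts on ℤ[ω][Γ] with matrix H.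
--
-- Suppose that the characteristic polynomial of H is ∏ (x − λᵢ) with integers λᵢ.  The elements [−g]
-- form a left null vector of F·1 − H, so ∏ (F − λᵢ) = 0.  Let p be a prime not dividing 3 |Γ| and
-- reduce modulo p.  Since xᵖ − x is divisible by x − λᵢ, Fᵖ − F is nilpotent; as (Σ u(g) [g])ᵖ =
-- Σ u(g)ᵖ [p g] and g ↦ p g is bijective, the reduction of ℤ[ω][Γ] is reduced, so Fᵖ = F.  Comparing
-- coefficients, f(p g) is f(g) or its conjugate according to p modulo 3.  Factoring integers into
-- primes, f(k g) = f(g) for all k ≡ 1 (mod 3) prime to |Γ|, and residues modulo the order of g lift
-- to such k; this is the condition on S.
--
-- Conversely, the condition makes f an integral combination of characters E of subgroups with values
-- in ℤ[ω], extended by zero: these functions are closed under products and contain the indicators of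
-- subgroups.  Since E ⋆ E = h E with h > 0, every vector u satisfies h u = u ⋆ E + (h u − u ⋆ E), a sum
-- of eigenvectors.  Starting from the standard basis, one may therefore replace the basis vectors one
-- after the other by simultaneous eigenvectors, keeping the determinant nonzero; the eigenvalues
-- of F on the resulting basis are integers.
module Submission where

open import Defs hiding (_·_; _∈_; det)
open import Data.Product using (∃; _×_; _,_; proj₁; proj₂)
open import Relation.Binary.PropositionalEquality as ≡ using (_≡_; _≢_)
open import Data.Bool using (Bool; true; false; _∨_; _∧_; not)
open import Function.Bundles using (_⇔_; mk⇔)
open import Algebra.Bundles using (AbelianGroup; CommutativeRing)
open import Algebra.Structures using (IsCommutativeRing)
open import Data.Empty using (⊥-elim)
open import Data.Fin using (Fin; zero; suc; toℕ; fromℕ; fromℕ<; inject₁; punchIn)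
open import Data.Fin.Permutation using (Permutation′; _⟨$⟩ʳ_; permutation)
open import Data.Integer as ℤ using (ℤ; +_; -[1+_]; ∣_∣)
open import Data.Integer.Tactic.RingSolver using (solve-∀)
open import Data.List using (List; []; _∷_; allFin; filter; map)
open import Data.List.Membership.Propositional using (_∈_; find; lose)
open import Data.List.Membership.Propositional.Properties using (∈-allFin; ∈-filter⁺; ∈-filter⁻; ∈-map⁺)
open import Data.List.Relation.Unary.All using (All; []; _∷_)
open import Data.List.Relation.Unary.All.Properties using (filter⁺)
open import Data.List.Relation.Unary.Any using (Any; here; there)
open import Data.Nat as ℕ using (ℕ; zero; suc; _∸_; _!; _%_; _/_; _<_; _≤_; z≤n; s≤s; z<s; s<s; NonZero)
open import Data.Nat.Combinatorics using (_C_; nCn≡1; k![n∸k]!∣n!)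
open import Data.Nat.Combinatorics.Specification using (nCk≡n!/k![n-k]!)
open import Data.Nat.Coprimality using (Coprime; coprime⇒gcd≡1; gcd≡1⇒coprime; coprime-Bézout)
open import Data.Nat.Divisibility using (_∣_; _∣?_; _∣0; divides; ∣-refl; ∣-trans; ∣-antisym; ∣1⇒≡1; 0∣⇒≡0; ∣⇒≤; m∣m*n; n∣m*n; ∣m⇒∣m*n; ∣n⇒∣m*n; ∣m+n∣m⇒∣n; ∣m∣n⇒∣m+n; m%n≡0⇒n∣m; n∣m⇒m%n≡0; %-presˡ-∣)
open import Data.Nat.DivMod using (m%n<n; m≡m%n+[m/n]*n; m/n*n≡m; [m+kn]%n≡m%n; m∣n⇒o%n%m≡o%m; %-distribˡ-+; %-distribˡ-*)
open import Data.Nat.GCD using (module Bézout)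
open import Data.Nat.Induction using (<-rec)
open import Data.Nat.ListAction using (product)
open import Data.Nat.ListAction.Properties using (∈⇒∣product)
open import Data.Nat.Primality using (Prime; euclidsLemma; prime⇒nonTrivial; prime⇒nonZero)
open import Data.Nat.Primality.Factorisation using (PrimeFactorisation; factorise; factorisationHasAllPrimeFactors)
open import Data.Sum using (_⊎_; inj₁; inj₂)
open import Data.Unit using (⊤)
open import Data.Vec.Functional using (updateAt) renaming (_∷_ to infixr 5 _∷ᵛ_)
open import Data.Vec.Functional.Properties using (updateAt-minimal; updateAt-updates)
open import Function using (_∘_; const; id; Inverse)
open import Function.Properties.Inverse using (↔-sym; ↔⇒↣)
open import Relation.Binary using (DecidableEquality)
open import Relation.Nullary using (Dec; yes; no; does; ¬_; ¬?)
open import Relation.Nullary.Decidable using (dec-true; map′)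
open import Relation.Unary using (Decidable)
import Algebra.Properties.AbelianGroup
import Algebra.Properties.CommutativeMonoid.Sum
import Algebra.Properties.CommutativeSemiring.Binomial
import Algebra.Properties.CommutativeSemiring.Exp
import Algebra.Properties.Group
import Algebra.Properties.Ring
import Algebra.Properties.Semiring.Mult
import Algebra.Properties.Semiring.Sum
import Algebra.Solver.Ring.NaturalCoefficients.Default
import Data.Bool.Properties as Bool
import Data.Fin.Properties as Fin
import Data.Integer.Properties as ℤ
import Data.List.Relation.Unary.All as All
import Data.List.Relation.Unary.Any as Any
import Data.Nat.Coprimality as Coprime
import Data.Nat.Properties as ℕ
import Defs
import Level
import Relation.Binary.Reasoning.Setoid

-- The eigenvalues of H are character sums in a cyclotomic field that grows with the exponent of Γ,
-- and it is the Galois group of that field over ℚ(ω) that ties integrality to invariance. Here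
-- everything stays in ℤ[ω], its quotients and their group rings, and the Frobenius maps modulo
-- primes take the place of the Galois automorphisms. A congruence modulo a single prime decides
-- membership in S, because the possible entries 0, 1, ω, 1 - ω are pairwise incongruent modulo
-- every prime. The prime 3 is excluded because ℤ[ω]/3 has nilpotents, the prime divisors of |Γ|
-- because g ↦ p g must be injective. A multiplier k ≡ 1 (mod 3) can have prime factors ≡ 2, so the
-- conjugating primes have to be tracked as well. In the converse, a basis of characters of Γ would
-- live in the large field, and the idempotent E/h would require division. Hence vectors are scaled
-- by h, and bases are replaced by |Γ| rows with nonzero determinant; such a determinant can be
-- cancelled because ℤ[ω] is a domain.

module FiniteSum {c ℓ} (K : CommutativeRing c ℓ) where
  open CommutativeRing K hiding (zero)
  private module S = Algebra.Properties.Semiring.Sum semiring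

  opaque
    -- Opaque: outside this block sums are known only through the equations proved in it, and goals
    -- do not unfold.
    ∑ : ∀ {n} → (Fin n → Carrier) → Carrier
    ∑ = S.sum

    ∑-empty : (f : Fin 0 → Carrier) → ∑ f ≈ 0#
    ∑-empty f = refl

    ∑-suc : ∀ {n} (f : Fin (suc n) → Carrier) → ∑ f ≈ f zero + ∑ (f ∘ suc)
    ∑-suc f = refl

    ∑-cong : ∀ {n} {f g : Fin n → Carrier} → (∀ i → f i ≈ g i) → ∑ f ≈ ∑ g
    ∑-cong = S.sum-cong-≋

    ∑-+ : ∀ {n} (f g : Fin n → Carrier) → ∑ (λ i → f i + g i) ≈ ∑ f + ∑ g
    ∑-+ = S.∑-distrib-+

    ∑-comm : ∀ {m n} (f : Fin m → Fin n → Carrier) → ∑ (λ i → ∑ (f i)) ≈ ∑ (λ j → ∑ λ i → f i j)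
    ∑-comm = S.∑-comm

    ∑-remove : ∀ {n} j (f : Fin (suc n) → Carrier) → ∑ f ≈ f j + ∑ (f ∘ punchIn j)
    ∑-remove j f = S.sum-remove {i = j} f

    ∑-permute : ∀ {n} (f : Fin n → Carrier) (π : Permutation′ n) → ∑ f ≈ ∑ (λ i → f (π ⟨$⟩ʳ i))
    ∑-permute = S.sum-permute

    *-distribˡ-∑ : ∀ {n} a (f : Fin n → Carrier) → a * ∑ f ≈ ∑ (λ i → a * f i)
    *-distribˡ-∑ = S.*-distribˡ-sum

    *-distribʳ-∑ : ∀ {n} a (f : Fin n → Carrier) → ∑ f * a ≈ ∑ (λ i → f i * a)
    *-distribʳ-∑ = S.*-distribʳ-sum

    ∑≈0 : ∀ {n} {f : Fin n → Carrier} → (∀ i → f i ≈ 0#) → ∑ f ≈ 0#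
    ∑≈0 {n} eq = trans (S.sum-cong-≋ eq) (S.sum-replicate-zero n)

  ∑-single : ∀ {n} j {f : Fin n → Carrier} → (∀ i → i ≢ j → f i ≈ 0#) → ∑ f ≈ f j
  ∑-single {suc n} j {f} off = trans (∑-remove j f)
    (trans (+-congˡ (∑≈0 λ i → off (punchIn j i) (Fin.punchInᵢ≢i j i))) (+-identityʳ (f j)))

module Product {c ℓ} (R : CommutativeRing c ℓ) where
  open CommutativeRing R hiding (zero)

  ∏ : ∀ {n} → (Fin n → Carrier) → Carrier
  ∏ {zero}  f = 1#
  ∏ {suc n} f = f zero * ∏ (f ∘ suc)

-- Determinants

module Determinant {c ℓ} (K : CommutativeRing c ℓ) where
  open CommutativeRing K hiding (zero)
  open FiniteSum K
  open Algebra.Properties.Ring ring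
  open Algebra.Solver.Ring.NaturalCoefficients.Default commutativeSemiring
  open Relation.Binary.Reasoning.Setoid setoid

  Matrix : ℕ → ℕ → Set c
  Matrix m n = Fin m → Fin n → Carrier

  sgn : ℕ → Carrier → Carrier
  sgn zero    x = x
  sgn (suc k) x = - sgn k x

  minor : ∀ {n} → Matrix (suc n) (suc n) → Fin (suc n) → Matrix n n
  minor M j i k = M (suc i) (punchIn j k)

  opaque
    det : ∀ n → Matrix n n → Carrier
    det zero    M = 1#
    det (suc n) M = ∑ λ j → sgn (toℕ j) (M zero j * det n (minor M j))

    det-zero : (M : Matrix 0 0) → det 0 M ≈ 1#
    det-zero M = refl

    det-suc : ∀ n (M : Matrix (suc n) (suc n)) →
              det (suc n) M ≈ ∑ λ j → sgn (toℕ j) (M zero j * det n (minor M j))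
    det-suc n M = refl

  sgn-cong : ∀ k {x y} → x ≈ y → sgn k x ≈ sgn k y
  sgn-cong zero    eq = eq
  sgn-cong (suc k) eq = -‿cong (sgn-cong k eq)

  sgn-0 : ∀ k → sgn k 0# ≈ 0#
  sgn-0 zero    = refl
  sgn-0 (suc k) = trans (-‿cong (sgn-0 k)) -0#≈0#

  sgn-linear : ∀ k a b x y → sgn k (a * x + b * y) ≈ a * sgn k x + b * sgn k y
  sgn-linear zero    a b x y = refl
  sgn-linear (suc k) a b x y = begin
    - sgn k (a * x + b * y)             ≈⟨ -‿cong (sgn-linear k a b x y) ⟩
    - (a * sgn k x + b * sgn k y)       ≈⟨ -‿+-comm _ _ ⟨
    - (a * sgn k x) + - (b * sgn k y)   ≈⟨ +-cong (-‿distribʳ-* _ _) (-‿distribʳ-* _ _) ⟩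
    a * - sgn k x + b * - sgn k y       ∎

  sgn-*ˡ : ∀ k a x → a * sgn k x ≈ sgn k (a * x)
  sgn-*ˡ zero    a x = refl
  sgn-*ˡ (suc k) a x = trans (sym (-‿distribʳ-* _ _)) (-‿cong (sgn-*ˡ k a x))

  sgn-*ʳ : ∀ k a x → sgn k x * a ≈ sgn k (x * a)
  sgn-*ʳ zero    a x = refl
  sgn-*ʳ (suc k) a x = trans (sym (-‿distribˡ-* _ _)) (-‿cong (sgn-*ʳ k a x))

  sum-linear : ∀ {n} a b (x y : Fin n → Carrier) →
               ∑ (λ j → a * x j + b * y j) ≈ a * ∑ x + b * ∑ y
  sum-linear a b x y = trans (∑-+ (λ j → a * x j) (λ j → b * y j))
    (sym (+-cong (*-distribˡ-∑ a x) (*-distribˡ-∑ b y)))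

  -- Rectangular matrices are allowed because fixing the first row leaves a form in one row less
  -- with rows of the same length. Linearity relates three matrices by their entries instead of
  -- updating a row, so it applies to matrices of any syntactic shape.
  record AlternatingForm n m (φ : Matrix n m → Carrier) : Set (c Level.⊔ ℓ) where
    field
      φ-cong      : ∀ {M N} → (∀ i j → M i j ≈ N i j) → φ M ≈ φ N
      linear      : ∀ r a b {M N P} → (∀ j → P r j ≈ a * M r j + b * N r j) →
                    (∀ i → i ≢ r → ∀ j → P i j ≈ M i j) →
                    (∀ i → i ≢ r → ∀ j → P i j ≈ N i j) →
                    φ P ≈ a * φ M + b * φ N
      alternating : ∀ r s {M} → r ≢ s → (∀ j → M r j ≈ M s j) → φ M ≈ 0#

    scale : ∀ r a {M N} → (∀ j → N r j ≈ a * M r j) →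
            (∀ i → i ≢ r → ∀ j → N i j ≈ M i j) → φ N ≈ a * φ M
    scale r a {M} {N} row rest = begin
      φ N                  ≈⟨ linear r a 0# (λ j → trans (row j) (solve 2 (λ x y → x :* y := x :* y :+ con 0 :* y) refl a (M r j))) rest rest ⟩
      a * φ M + 0# * φ M   ≈⟨ solve 2 (λ x y → x :* y :+ con 0 :* y := x :* y) refl a (φ M) ⟩
      a * φ M              ∎

    zero-row : ∀ r {M} → (∀ j → M r j ≈ 0#) → φ M ≈ 0#
    zero-row r {M} row = trans (scale r 0# (λ j → trans (row j) (sym (zeroˡ _))) (λ _ _ _ → refl)) (zeroˡ (φ M))

  restrict : ∀ {n m φ} → AlternatingForm (suc n) m φ → ∀ w → AlternatingForm n m (λ A → φ (w ∷ᵛ A))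
  restrict {φ = φ} alt w = record
    { φ-cong      = λ eq → φ-cong λ { zero j → refl ; (suc i) j → eq i j }
    ; linear      = λ r a b row restM restN → linear (suc r) a b row
        (λ { zero _ j → refl ; (suc i) i≢r → restM i (i≢r ∘ ≡.cong suc) })
        (λ { zero _ j → refl ; (suc i) i≢r → restN i (i≢r ∘ ≡.cong suc) })
    ; alternating = λ r s r≢s eq → alternating (suc r) (suc s) (r≢s ∘ Fin.suc-injective) eq
    }
    where open AlternatingForm alt

  module _ {n m φ} (alt : AlternatingForm (suc (suc n)) m φ) where
    open AlternatingForm alt

    -- Polarisation: the form vanishes on the rows u + v, u + v, and its expansion leaves only the
    -- two mixed terms.
    swap₀₁ : ∀ u v A → φ (u ∷ᵛ v ∷ᵛ A) ≈ - φ (v ∷ᵛ u ∷ᵛ A)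
    swap₀₁ u v A = begin
      φ (u ∷ᵛ v ∷ᵛ A)                           ≈⟨ +-identityʳ _ ⟨
      φ (u ∷ᵛ v ∷ᵛ A) + 0#                      ≈⟨ +-congˡ (-‿inverseʳ (φ (v ∷ᵛ u ∷ᵛ A))) ⟨
      φ (u ∷ᵛ v ∷ᵛ A) + (φ (v ∷ᵛ u ∷ᵛ A) - φ (v ∷ᵛ u ∷ᵛ A))  ≈⟨ +-assoc _ _ _ ⟨
      φ (u ∷ᵛ v ∷ᵛ A) + φ (v ∷ᵛ u ∷ᵛ A) - φ (v ∷ᵛ u ∷ᵛ A)    ≈⟨ +-congʳ zero-sum ⟩
      0# - φ (v ∷ᵛ u ∷ᵛ A)                      ≈⟨ +-identityˡ _ ⟩
      - φ (v ∷ᵛ u ∷ᵛ A)                         ∎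
      where
      u+v : Fin m → Carrier
      u+v j = 1# * u j + 1# * v j

      split₁ : ∀ x → φ (x ∷ᵛ u+v ∷ᵛ A) ≈ 1# * φ (x ∷ᵛ u ∷ᵛ A) + 1# * φ (x ∷ᵛ v ∷ᵛ A)
      split₁ x = linear (suc zero) 1# 1# (λ _ → refl)
        (λ { zero _ _ → refl ; (suc zero) i≢ _ → ⊥-elim (i≢ ≡.refl) ; (suc (suc i)) _ _ → refl })
        (λ { zero _ _ → refl ; (suc zero) i≢ _ → ⊥-elim (i≢ ≡.refl) ; (suc (suc i)) _ _ → refl })

      split₀ : ∀ x → φ (u+v ∷ᵛ x ∷ᵛ A) ≈ 1# * φ (u ∷ᵛ x ∷ᵛ A) + 1# * φ (v ∷ᵛ x ∷ᵛ A)
      split₀ x = linear zero 1# 1# (λ _ → refl)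
        (λ { zero i≢ _ → ⊥-elim (i≢ ≡.refl) ; (suc i) _ _ → refl })
        (λ { zero i≢ _ → ⊥-elim (i≢ ≡.refl) ; (suc i) _ _ → refl })

      diagonal : ∀ x → φ (x ∷ᵛ x ∷ᵛ A) ≈ 0#
      diagonal x = alternating zero (suc zero) (λ ()) (λ _ → refl)

      zero-sum : φ (u ∷ᵛ v ∷ᵛ A) + φ (v ∷ᵛ u ∷ᵛ A) ≈ 0#
      zero-sum = begin
        φ (u ∷ᵛ v ∷ᵛ A) + φ (v ∷ᵛ u ∷ᵛ A)
          ≈⟨ solve 2 (λ x y → x :+ y := con 1 :* (con 1 :* con 0 :+ con 1 :* x) :+ con 1 :* (con 1 :* y :+ con 1 :* con 0)) refl _ _ ⟩
        1# * (1# * 0# + 1# * φ (u ∷ᵛ v ∷ᵛ A)) + 1# * (1# * φ (v ∷ᵛ u ∷ᵛ A) + 1# * 0#)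
          ≈⟨ +-cong (*-congˡ (+-congʳ (*-congˡ (diagonal u)))) (*-congˡ (+-congˡ (*-congˡ (diagonal v)))) ⟨
        1# * (1# * φ (u ∷ᵛ u ∷ᵛ A) + 1# * φ (u ∷ᵛ v ∷ᵛ A)) + 1# * (1# * φ (v ∷ᵛ u ∷ᵛ A) + 1# * φ (v ∷ᵛ v ∷ᵛ A))
          ≈⟨ +-cong (*-congˡ (split₁ u)) (*-congˡ (split₁ v)) ⟨
        1# * φ (u ∷ᵛ u+v ∷ᵛ A) + 1# * φ (v ∷ᵛ u+v ∷ᵛ A)
          ≈⟨ split₀ u+v ⟨
        φ (u+v ∷ᵛ u+v ∷ᵛ A)
          ≈⟨ diagonal u+v ⟩
        0# ∎

  module _ {n m φ} (alt : AlternatingForm (suc n) m φ) where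
    open AlternatingForm alt

    row₀-sum : ∀ {k} (a : Fin k → Carrier) (V : Matrix k m) A →
               φ ((λ c → ∑ λ j → a j * V j c) ∷ᵛ A) ≈ ∑ (λ j → a j * φ (V j ∷ᵛ A))
    row₀-sum {zero}  a V A = trans (zero-row zero (λ _ → ∑-empty _)) (sym (∑-empty _))
    row₀-sum {suc k} a V A = begin
      φ ((λ c → ∑ λ j → a j * V j c) ∷ᵛ A)
        ≈⟨ linear zero (a zero) 1# (λ c → trans (∑-suc _) (+-congˡ (sym (*-identityˡ _))))
             (λ { zero i≢ _ → ⊥-elim (i≢ ≡.refl) ; (suc i) _ _ → refl })
             (λ { zero i≢ _ → ⊥-elim (i≢ ≡.refl) ; (suc i) _ _ → refl }) ⟩
      a zero * φ (V zero ∷ᵛ A) + 1# * φ ((λ c → ∑ λ j → a (suc j) * V (suc j) c) ∷ᵛ A)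
        ≈⟨ +-congˡ (trans (*-identityˡ _) (row₀-sum (a ∘ suc) (V ∘ suc) A)) ⟩
      a zero * φ (V zero ∷ᵛ A) + ∑ (λ j → a (suc j) * φ (V (suc j) ∷ᵛ A))
        ≈⟨ ∑-suc _ ⟨
      ∑ (λ j → a j * φ (V j ∷ᵛ A)) ∎

  -- Multiples of `w` may be dropped from the rows below it. Once the first of those rows is
  -- cleared, it is swapped above `w` and fixed there, so that `w` is again the top row of a smaller
  -- form.
  absorb : ∀ {n m φ} → AlternatingForm (suc n) m φ → ∀ w (a : Fin n → Carrier) {A B : Matrix n m} →
           (∀ i j → A i j ≈ a i * w j + B i j) → φ (w ∷ᵛ A) ≈ φ (w ∷ᵛ B)
  absorb {zero}  alt w a eq = AlternatingForm.φ-cong alt λ { zero _ → refl ; (suc ()) }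
  absorb {suc n} {m} {φ} alt w a {A} {B} eq = begin
    φ (w ∷ᵛ A)                                   ≈⟨ φ-cong (λ { zero _ → refl ; (suc zero) _ → refl ; (suc (suc i)) _ → refl }) ⟩
    φ (w ∷ᵛ A zero ∷ᵛ A ∘ suc)                    ≈⟨ linear (suc zero) (a zero) 1# (λ j → trans (eq zero j) (+-congˡ (sym (*-identityˡ _))))
                                                     (λ { zero _ _ → refl ; (suc zero) i≢ _ → ⊥-elim (i≢ ≡.refl) ; (suc (suc i)) _ _ → refl })
                                                     (λ { zero _ _ → refl ; (suc zero) i≢ _ → ⊥-elim (i≢ ≡.refl) ; (suc (suc i)) _ _ → refl }) ⟩
    a zero * φ (w ∷ᵛ w ∷ᵛ A ∘ suc) + 1# * φ (w ∷ᵛ B zero ∷ᵛ A ∘ suc)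
                                                ≈⟨ +-congʳ (*-congˡ (alternating zero (suc zero) (λ ()) (λ _ → refl))) ⟩
    a zero * 0# + 1# * φ (w ∷ᵛ B zero ∷ᵛ A ∘ suc) ≈⟨ solve 2 (λ x y → x :* con 0 :+ con 1 :* y := y) refl (a zero) _ ⟩
    φ (w ∷ᵛ B zero ∷ᵛ A ∘ suc)                    ≈⟨ swap₀₁ alt w (B zero) (A ∘ suc) ⟩
    - φ (B zero ∷ᵛ w ∷ᵛ A ∘ suc)                  ≈⟨ -‿cong (absorb (restrict alt (B zero)) w (a ∘ suc) (λ i → eq (suc i))) ⟩
    - φ (B zero ∷ᵛ w ∷ᵛ B ∘ suc)                  ≈⟨ swap₀₁ alt w (B zero) (B ∘ suc) ⟨
    φ (w ∷ᵛ B zero ∷ᵛ B ∘ suc)                    ≈⟨ φ-cong (λ { zero _ → refl ; (suc zero) _ → refl ; (suc (suc i)) _ → refl }) ⟩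
    φ (w ∷ᵛ B)                                   ∎
    where open AlternatingForm alt

  -- Row `j` passes the j rows above it by adjacent transpositions, each contributing a sign.
  rotate : ∀ {n m φ} → AlternatingForm (suc n) m φ → ∀ j (M : Matrix (suc n) m) →
           φ (M j ∷ᵛ M ∘ punchIn j) ≈ sgn (toℕ j) (φ M)
  rotate alt zero M = AlternatingForm.φ-cong alt λ { zero _ → refl ; (suc i) _ → refl }
  rotate {suc n} {m} {φ} alt (suc j) M = begin
    φ (M (suc j) ∷ᵛ M ∘ punchIn (suc j))                   ≈⟨ φ-cong (λ { zero _ → refl ; (suc zero) _ → refl ; (suc (suc i)) _ → refl }) ⟩
    φ (M (suc j) ∷ᵛ M zero ∷ᵛ M ∘ suc ∘ punchIn j)          ≈⟨ swap₀₁ alt _ _ _ ⟩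
    - φ (M zero ∷ᵛ M (suc j) ∷ᵛ M ∘ suc ∘ punchIn j)        ≈⟨ -‿cong (rotate (restrict alt (M zero)) j (M ∘ suc)) ⟩
    - sgn (toℕ j) (φ (M zero ∷ᵛ M ∘ suc))                  ≈⟨ -‿cong (sgn-cong (toℕ j) (φ-cong λ { zero _ → refl ; (suc i) _ → refl })) ⟩
    - sgn (toℕ j) (φ M)                                   ∎
    where open AlternatingForm alt

  infixl 7 _·ₘ_
  _·ₘ_ : ∀ {m n k} → Matrix m n → Matrix n k → Matrix m k
  (U ·ₘ M) i j = ∑ λ k → U i k * M k j

  -- Row 0 of the product is a combination of the rows `M j`, and modulo `M j` the other rows
  -- involve only the minor of `U` at j; so the Laplace expansion of `U` appears by itself. With φ
  -- the determinant this is multiplicativity.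
  form-mul : ∀ {n m φ} → AlternatingForm n m φ → ∀ U M → φ (U ·ₘ M) ≈ det n U * φ M
  form-mul {zero} alt U M = trans (AlternatingForm.φ-cong alt (λ ())) (trans (sym (*-identityˡ _)) (*-congʳ (sym (det-zero U))))
  form-mul {suc n} {m} {φ} alt U M = begin
    φ (U ·ₘ M)
      ≈⟨ φ-cong (λ { zero _ → refl ; (suc i) _ → refl }) ⟩
    φ ((U ·ₘ M) zero ∷ᵛ (U ·ₘ M) ∘ suc)
      ≈⟨ row₀-sum alt (U zero) M ((U ·ₘ M) ∘ suc) ⟩
    ∑ (λ j → U zero j * φ (M j ∷ᵛ (U ·ₘ M) ∘ suc))
      ≈⟨ ∑-cong step ⟩
    ∑ (λ j → sgn (toℕ j) (U zero j * det n (minor U j)) * φ M)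
      ≈⟨ *-distribʳ-∑ (φ M) (λ j → sgn (toℕ j) (U zero j * det n (minor U j))) ⟨
    ∑ (λ j → sgn (toℕ j) (U zero j * det n (minor U j))) * φ M
      ≈⟨ *-congʳ (det-suc n U) ⟨
    det (suc n) U * φ M ∎
    where
    open AlternatingForm alt

    step : ∀ j → U zero j * φ (M j ∷ᵛ (U ·ₘ M) ∘ suc) ≈ sgn (toℕ j) (U zero j * det n (minor U j)) * φ M
    step j = begin
      U zero j * φ (M j ∷ᵛ (U ·ₘ M) ∘ suc)
        ≈⟨ *-congˡ (absorb alt (M j) (λ i → U (suc i) j) (λ i c → ∑-remove j (λ k → U (suc i) k * M k c))) ⟩
      U zero j * φ (M j ∷ᵛ (minor U j ·ₘ (M ∘ punchIn j)))
        ≈⟨ *-congˡ (form-mul (restrict alt (M j)) (minor U j) (M ∘ punchIn j)) ⟩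
      U zero j * (det n (minor U j) * φ (M j ∷ᵛ M ∘ punchIn j))
        ≈⟨ *-congˡ (*-congˡ (rotate alt j M)) ⟩
      U zero j * (det n (minor U j) * sgn (toℕ j) (φ M))
        ≈⟨ *-assoc _ _ _ ⟨
      U zero j * det n (minor U j) * sgn (toℕ j) (φ M)
        ≈⟨ trans (sgn-*ˡ (toℕ j) _ _) (sym (sgn-*ʳ (toℕ j) _ _)) ⟩
      sgn (toℕ j) (U zero j * det n (minor U j)) * φ M ∎

  det-cong : ∀ n {M N : Matrix n n} → (∀ i j → M i j ≈ N i j) → det n M ≈ det n N
  det-cong zero    {M} {N} eq = trans (det-zero M) (sym (det-zero N))
  det-cong (suc n) {M} {N} eq = begin
    det (suc n) M                                        ≈⟨ det-suc n M ⟩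
    ∑ (λ j → sgn (toℕ j) (M zero j * det n (minor M j))) ≈⟨ ∑-cong (λ j → sgn-cong (toℕ j)
      (*-cong (eq zero j) (det-cong n λ i k → eq (suc i) (punchIn j k)))) ⟩
    ∑ (λ j → sgn (toℕ j) (N zero j * det n (minor N j))) ≈⟨ det-suc n N ⟨
    det (suc n) N                                        ∎

  det-linear : ∀ n r a b {M N P : Matrix n n} → (∀ j → P r j ≈ a * M r j + b * N r j) →
               (∀ i → i ≢ r → ∀ j → P i j ≈ M i j) → (∀ i → i ≢ r → ∀ j → P i j ≈ N i j) →
               det n P ≈ a * det n M + b * det n N
  det-linear (suc n) r a b {M} {N} {P} row restM restN = begin
    det (suc n) P
      ≈⟨ det-suc n P ⟩
    ∑ (λ j → sgn (toℕ j) (P zero j * d P j))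
      ≈⟨ ∑-cong (λ j → trans (sgn-cong (toℕ j) (step r row restM restN j)) (sgn-linear (toℕ j) a b _ _)) ⟩
    ∑ (λ j → a * sgn (toℕ j) (M zero j * d M j) + b * sgn (toℕ j) (N zero j * d N j))
      ≈⟨ sum-linear a b _ _ ⟩
    a * ∑ (λ j → sgn (toℕ j) (M zero j * d M j)) + b * ∑ (λ j → sgn (toℕ j) (N zero j * d N j))
      ≈⟨ +-cong (*-congˡ (det-suc n M)) (*-congˡ (det-suc n N)) ⟨
    a * det (suc n) M + b * det (suc n) N ∎
    where
    d : Matrix (suc n) (suc n) → Fin (suc n) → Carrier
    d Q j = det n (minor Q j)

    step : ∀ r → (∀ j → P r j ≈ a * M r j + b * N r j) →
           (∀ i → i ≢ r → ∀ j → P i j ≈ M i j) → (∀ i → i ≢ r → ∀ j → P i j ≈ N i j) →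
           ∀ j → P zero j * d P j ≈ a * (M zero j * d M j) + b * (N zero j * d N j)
    step zero row restM restN j = begin
      P zero j * d P j
        ≈⟨ *-congʳ (row j) ⟩
      (a * M zero j + b * N zero j) * d P j
        ≈⟨ solve 5 (λ a x b y z → (a :* x :+ b :* y) :* z := a :* (x :* z) :+ b :* (y :* z)) refl a (M zero j) b (N zero j) (d P j) ⟩
      a * (M zero j * d P j) + b * (N zero j * d P j)
        ≈⟨ +-cong (*-congˡ (*-congˡ (det-cong n λ i k → restM (suc i) (λ ()) (punchIn j k))))
                  (*-congˡ (*-congˡ (det-cong n λ i k → restN (suc i) (λ ()) (punchIn j k)))) ⟩
      a * (M zero j * d M j) + b * (N zero j * d N j) ∎
    step (suc r) row restM restN j = begin
      P zero j * d P j
        ≈⟨ *-congˡ (det-linear n r a b (λ k → row (punchIn j k))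
             (λ i i≢r k → restM (suc i) (i≢r ∘ Fin.suc-injective) (punchIn j k))
             (λ i i≢r k → restN (suc i) (i≢r ∘ Fin.suc-injective) (punchIn j k))) ⟩
      P zero j * (a * d M j + b * d N j)
        ≈⟨ solve 5 (λ a x b y z → z :* (a :* x :+ b :* y) := a :* (z :* x) :+ b :* (z :* y)) refl a (d M j) b (d N j) (P zero j) ⟩
      a * (P zero j * d M j) + b * (P zero j * d N j)
        ≈⟨ +-cong (*-congˡ (*-congʳ (restM zero (λ ()) j))) (*-congˡ (*-congʳ (restN zero (λ ()) j))) ⟩
      a * (M zero j * d M j) + b * (N zero j * d N j) ∎

  -- The double Laplace expansion along two equal rows is indexed by ordered pairs of distinct
  -- columns (j , punchIn j k); the pair reversing (0 , suc k) is (suc k , 0).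
  Cancelling : ∀ m → (Fin (suc m) → Fin m → Carrier) → Set ℓ
  Cancelling zero    t = Level.Lift ℓ ⊤
  Cancelling (suc m) t = (∀ k → t zero k + t (suc k) zero ≈ 0#) ×
                         Cancelling m (λ j k → t (suc j) (suc k))

  cancelling-sum : ∀ m t → Cancelling m t → ∑ (λ j → ∑ (t j)) ≈ 0#
  cancelling-sum zero    t _            = ∑≈0 λ j → ∑-empty (t j)
  cancelling-sum (suc m) t (pair , rest) = begin
    ∑ (λ j → ∑ (t j))
      ≈⟨ trans (∑-suc _) (+-congˡ (∑-cong λ j → ∑-suc (t (suc j)))) ⟩
    ∑ (t zero) + ∑ (λ j → t (suc j) zero + ∑ (λ k → t (suc j) (suc k)))
      ≈⟨ +-congˡ (∑-+ (λ j → t (suc j) zero) _) ⟩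
    ∑ (t zero) + (∑ (λ j → t (suc j) zero) + ∑ (λ j → ∑ (λ k → t (suc j) (suc k))))
      ≈⟨ +-assoc _ _ _ ⟨
    ∑ (t zero) + ∑ (λ j → t (suc j) zero) + ∑ (λ j → ∑ (λ k → t (suc j) (suc k)))
      ≈⟨ +-cong (sym (∑-+ (t zero) (λ j → t (suc j) zero))) (cancelling-sum m _ rest) ⟩
    ∑ (λ k → t zero k + t (suc k) zero) + 0#
      ≈⟨ trans (+-identityʳ _) (∑≈0 pair) ⟩
    0# ∎

  lift : ∀ {m n} → (Fin m → Fin n) → Fin (suc m) → Fin (suc n)
  lift f zero    = zero
  lift f (suc i) = suc (f i)

  -- `D` takes the injection onto the columns that remain after both choices. Leaving it arbitrary
  -- lets the induction replace it by `D ∘ lift`, which keeps column 0 among the remaining ones.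
  doubleTerm : ∀ {n} → (Fin (suc (suc n)) → Carrier) → ((Fin n → Fin (suc (suc n))) → Carrier) →
               Fin (suc (suc n)) → Fin (suc n) → Carrier
  doubleTerm v D j k = sgn (toℕ j) (v j * sgn (toℕ k) (v (punchIn j k) * D (punchIn j ∘ punchIn k)))

  -- Choosing the columns 0 and suc k in either order leaves the same columns, with opposite signs.
  -- If neither chosen column is 0, setting column 0 aside gives a smaller instance.
  expansion-cancelling : ∀ n (v : Fin (suc (suc n)) → Carrier) (D : (Fin n → Fin (suc (suc n))) → Carrier) →
    (∀ {f g} → (∀ i → f i ≡ g i) → D f ≈ D g) →
    Cancelling (suc n) (doubleTerm v D)
  expansion-cancelling n v D D-cong = pair , rest n v D D-cong
    where
    pair : ∀ k → v zero * sgn (toℕ k) (v (suc k) * D (suc ∘ punchIn k)) +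
                 - sgn (toℕ k) (v (suc k) * (v zero * D (punchIn (suc k) ∘ suc))) ≈ 0#
    pair k = begin
      v zero * sgn (toℕ k) (v (suc k) * D (suc ∘ punchIn k)) + - sgn (toℕ k) (v (suc k) * (v zero * D (punchIn (suc k) ∘ suc)))
        ≈⟨ +-cong (sgn-*ˡ (toℕ k) _ _) (-‿cong (sgn-cong (toℕ k)
             (solve 3 (λ x y z → x :* (y :* z) := y :* (x :* z)) refl (v (suc k)) (v zero) _))) ⟩
      sgn (toℕ k) (v zero * (v (suc k) * D (suc ∘ punchIn k))) + - sgn (toℕ k) (v zero * (v (suc k) * D (suc ∘ punchIn k)))
        ≈⟨ -‿inverseʳ _ ⟩
      0# ∎

    Cancelling-cong : ∀ m {t u : Fin (suc m) → Fin m → Carrier} → (∀ j k → u j k ≈ t j k) → Cancelling m t → Cancelling m u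
    Cancelling-cong zero    eq _         = _
    Cancelling-cong (suc m) eq (p , r) = (λ k → trans (+-cong (eq _ _) (eq _ _)) (p k)) ,
      Cancelling-cong m (λ j k → eq (suc j) (suc k)) r

    rest : ∀ n (v : Fin (suc (suc n)) → Carrier) (D : (Fin n → Fin (suc (suc n))) → Carrier) →
      (∀ {f g} → (∀ i → f i ≡ g i) → D f ≈ D g) →
      Cancelling n (λ j k → doubleTerm v D (suc j) (suc k))
    rest zero    v D D-cong = _
    rest (suc n) v D D-cong = Cancelling-cong (suc n) {doubleTerm (v ∘ suc) (D ∘ lift)} {λ j k → doubleTerm v D (suc j) (suc k)}
      -- Both chosen indices are shifted by one, and the two signs this produces cancel.
      (λ j k → trans (-‿cong (sgn-cong (toℕ j) (sym (-‿distribʳ-* _ _))))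
               (trans (sgn-neg (toℕ j) _)
               (sgn-cong (toℕ j) (*-congˡ (sgn-cong (toℕ k) (*-congˡ (D-cong λ { zero → ≡.refl ; (suc i) → ≡.refl })))))))
      (expansion-cancelling n (v ∘ suc) (D ∘ lift) (λ eq → D-cong λ { zero → ≡.refl ; (suc i) → ≡.cong suc (eq i) }))
      where
      sgn-neg : ∀ k x → - sgn k (- x) ≈ sgn k x
      sgn-neg zero    x = -‿involutive x
      sgn-neg (suc k) x = -‿cong (sgn-neg k x)

  det-rows₀₁ : ∀ n {M : Matrix (suc (suc n)) (suc (suc n))} → (∀ j → M zero j ≈ M (suc zero) j) →
               det (suc (suc n)) M ≈ 0#
  det-rows₀₁ n {M} eq = begin
    det (suc (suc n)) M
      ≈⟨ trans (det-suc (suc n) M) (∑-cong λ j → sgn-cong (toℕ j) (*-congˡ (det-suc n (minor M j)))) ⟩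
    ∑ (λ j → sgn (toℕ j) (M zero j * ∑ (inner j)))
      ≈⟨ ∑-cong (λ j → trans (sgn-cong (toℕ j) (*-distribˡ-∑ (M zero j) (inner j))) (sgn-sum (toℕ j) _)) ⟩
    ∑ (λ j → ∑ (λ k → sgn (toℕ j) (M zero j * inner j k)))
      ≈⟨ ∑-cong (λ j → ∑-cong λ k → sgn-cong (toℕ j) (*-congˡ (sgn-cong (toℕ k) (*-congʳ (sym (eq (punchIn j k))))))) ⟩
    ∑ (λ j → ∑ (λ k → sgn (toℕ j) (M zero j * sgn (toℕ k) (M zero (punchIn j k) * D (punchIn j ∘ punchIn k)))))
      ≈⟨ cancelling-sum (suc n) (doubleTerm (M zero) D) (expansion-cancelling n (M zero) D
           (λ f≗g → det-cong n λ i k → reflexive (≡.cong (M (suc (suc i))) (f≗g k)))) ⟩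
    0# ∎
    where
    D : (Fin n → Fin (suc (suc n))) → Carrier
    D f = det n λ i k → M (suc (suc i)) (f k)

    inner : Fin (suc (suc n)) → Fin (suc n) → Carrier
    inner j k = sgn (toℕ k) (M (suc zero) (punchIn j k) * D (punchIn j ∘ punchIn k))

    sgn-sum : ∀ k {n} (x : Fin n → Carrier) → sgn k (∑ x) ≈ ∑ (sgn k ∘ x)
    sgn-sum k {zero}  x = trans (sgn-cong k (∑-empty x)) (trans (sgn-0 k) (sym (∑-empty _)))
    sgn-sum k {suc n} x = begin
      sgn k (∑ x)                                ≈⟨ sgn-cong k (∑-suc x) ⟩
      sgn k (x zero + ∑ (x ∘ suc))               ≈⟨ sgn-cong k (+-cong (*-identityˡ _) (*-identityˡ _)) ⟨
      sgn k (1# * x zero + 1# * ∑ (x ∘ suc))     ≈⟨ sgn-linear k 1# 1# _ _ ⟩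
      1# * sgn k (x zero) + 1# * sgn k (∑ (x ∘ suc))  ≈⟨ +-cong (*-identityˡ _) (trans (*-identityˡ _) (sgn-sum k (x ∘ suc))) ⟩
      sgn k (x zero) + ∑ (sgn k ∘ x ∘ suc)       ≈⟨ ∑-suc _ ⟨
      ∑ (sgn k ∘ x)                              ∎

  DetAlternating : ℕ → Set (c Level.⊔ ℓ)
  DetAlternating n = ∀ r s {M : Matrix n n} → r ≢ s → (∀ j → M r j ≈ M s j) → det n M ≈ 0#

  alternating-minors : ∀ n → DetAlternating n → ∀ r s {M : Matrix (suc n) (suc n)} → r ≢ s →
                       (∀ j → M (suc r) j ≈ M (suc s) j) → det (suc n) M ≈ 0#
  alternating-minors n ih r s {M} r≢s eq = trans (det-suc n M) (∑≈0 λ j → trans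
    (sgn-cong (toℕ j) (trans (*-congˡ (ih r s r≢s (λ k → eq (punchIn j k)))) (zeroʳ (M zero j))))
    (sgn-0 (toℕ j)))

  -- With v = row 0 = row s and w = row 1, expand the vanishing determinant with rows v, w + v, w + v.
  alternating₀ₛ : ∀ n → DetAlternating (suc (suc n)) → ∀ s {M : Matrix (suc (suc (suc n))) (suc (suc (suc n)))} →
                  (∀ j → M zero j ≈ M (suc (suc s)) j) → det (suc (suc (suc n))) M ≈ 0#
  alternating₀ₛ n ih s {M} eq = begin
    det N M                             ≈⟨ solve 1 (λ x → x := con 1 :* (con 1 :* con 0 :+ con 1 :* x) :+ con 1 :* con 0) refl (det N M) ⟩
    1# * (1# * 0# + 1# * det N M) + 1# * 0#
      ≈⟨ +-cong (*-congˡ (trans row-s (+-congʳ (*-congˡ Q₃≈0)))) (*-congˡ Q₂≈0) ⟨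
    1# * det N Q₁ + 1# * det N Q₂       ≈⟨ row-1 ⟨
    det N P                             ≈⟨ P≈0 ⟩
    0#                                  ∎
    where
    N = suc (suc (suc n))

    w+v : Fin N → Carrier
    w+v j = 1# * M (suc zero) j + 1# * M zero j

    at-s : (Fin N → Carrier) → Fin (suc n) → Fin N → Carrier
    at-s x = updateAt (λ i → M (suc (suc i))) s (const x)

    P Q₁ Q₂ Q₃ : Matrix N N
    P  = M zero ∷ᵛ w+v ∷ᵛ at-s w+v
    Q₁ = M zero ∷ᵛ M (suc zero) ∷ᵛ at-s w+v
    Q₂ = M zero ∷ᵛ M zero ∷ᵛ at-s w+v
    Q₃ = M zero ∷ᵛ M (suc zero) ∷ᵛ at-s (M (suc zero))

    at-s-here : ∀ x j → at-s x s j ≈ x j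
    at-s-here x j = reflexive (≡.cong (λ f → f j) (updateAt-updates s (λ i → M (suc (suc i)))))

    at-s-there : ∀ x i → i ≢ s → ∀ j → at-s x i j ≈ M (suc (suc i)) j
    at-s-there x i i≢s j = reflexive (≡.cong (λ f → f j) (updateAt-minimal i s (λ i → M (suc (suc i))) i≢s))

    Q₂≈0 : det N Q₂ ≈ 0#
    Q₂≈0 = det-rows₀₁ (suc n) (λ _ → refl)

    alternating₁ₛ : ∀ x y → det N (x ∷ᵛ y ∷ᵛ at-s y) ≈ 0#
    alternating₁ₛ x y = alternating-minors (suc (suc n)) ih zero (suc s) (λ ()) (λ j → sym (at-s-here y j))

    P≈0 : det N P ≈ 0#
    P≈0 = alternating₁ₛ (M zero) w+v

    Q₃≈0 : det N Q₃ ≈ 0#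
    Q₃≈0 = alternating₁ₛ (M zero) (M (suc zero))

    row-1 : det N P ≈ 1# * det N Q₁ + 1# * det N Q₂
    row-1 = det-linear N (suc zero) 1# 1# (λ _ → refl)
      (λ { zero _ _ → refl ; (suc zero) i≢ _ → ⊥-elim (i≢ ≡.refl) ; (suc (suc i)) _ _ → refl })
      (λ { zero _ _ → refl ; (suc zero) i≢ _ → ⊥-elim (i≢ ≡.refl) ; (suc (suc i)) _ _ → refl })

    row-s : det N Q₁ ≈ 1# * det N Q₃ + 1# * det N M
    row-s = det-linear N (suc (suc s)) 1# 1#
      (λ j → trans (at-s-here w+v j) (+-cong (*-congˡ (sym (at-s-here _ j))) (*-congˡ (eq j))))
      (λ { zero _ _ → refl ; (suc zero) _ _ → refl
         ; (suc (suc i)) i≢ j → trans (at-s-there _ i (i≢ ∘ ≡.cong (λ k → suc (suc k))) j) (sym (at-s-there _ i (i≢ ∘ ≡.cong (λ k → suc (suc k))) j)) })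
      (λ { zero _ _ → refl ; (suc zero) _ _ → refl
         ; (suc (suc i)) i≢ j → at-s-there _ i (i≢ ∘ ≡.cong (λ k → suc (suc k))) j })

  det-alternating : ∀ n → DetAlternating n
  det-alternating (suc n) zero    zero    r≢s eq = ⊥-elim (r≢s ≡.refl)
  det-alternating (suc n) (suc r) (suc s) r≢s eq =
    alternating-minors n (det-alternating n) r s (r≢s ∘ ≡.cong suc) eq
  det-alternating (suc (suc n))       zero (suc zero)    r≢s eq = det-rows₀₁ n eq
  det-alternating (suc (suc (suc n))) zero (suc (suc s)) r≢s eq =
    alternating₀ₛ n (det-alternating (suc (suc n))) s eq
  det-alternating (suc (suc n))       (suc zero)    zero r≢s eq = det-rows₀₁ n (sym ∘ eq)
  det-alternating (suc (suc (suc n))) (suc (suc s)) zero r≢s eq =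
    alternating₀ₛ n (det-alternating (suc (suc n))) s (sym ∘ eq)

  det-form : ∀ n → AlternatingForm n n (det n)
  det-form n = record
    { φ-cong = det-cong n ; linear = det-linear n ; alternating = det-alternating n }

  det-mul : ∀ n U M → det n (U ·ₘ M) ≈ det n U * det n M
  det-mul n = form-mul (det-form n)

  -- Replace row 0 by the combination of all rows with coefficients `w`. That row is zero; by
  -- linearity in it, every term except that of row 0 itself has a repeated row.
  det-null : ∀ n (w : Fin (suc n) → Carrier) (M : Matrix (suc n) (suc n)) →
             (∀ j → ∑ (λ i → w i * M i j) ≈ 0#) → w zero * det (suc n) M ≈ 0#
  det-null n w M null = begin
    w zero * det (suc n) M
      ≈⟨ *-congˡ (det-cong (suc n) λ { zero _ → refl ; (suc i) _ → refl }) ⟩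
    w zero * det (suc n) (M zero ∷ᵛ M ∘ suc)
      ≈⟨ ∑-single zero off ⟨
    ∑ (λ i → w i * det (suc n) (M i ∷ᵛ M ∘ suc))
      ≈⟨ row₀-sum (det-form (suc n)) w M (M ∘ suc) ⟨
    det (suc n) ((λ j → ∑ λ i → w i * M i j) ∷ᵛ M ∘ suc)
      ≈⟨ AlternatingForm.zero-row (det-form (suc n)) zero null ⟩
    0# ∎
    where
    off : ∀ i → i ≢ zero → w i * det (suc n) (M i ∷ᵛ M ∘ suc) ≈ 0#
    off zero    i≢0 = ⊥-elim (i≢0 ≡.refl)
    off (suc i) _   = trans (*-congˡ (det-alternating (suc n) zero (suc i) (λ ()) (λ _ → refl))) (zeroʳ _)

  -- The argument of type `Fin n` excludes the empty matrix, whose determinant is 1.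
  det-vanishes : ∀ {n} → Fin n → (w : Fin n → Carrier) (M : Matrix n n) →
                 (∀ i x → w i * x ≈ 0# → x ≈ 0#) → (∀ j → ∑ (λ i → w i * M i j) ≈ 0#) → det n M ≈ 0#
  det-vanishes {suc n} _ w M cancel null = cancel zero _ (det-null n w M null)

  det-scale-rows : ∀ n (a : Fin n → Carrier) (M : Matrix n n) →
                   det n (λ i j → a i * M i j) ≈ Product.∏ K a * det n M
  det-scale-rows zero    a M = trans (det-cong 0 (λ ())) (sym (*-identityˡ _))
  det-scale-rows (suc n) a M = begin
    det (suc n) (λ i j → a i * M i j)
      ≈⟨ det-suc n _ ⟩
    ∑ (λ j → sgn (toℕ j) (a zero * M zero j * det n (λ i k → a (suc i) * minor M j i k)))
      ≈⟨ ∑-cong (λ j → trans (sgn-cong (toℕ j) (trans (*-congˡ (det-scale-rows n (a ∘ suc) (minor M j)))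
           (solve 4 (λ a m p d → (a :* m) :* (p :* d) := (a :* p) :* (m :* d)) refl (a zero) (M zero j) _ _)))
           (sym (sgn-*ˡ (toℕ j) _ _))) ⟩
    ∑ (λ j → Product.∏ K a * sgn (toℕ j) (M zero j * det n (minor M j)))
      ≈⟨ *-distribˡ-∑ _ _ ⟨
    Product.∏ K a * ∑ (λ j → sgn (toℕ j) (M zero j * det n (minor M j)))
      ≈⟨ *-congˡ (det-suc n M) ⟨
    Product.∏ K a * det (suc n) M ∎

  det-identity : ∀ n (I : Matrix n n) → (∀ i → I i i ≈ 1#) → (∀ i j → i ≢ j → I i j ≈ 0#) → det n I ≈ 1#
  det-identity zero    I diag off = det-zero I
  det-identity (suc n) I diag off = begin
    det (suc n) I
      ≈⟨ det-suc n I ⟩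
    ∑ (λ j → sgn (toℕ j) (I zero j * det n (minor I j)))
      ≈⟨ ∑-single zero (λ { zero j≢0 → ⊥-elim (j≢0 ≡.refl)
                          ; (suc j) _ → trans (sgn-cong (suc (toℕ j)) (trans (*-congʳ (off zero (suc j) (λ ()))) (zeroˡ _))) (sgn-0 (suc (toℕ j))) }) ⟩
    I zero zero * det n (minor I zero)
      ≈⟨ *-cong (diag zero) (det-identity n (minor I zero) (λ i → diag (suc i)) (λ i j i≢j → off (suc i) (suc j) (i≢j ∘ Fin.suc-injective))) ⟩
    1# * 1#
      ≈⟨ *-identityˡ 1# ⟩
    1# ∎

-- Group rings

module GroupFacts (Γ : FiniteAbelianGroup) where
  open FiniteAbelianGroup Γ public
    using (order; enum; isAbelianGroup)
    renaming (Carrier to G; _+_ to infixl 6 _+ᴳ_; 0# to 0ᴳ; -_ to infix 8 -ᴳ_)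
  open Inverse enum public using (to; from)

  abelianGroup : AbelianGroup _ _
  abelianGroup = record { isAbelianGroup = isAbelianGroup }

  open AbelianGroup abelianGroup public
    using () renaming (assoc to +ᴳ-assoc; comm to +ᴳ-comm; identityˡ to +ᴳ-identityˡ; identityʳ to +ᴳ-identityʳ;
                       inverseˡ to +ᴳ-inverseˡ; inverseʳ to +ᴳ-inverseʳ)
  open Algebra.Properties.AbelianGroup abelianGroup public
    using () renaming (⁻¹-∙-comm to -ᴳ-+ᴳ-comm)
  open Algebra.Properties.Group (AbelianGroup.group abelianGroup) public
    using () renaming (⁻¹-involutive to -ᴳ-involutive; ε⁻¹≈ε to -ᴳ-0ᴳ; ∙-cancelˡ to +ᴳ-cancelˡ; ∙-cancelʳ to +ᴳ-cancelʳ;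
                       ⁻¹-injective to -ᴳ-injective; inverseʳ-unique to +ᴳ-inverseʳ-unique)

  to-from : ∀ x → to (from x) ≡ x
  to-from = Inverse.strictlyInverseˡ enum

  from-to : ∀ i → from (to i) ≡ i
  from-to = Inverse.strictlyInverseʳ enum

  infix 4 _≟ᴳ_
  _≟ᴳ_ : DecidableEquality G
  _≟ᴳ_ = Fin.inj⇒≟ (↔⇒↣ (↔-sym enum))

  x+y-x : ∀ x y → x +ᴳ y +ᴳ -ᴳ x ≡ y
  x+y-x = Algebra.Properties.AbelianGroup.xyx⁻¹≈y abelianGroup

  x+[y-x] : ∀ x y → x +ᴳ (y +ᴳ -ᴳ x) ≡ y
  x+[y-x] x y = ≡.trans (≡.sym (+ᴳ-assoc x y (-ᴳ x))) (x+y-x x y)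

  y+x-x : ∀ x y → y +ᴳ x +ᴳ -ᴳ x ≡ y
  y+x-x x y = ≡.trans (≡.cong (_+ᴳ -ᴳ x) (+ᴳ-comm y x)) (x+y-x x y)

  [y-x]+x : ∀ x y → y +ᴳ -ᴳ x +ᴳ x ≡ y
  [y-x]+x x y = ≡.trans (+ᴳ-comm _ x) (x+[y-x] x y)

  y-[y-x] : ∀ x y → y +ᴳ -ᴳ (y +ᴳ -ᴳ x) ≡ x
  y-[y-x] x y = +ᴳ-cancelʳ (y +ᴳ -ᴳ x) _ _
    (≡.trans ([y-x]+x (y +ᴳ -ᴳ x) y) (≡.sym (x+[y-x] x y)))

  -[x-y] : ∀ x y → -ᴳ (x +ᴳ -ᴳ y) ≡ y +ᴳ -ᴳ x
  -[x-y] = Algebra.Properties.AbelianGroup.⁻¹-anti-homo‿- abelianGroup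

  x-[y+z] : ∀ x y z → x +ᴳ -ᴳ (y +ᴳ z) ≡ (x +ᴳ -ᴳ z) +ᴳ -ᴳ y
  x-[y+z] x y z = ≡.trans (≡.cong (x +ᴳ_) (≡.trans (≡.sym (-ᴳ-+ᴳ-comm y z)) (+ᴳ-comm (-ᴳ y) (-ᴳ z))))
    (≡.sym (+ᴳ-assoc x (-ᴳ z) (-ᴳ y)))

module GroupSum {c ℓ} (K : CommutativeRing c ℓ) (Γ : FiniteAbelianGroup) where
  open CommutativeRing K hiding (zero)
  open FiniteSum K
  open GroupFacts Γ
  open Relation.Binary.Reasoning.Setoid setoid

  ∑ᴳ : (G → Carrier) → Carrier
  ∑ᴳ φ = ∑ (φ ∘ to)

  ∑ᴳ-bijection : ∀ (σ τ : G → G) → (∀ x → σ (τ x) ≡ x) → (∀ x → τ (σ x) ≡ x) →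
                 ∀ φ → ∑ᴳ φ ≈ ∑ᴳ (φ ∘ σ)
  ∑ᴳ-bijection σ τ στ τσ φ = trans
    (∑-permute (φ ∘ to) (permutation (from ∘ σ ∘ to) (from ∘ τ ∘ to)
      (λ i → ≡.trans (≡.cong (from ∘ σ) (to-from _)) (≡.trans (≡.cong from (στ (to i))) (from-to i)))
      (λ i → ≡.trans (≡.cong (from ∘ τ) (to-from _)) (≡.trans (≡.cong from (τσ (to i))) (from-to i)))))
    (∑-cong λ i → reflexive (≡.cong φ (to-from (σ (to i)))))

  ∑ᴳ-single : ∀ a {φ} → (∀ x → x ≢ a → φ x ≈ 0#) → ∑ᴳ φ ≈ φ a
  ∑ᴳ-single a {φ} off = trans
    (∑-single (from a) λ i i≢ → off (to i) (λ eq → i≢ (≡.trans (≡.sym (from-to i)) (≡.cong from eq))))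
    (reflexive (≡.cong φ (to-from a)))

  -- The basis element [a] of the group ring.
  indicator : G → G → Carrier
  indicator a x with a ≟ᴳ x
  ... | yes _ = 1#
  ... | no  _ = 0#

  indicator-≡ : ∀ {a x} → a ≡ x → indicator a x ≈ 1#
  indicator-≡ {a} {x} eq with a ≟ᴳ x
  ... | yes _ = refl
  ... | no ne = ⊥-elim (ne eq)

  indicator-≢ : ∀ {a x} → a ≢ x → indicator a x ≈ 0#
  indicator-≢ {a} {x} ne with a ≟ᴳ x
  ... | yes eq = ⊥-elim (ne eq)
  ... | no _   = refl

  ∑ᴳ-indicator : ∀ a (φ : G → Carrier) → ∑ᴳ (λ x → indicator a x * φ x) ≈ φ a
  ∑ᴳ-indicator a φ = begin
    ∑ᴳ (λ x → indicator a x * φ x) ≈⟨ ∑ᴳ-single a {λ x → indicator a x * φ x} (λ x x≢a → trans (*-congʳ (indicator-≢ (x≢a ∘ ≡.sym))) (zeroˡ _)) ⟩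
    indicator a a * φ a            ≈⟨ *-congʳ (indicator-≡ ≡.refl) ⟩
    1# * φ a                       ≈⟨ *-identityˡ _ ⟩
    φ a                            ∎

module GroupRing {c ℓ} (K : CommutativeRing c ℓ) (Γ : FiniteAbelianGroup) where
  open CommutativeRing K hiding (zero)
  open FiniteSum K
  open GroupFacts Γ
  open GroupSum K Γ
  open Relation.Binary.Reasoning.Setoid setoid

  infixl 7 _⋆_
  opaque
    _⋆_ : (G → Carrier) → (G → Carrier) → G → Carrier
    (u ⋆ v) y = ∑ᴳ λ x → u x * v (y +ᴳ -ᴳ x)

    ⋆-def : ∀ u v y → (u ⋆ v) y ≈ ∑ᴳ λ x → u x * v (y +ᴳ -ᴳ x)
    ⋆-def u v y = refl

  ⋆-cong : ∀ {u u′ v v′} → (∀ x → u x ≈ u′ x) → (∀ x → v x ≈ v′ x) → ∀ y → (u ⋆ v) y ≈ (u′ ⋆ v′) y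
  ⋆-cong {u} {u′} {v} {v′} eq eq′ y = begin
    (u ⋆ v) y                           ≈⟨ ⋆-def u v y ⟩
    ∑ᴳ (λ x → u x * v (y +ᴳ -ᴳ x))      ≈⟨ ∑-cong (λ i → *-cong (eq (to i)) (eq′ _)) ⟩
    ∑ᴳ (λ x → u′ x * v′ (y +ᴳ -ᴳ x))    ≈⟨ ⋆-def u′ v′ y ⟨
    (u′ ⋆ v′) y                         ∎

  ⋆-comm : ∀ u v y → (u ⋆ v) y ≈ (v ⋆ u) y
  ⋆-comm u v y = begin
    (u ⋆ v) y                           ≈⟨ ⋆-def u v y ⟩
    ∑ᴳ (λ x → u x * v (y +ᴳ -ᴳ x))
      ≈⟨ ∑ᴳ-bijection (λ x → y +ᴳ -ᴳ x) (λ x → y +ᴳ -ᴳ x) (λ x → y-[y-x] x y) (λ x → y-[y-x] x y) (λ x → u x * v (y +ᴳ -ᴳ x)) ⟩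
    ∑ᴳ (λ x → u (y +ᴳ -ᴳ x) * v (y +ᴳ -ᴳ (y +ᴳ -ᴳ x)))
      ≈⟨ ∑-cong (λ i → trans (*-congˡ (reflexive (≡.cong v (y-[y-x] (to i) y)))) (*-comm _ _)) ⟩
    ∑ᴳ (λ x → v x * u (y +ᴳ -ᴳ x))      ≈⟨ ⋆-def v u y ⟨
    (v ⋆ u) y                           ∎

  ⋆-distribˡ : ∀ u v w y → (u ⋆ (λ x → v x + w x)) y ≈ (u ⋆ v) y + (u ⋆ w) y
  ⋆-distribˡ u v w y = begin
    (u ⋆ (λ x → v x + w x)) y                            ≈⟨ ⋆-def u _ y ⟩
    ∑ᴳ (λ x → u x * (v (y +ᴳ -ᴳ x) + w (y +ᴳ -ᴳ x)))     ≈⟨ ∑-cong (λ i → distribˡ _ _ _) ⟩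
    ∑ᴳ (λ x → u x * v (y +ᴳ -ᴳ x) + u x * w (y +ᴳ -ᴳ x)) ≈⟨ ∑-+ _ _ ⟩
    ∑ᴳ (λ x → u x * v (y +ᴳ -ᴳ x)) + ∑ᴳ (λ x → u x * w (y +ᴳ -ᴳ x)) ≈⟨ +-cong (⋆-def u v y) (⋆-def u w y) ⟨
    (u ⋆ v) y + (u ⋆ w) y                                ∎

  ⋆-assoc : ∀ u v w z → ((u ⋆ v) ⋆ w) z ≈ (u ⋆ (v ⋆ w)) z
  ⋆-assoc u v w z = begin
    ((u ⋆ v) ⋆ w) z
      ≈⟨ ⋆-def (u ⋆ v) w z ⟩
    ∑ᴳ (λ y → (u ⋆ v) y * w (z +ᴳ -ᴳ y))
      ≈⟨ ∑-cong (λ i → trans (*-congʳ (⋆-def u v (to i))) (*-distribʳ-∑ _ _)) ⟩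
    ∑ᴳ (λ y → ∑ᴳ λ x → u x * v (y +ᴳ -ᴳ x) * w (z +ᴳ -ᴳ y))
      ≈⟨ ∑-comm _ ⟩
    ∑ᴳ (λ x → ∑ᴳ λ y → u x * v (y +ᴳ -ᴳ x) * w (z +ᴳ -ᴳ y))
      ≈⟨ ∑-cong (λ i → inner (to i)) ⟩
    ∑ᴳ (λ x → u x * (v ⋆ w) (z +ᴳ -ᴳ x))
      ≈⟨ ⋆-def u (v ⋆ w) z ⟨
    (u ⋆ (v ⋆ w)) z ∎
    where
    inner : ∀ x → ∑ᴳ (λ y → u x * v (y +ᴳ -ᴳ x) * w (z +ᴳ -ᴳ y)) ≈ u x * (v ⋆ w) (z +ᴳ -ᴳ x)
    inner x = begin
      ∑ᴳ (λ y → u x * v (y +ᴳ -ᴳ x) * w (z +ᴳ -ᴳ y))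
        ≈⟨ ∑ᴳ-bijection (_+ᴳ x) (_+ᴳ -ᴳ x) ([y-x]+x x) (y+x-x x) (λ y → u x * v (y +ᴳ -ᴳ x) * w (z +ᴳ -ᴳ y)) ⟩
      ∑ᴳ (λ y → u x * v (y +ᴳ x +ᴳ -ᴳ x) * w (z +ᴳ -ᴳ (y +ᴳ x)))
        ≈⟨ ∑-cong (λ i → trans (*-cong (*-congˡ (reflexive (≡.cong v (y+x-x x (to i)))))
                                       (reflexive (≡.cong w (x-[y+z] z (to i) x))))
                               (*-assoc _ _ _)) ⟩
      ∑ᴳ (λ y → u x * (v y * w (z +ᴳ -ᴳ x +ᴳ -ᴳ y)))
        ≈⟨ *-distribˡ-∑ _ _ ⟨
      u x * ∑ᴳ (λ y → v y * w (z +ᴳ -ᴳ x +ᴳ -ᴳ y))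
        ≈⟨ *-congˡ (⋆-def v w (z +ᴳ -ᴳ x)) ⟨
      u x * (v ⋆ w) (z +ᴳ -ᴳ x) ∎

  indicator-⋆ : ∀ a v y → (indicator a ⋆ v) y ≈ v (y +ᴳ -ᴳ a)
  indicator-⋆ a v y = trans (⋆-def (indicator a) v y) (∑ᴳ-indicator a (λ x → v (y +ᴳ -ᴳ x)))

  ⋆-identityˡ : ∀ v y → (indicator 0ᴳ ⋆ v) y ≈ v y
  ⋆-identityˡ v y = trans (indicator-⋆ 0ᴳ v y)
    (reflexive (≡.cong v (≡.trans (≡.cong (y +ᴳ_) -ᴳ-0ᴳ) (+ᴳ-identityʳ y))))

  groupRing : CommutativeRing c ℓ
  groupRing = record
    { Carrier = G → Carrier
    ; _≈_ = λ u v → ∀ x → u x ≈ v x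
    ; _+_ = λ u v x → u x + v x
    ; _*_ = _⋆_
    ; -_  = λ u x → - u x
    ; 0#  = λ _ → 0#
    ; 1#  = indicator 0ᴳ
    ; isCommutativeRing = record
      { isRing = record
        { +-isAbelianGroup = record
          { isGroup = record
            { isMonoid = record
              { isSemigroup = record
                { isMagma = record
                  { isEquivalence = record
                    { refl = λ _ → refl ; sym = λ p x → sym (p x) ; trans = λ p q x → trans (p x) (q x) }
                  ; ∙-cong = λ p q x → +-cong (p x) (q x)
                  }
                ; assoc = λ u v w x → +-assoc (u x) (v x) (w x)
                }
              ; identity = (λ u x → +-identityˡ (u x)) , (λ u x → +-identityʳ (u x))
              }
            ; inverse = (λ u x → -‿inverseˡ (u x)) , (λ u x → -‿inverseʳ (u x))
            ; ⁻¹-cong = λ p x → -‿cong (p x)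
            }
          ; comm = λ u v x → +-comm (u x) (v x)
          }
        ; *-cong = ⋆-cong
        ; *-assoc = ⋆-assoc
        ; *-identity = ⋆-identityˡ , λ v y → trans (⋆-comm v (indicator 0ᴳ) y) (⋆-identityˡ v y)
        ; distrib = ⋆-distribˡ ,
            λ u v w y → trans (⋆-comm (λ x → v x + w x) u y) (trans (⋆-distribˡ u v w y) (+-cong (⋆-comm u v y) (⋆-comm u w y)))
        }
      ; *-comm = ⋆-comm
      }
    }

  scalar : Carrier → G → Carrier
  scalar a x = indicator 0ᴳ x * a

  scalar-⋆ : ∀ a v y → (scalar a ⋆ v) y ≈ a * v y
  scalar-⋆ a v y = begin
    (scalar a ⋆ v) y                                          ≈⟨ ⋆-def (scalar a) v y ⟩
    ∑ᴳ (λ x → indicator 0ᴳ x * a * v (y +ᴳ -ᴳ x))             ≈⟨ ∑-cong (λ i → *-assoc _ _ _) ⟩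
    ∑ᴳ (λ x → indicator 0ᴳ x * (a * v (y +ᴳ -ᴳ x)))           ≈⟨ ∑ᴳ-indicator 0ᴳ (λ x → a * v (y +ᴳ -ᴳ x)) ⟩
    a * v (y +ᴳ -ᴳ 0ᴳ)                                        ≈⟨ *-congˡ (reflexive (≡.cong v (≡.trans (≡.cong (y +ᴳ_) -ᴳ-0ᴳ) (+ᴳ-identityʳ y)))) ⟩
    a * v y                                                   ∎

  private module R = CommutativeRing groupRing
  open FiniteSum groupRing using () renaming (∑ to ∑ᴿ; ∑-empty to ∑ᴿ-empty; ∑-suc to ∑ᴿ-suc)

  ∑ᴿ-eval : ∀ {n} (f : Fin n → G → Carrier) y → ∑ᴿ f y ≈ ∑ (λ i → f i y)
  ∑ᴿ-eval {zero}  f y = trans (∑ᴿ-empty f y) (sym (∑-empty _))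
  ∑ᴿ-eval {suc n} f y = trans (∑ᴿ-suc f y) (trans (+-congˡ (∑ᴿ-eval (f ∘ suc) y)) (sym (∑-suc _)))

  basis-expansion : ∀ u → ∑ᴿ (λ i → scalar (u (to i)) ⋆ indicator (to i)) R.≈ u
  basis-expansion u y = begin
    ∑ᴿ (λ i → scalar (u (to i)) ⋆ indicator (to i)) y      ≈⟨ ∑ᴿ-eval _ y ⟩
    ∑ (λ i → (scalar (u (to i)) ⋆ indicator (to i)) y)     ≈⟨ ∑-cong (λ i → scalar-⋆ (u (to i)) (indicator (to i)) y) ⟩
    ∑ᴳ (λ x → u x * indicator x y)                         ≈⟨ ∑ᴳ-single y {λ x → u x * indicator x y} (λ x x≢y → trans (*-congˡ (indicator-≢ x≢y)) (zeroʳ _)) ⟩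
    u y * indicator y y                                    ≈⟨ trans (*-congˡ (indicator-≡ ≡.refl)) (*-identityʳ _) ⟩
    u y                                                    ∎

  indicator-⋆-indicator : ∀ a b → indicator a ⋆ indicator b R.≈ indicator (a +ᴳ b)
  indicator-⋆-indicator a b y with a +ᴳ b ≟ᴳ y
  ... | yes eq = trans (indicator-⋆ a _ y) (indicator-≡ (≡.trans (≡.sym (x+y-x a b)) (≡.cong (_+ᴳ -ᴳ a) eq)))
  ... | no  ne = trans (indicator-⋆ a _ y) (indicator-≢ λ eq → ne (≡.trans (≡.cong (a +ᴳ_) eq) (x+[y-x] a y)))

  scalar-cong : ∀ {a b} → a ≈ b → scalar a R.≈ scalar b
  scalar-cong eq x = *-congˡ eq

  scalar-0 : scalar 0# R.≈ R.0#
  scalar-0 x = zeroʳ _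

  scalar-1 : scalar 1# R.≈ R.1#
  scalar-1 x = *-identityʳ _

  scalar-+ : ∀ a b → scalar (a + b) R.≈ scalar a R.+ scalar b
  scalar-+ a b x = distribˡ _ a b

  scalar-* : ∀ a b → scalar (a * b) R.≈ scalar a ⋆ scalar b
  scalar-* a b x = begin
    indicator 0ᴳ x * (a * b)  ≈⟨ *-assoc _ a b ⟨
    indicator 0ᴳ x * a * b    ≈⟨ *-congʳ (*-comm _ a) ⟩
    a * indicator 0ᴳ x * b    ≈⟨ *-assoc a _ b ⟩
    a * scalar b x            ≈⟨ scalar-⋆ a (scalar b) x ⟨
    (scalar a ⋆ scalar b) x   ∎

-- The Frobenius endomorphism

prime∤! : ∀ {p} → Prime p → ∀ m → m < p → ¬ (p ∣ m !)
prime∤! {p} pr zero    _   p∣ = ℕ.nonTrivial⇒≢1 {{prime⇒nonTrivial pr}} (∣1⇒≡1 p∣)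
prime∤! {p} pr (suc m) m<p p∣ with euclidsLemma (suc m) (m !) pr p∣
... | inj₁ p∣m = ℕ.<⇒≱ m<p (∣⇒≤ p∣m)
... | inj₂ p∣! = prime∤! pr m (ℕ.<-trans (ℕ.n<1+n m) m<p) p∣!

prime∣binomial : ∀ {p} → Prime p → ∀ k → 0 < k → k < p → p ∣ (p C k)
prime∣binomial {p@(suc p-1)} pr k 0<k k<p with euclidsLemma (p C k) (k ! ℕ.* (p ∸ k) !) pr p∣product
  where
  k≤p = ℕ.<⇒≤ k<p
  instance _ = k ℕ.!* p ∸ k !≢0

  product≡ : (p C k) ℕ.* (k ! ℕ.* (p ∸ k) !) ≡ p !
  product≡ = ≡.trans (≡.cong (ℕ._* (k ! ℕ.* (p ∸ k) !)) (nCk≡n!/k![n-k]! k≤p)) (m/n*n≡m (k![n∸k]!∣n! k≤p))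

  p∣product : p ∣ (p C k) ℕ.* (k ! ℕ.* (p ∸ k) !)
  p∣product = ≡.subst (p ∣_) (≡.sym product≡) (m∣m*n (p-1 !))
... | inj₁ p∣C = p∣C
... | inj₂ p∣d with euclidsLemma (k !) ((p ∸ k) !) pr p∣d
...   | inj₁ p∣k! = ⊥-elim (prime∤! pr k k<p p∣k!)
...   | inj₂ p∣k! = ⊥-elim (prime∤! pr (p ∸ k) (ℕ.∸-monoʳ-< 0<k (ℕ.<⇒≤ k<p)) p∣k!)

n<p^n : ∀ {p} → 1 < p → ∀ n → n < p ℕ.^ n
n<p^n         1<p zero    = z<s
n<p^n {p} 1<p (suc n) = begin-strict
  suc n         ≤⟨ n<p^n 1<p n ⟩
  p ℕ.^ n       ≡⟨ ℕ.*-identityˡ _ ⟨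
  1 ℕ.* p ℕ.^ n <⟨ ℕ.*-monoˡ-< (p ℕ.^ n) {{ℕ.>-nonZero (ℕ.≤-<-trans ℕ.z≤n (n<p^n 1<p n))}} 1<p ⟩
  p ℕ.^ suc n   ∎
  where open ℕ.≤-Reasoning

module Frobenius {c ℓ} (R : CommutativeRing c ℓ) {p} (pr : Prime p)
                 (char : CommutativeRing._≈_ R
                   (Algebra.Properties.Semiring.Mult._×_ (CommutativeRing.semiring R) p (CommutativeRing.1# R))
                   (CommutativeRing.0# R)) where
  open CommutativeRing R hiding (zero)
  open FiniteSum R
  open Product R
  open Algebra.Properties.Ring ring
  open Algebra.Properties.CommutativeSemiring.Exp commutativeSemiring
  open Algebra.Properties.Semiring.Mult semiring using (×-congʳ; ×-congˡ; ×-assocˡ; ×-homo-1; ×-assoc-*) renaming (_×_ to _·_)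
  open Algebra.Properties.Semiring.Sum semiring using (sum; sum-cong-≋; sum-replicate-zero; sum-init-last)
  open Algebra.Solver.Ring.NaturalCoefficients.Default commutativeSemiring
  open Relation.Binary.Reasoning.Setoid setoid
  private
    module Bin = Algebra.Properties.CommutativeSemiring.Binomial commutativeSemiring
    instance _ = prime⇒nonZero pr

  char-∣ : ∀ {n} → p ∣ n → ∀ x → n · x ≈ 0#
  char-∣ {n} (divides q eq) x = begin
    n · x                     ≈⟨ ×-congˡ eq ⟩
    (q ℕ.* p) · x             ≈⟨ ×-assocˡ x q p ⟨
    q · (p · x)               ≈⟨ ×-congʳ q (×-congʳ p (*-identityˡ x)) ⟨
    q · (p · (1# * x))        ≈⟨ ×-congʳ q (×-assoc-* p 1# x) ⟨
    q · ((p · 1#) * x)        ≈⟨ ×-congʳ q (trans (*-congʳ char) (zeroˡ x)) ⟩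
    q · 0#                    ≈⟨ q·0 q ⟩
    0#                        ∎
    where
    q·0 : ∀ q → q · 0# ≈ 0#
    q·0 zero    = refl
    q·0 (suc q) = trans (+-identityˡ _) (q·0 q)

  frob-+ : ∀ x y → (x + y) ^ p ≈ x ^ p + y ^ p
  frob-+ x y = expand p pr ≡.refl
    where
    -- The exponent is a variable equal to `p`, so that it can be matched as a successor and the
    -- first and last binomial terms split off.
    expand : ∀ n → Prime n → n ≡ p → (x + y) ^ n ≈ x ^ n + y ^ n
    expand (suc m) prn ≡.refl = begin
      (x + y) ^ suc m                                ≈⟨ Bin.theorem (suc m) x y ⟩
      t zero + sum (t ∘ suc)                         ≈⟨ +-congˡ (sum-init-last (t ∘ suc)) ⟩
      t zero + (sum (t ∘ suc ∘ inject₁) + t (suc (fromℕ m)))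
        ≈⟨ +-cong first (+-cong middle last) ⟩
      y ^ suc m + (0# + x ^ suc m)                   ≈⟨ trans (+-congˡ (+-identityˡ _)) (+-comm _ _) ⟩
      x ^ suc m + y ^ suc m                          ∎
      where
      t : Fin (suc (suc m)) → Carrier
      t = Bin.binomialTerm x y (suc m)

      first : t zero ≈ y ^ suc m
      first = trans (×-homo-1 _) (*-identityˡ _)

      middle : sum (t ∘ suc ∘ inject₁) ≈ 0#
      middle = trans
        (sum-cong-≋ λ i → char-∣ (prime∣binomial prn (suc (toℕ (inject₁ i))) z<s
          (≡.subst (λ k → suc k < suc m) (≡.sym (Fin.toℕ-inject₁ i)) (s<s (Fin.toℕ<n i)))) _)
        (sum-replicate-zero m)

      last : t (suc (fromℕ m)) ≈ x ^ suc m
      last = begin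
        (suc m C suc (toℕ (fromℕ m))) · (x ^ suc (toℕ (fromℕ m)) * y ^ (m ∸ toℕ (fromℕ m)))
          ≡⟨ ≡.cong (λ k → (suc m C suc k) · (x ^ suc k * y ^ (m ∸ k))) (Fin.toℕ-fromℕ m) ⟩
        (suc m C suc m) · (x ^ suc m * y ^ (m ∸ m))
          ≡⟨ ≡.cong₂ (λ k l → k · (x ^ suc m * y ^ l)) (nCn≡1 (suc m)) (ℕ.n∸n≡0 m) ⟩
        1 · (x ^ suc m * 1#)
          ≈⟨ trans (×-homo-1 _) (*-identityʳ _) ⟩
        x ^ suc m ∎

  frob-0 : 0# ^ p ≈ 0#
  frob-0 = 0^ p
    where
    0^ : ∀ n → .{{_ : NonZero n}} → 0# ^ n ≈ 0#
    0^ (suc n) = zeroˡ _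

  frob-1 : 1# ^ p ≈ 1#
  frob-1 = 1^ p
    where
    1^ : ∀ n → 1# ^ n ≈ 1#
    1^ zero    = refl
    1^ (suc n) = trans (*-identityˡ _) (1^ n)

  -- Follows from additivity alone, which treats p = 2 together with the odd primes.
  frob-neg : ∀ x → (- x) ^ p ≈ - (x ^ p)
  frob-neg x = +-inverseʳ-unique (x ^ p) _ (begin
    x ^ p + (- x) ^ p  ≈⟨ frob-+ x (- x) ⟨
    (x + - x) ^ p      ≈⟨ ^-congˡ p (-‿inverseʳ x) ⟩
    0# ^ p             ≈⟨ frob-0 ⟩
    0#                 ∎)

  frob-∑ : ∀ {n} (f : Fin n → Carrier) → ∑ f ^ p ≈ ∑ (λ i → f i ^ p)
  frob-∑ {zero}  f = trans (^-congˡ p (∑-empty f)) (trans frob-0 (sym (∑-empty _)))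
  frob-∑ {suc n} f = begin
    ∑ f ^ p                            ≈⟨ ^-congˡ p (∑-suc f) ⟩
    (f zero + ∑ (f ∘ suc)) ^ p         ≈⟨ frob-+ _ _ ⟩
    f zero ^ p + ∑ (f ∘ suc) ^ p       ≈⟨ +-congˡ (frob-∑ (f ∘ suc)) ⟩
    f zero ^ p + ∑ (λ i → f (suc i) ^ p) ≈⟨ ∑-suc _ ⟨
    ∑ (λ i → f i ^ p)                  ∎

  fermat : ∀ n → (n · 1#) ^ p ≈ n · 1#
  fermat zero    = frob-0
  fermat (suc n) = trans (frob-+ _ _) (+-cong frob-1 (fermat n))

  module _ (reduced : ∀ u → u ^ p ≈ 0# → u ≈ 0#) where
    -- The hypothesis `reduced` removes only exponents p. So n is first raised to the power pⁿ ≥ n,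
    -- which is then taken down one factor p at a time.
    nilpotent⇒0 : ∀ u n → u ^ n ≈ 0# → u ≈ 0#
    nilpotent⇒0 u n eq = descend n (begin
      u ^ (p ℕ.^ n)                  ≡⟨ ≡.cong (u ^_) (ℕ.m+[n∸m]≡n n≤) ⟨
      u ^ (n ℕ.+ (p ℕ.^ n ∸ n))      ≈⟨ ^-homo-* u n (p ℕ.^ n ∸ n) ⟩
      u ^ n * u ^ (p ℕ.^ n ∸ n)      ≈⟨ trans (*-congʳ eq) (zeroˡ _) ⟩
      0#                             ∎)
      where
      n≤ : n ≤ p ℕ.^ n
      n≤ = ℕ.<⇒≤ (n<p^n (ℕ.nonTrivial⇒n>1 p {{prime⇒nonTrivial pr}}) n)

      descend : ∀ r → u ^ (p ℕ.^ r) ≈ 0# → u ≈ 0#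
      descend zero    eq = trans (sym (*-identityʳ u)) eq
      descend (suc r) eq = descend r (reduced _ (begin
        (u ^ (p ℕ.^ r)) ^ p          ≈⟨ ^-assocʳ u (p ℕ.^ r) p ⟩
        u ^ (p ℕ.^ r ℕ.* p)          ≡⟨ ≡.cong (u ^_) (ℕ.*-comm (p ℕ.^ r) p) ⟩
        u ^ (p ℕ.^ suc r)            ≈⟨ eq ⟩
        0#                           ∎))

    -- Each factor x − eᵢ divides xᵖ − x = (x − eᵢ)ᵖ − (x − eᵢ), so xᵖ − x is nilpotent.
    frob-fixed : ∀ {n} x (e : Fin n → Carrier) → (∀ i → e i ^ p ≈ e i) →
                 ∏ (λ i → x - e i) ≈ 0# → x ^ p ≈ x
    frob-fixed {n} x e fixed root = x∙y⁻¹≈ε⇒x≈y (x ^ p) x (nilpotent⇒0 y n (begin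
      y ^ n                             ≈⟨ power n e fixed ⟩
      ∏ (λ i → x - e i) * ∏ (λ i → cofactor (e i))  ≈⟨ trans (*-congʳ root) (zeroˡ _) ⟩
      0#                                ∎))
      where
      y = x ^ p - x

      cofactor : Carrier → Carrier
      cofactor a = (x - a) ^ (p ∸ 1) - 1#

      divides-y : ∀ a → a ^ p ≈ a → y ≈ (x - a) * cofactor a
      divides-y a eq = sym (begin
        (x - a) * ((x - a) ^ (p ∸ 1) - 1#)                ≈⟨ distribˡ _ _ _ ⟩
        (x - a) * (x - a) ^ (p ∸ 1) + (x - a) * - 1#      ≈⟨ +-cong (reflexive (≡.cong ((x - a) ^_) (ℕ.suc-pred p))) (trans (sym (-‿distribʳ-* _ _)) (-‿cong (*-identityʳ _))) ⟩
        (x - a) ^ p - (x - a)                             ≈⟨ +-congʳ (trans (frob-+ x (- a)) (+-congˡ (trans (frob-neg a) (-‿cong eq)))) ⟩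
        (x ^ p - a) - (x - a)                             ≈⟨ +-congˡ (-‿+-comm x (- a)) ⟨
        (x ^ p - a) + (- x + - - a)                       ≈⟨ solve 4 (λ xp a′ x′ a″ → (xp :+ a′) :+ (x′ :+ a″) := (xp :+ x′) :+ (a′ :+ a″)) refl (x ^ p) (- a) (- x) (- - a) ⟩
        (x ^ p - x) + (- a + - - a)                       ≈⟨ trans (+-congˡ (-‿inverseʳ (- a))) (+-identityʳ _) ⟩
        x ^ p - x                                         ∎)

      power : ∀ n (e : Fin n → Carrier) → (∀ i → e i ^ p ≈ e i) →
              y ^ n ≈ ∏ (λ i → x - e i) * ∏ (λ i → cofactor (e i))
      power zero    e fixed = sym (*-identityˡ 1#)
      power (suc n) e fixed = begin
        y * y ^ n                                         ≈⟨ *-cong (divides-y (e zero) (fixed zero)) (power n (e ∘ suc) (fixed ∘ suc)) ⟩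
        ((x - e zero) * cofactor (e zero)) * (∏ (λ i → x - e (suc i)) * ∏ (λ i → cofactor (e (suc i))))
          ≈⟨ solve 4 (λ a b c d → (a :* b) :* (c :* d) := (a :* c) :* (b :* d)) refl (x - e zero) (cofactor (e zero)) _ _ ⟩
        ((x - e zero) * ∏ (λ i → x - e (suc i))) * (cofactor (e zero) * ∏ (λ i → cofactor (e (suc i)))) ∎

-- Eisenstein integers

⊗-comm : ∀ x y → x ⊗ y ≡ y ⊗ x
⊗-comm (a +ω b) (c +ω d) = ≡.cong₂ _+ω_ (re a b c d) (im a b c d)
  where
  re : ∀ a b c d → a ℤ.* c ℤ.- b ℤ.* d ≡ c ℤ.* a ℤ.- d ℤ.* b
  re = solve-∀
  im : ∀ a b c d → a ℤ.* d ℤ.+ b ℤ.* c ℤ.+ b ℤ.* d ≡ c ℤ.* b ℤ.+ d ℤ.* a ℤ.+ d ℤ.* b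
  im = solve-∀

⊗-assoc : ∀ x y z → (x ⊗ y) ⊗ z ≡ x ⊗ (y ⊗ z)
⊗-assoc (a +ω b) (c +ω d) (e +ω f) = ≡.cong₂ _+ω_ (re a b c d e f) (im a b c d e f)
  where
  re : ∀ a b c d e f → (a ℤ.* c ℤ.- b ℤ.* d) ℤ.* e ℤ.- (a ℤ.* d ℤ.+ b ℤ.* c ℤ.+ b ℤ.* d) ℤ.* f ≡
       a ℤ.* (c ℤ.* e ℤ.- d ℤ.* f) ℤ.- b ℤ.* (c ℤ.* f ℤ.+ d ℤ.* e ℤ.+ d ℤ.* f)
  re = solve-∀
  im : ∀ a b c d e f →
       (a ℤ.* c ℤ.- b ℤ.* d) ℤ.* f ℤ.+ (a ℤ.* d ℤ.+ b ℤ.* c ℤ.+ b ℤ.* d) ℤ.* e ℤ.+ (a ℤ.* d ℤ.+ b ℤ.* c ℤ.+ b ℤ.* d) ℤ.* f ≡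
       a ℤ.* (c ℤ.* f ℤ.+ d ℤ.* e ℤ.+ d ℤ.* f) ℤ.+ b ℤ.* (c ℤ.* e ℤ.- d ℤ.* f) ℤ.+ b ℤ.* (c ℤ.* f ℤ.+ d ℤ.* e ℤ.+ d ℤ.* f)
  im = solve-∀

⊗-identityˡ : ∀ x → ω1 ⊗ x ≡ x
⊗-identityˡ (a +ω b) = ≡.cong₂ _+ω_ (re a b) (im a b)
  where
  re : ∀ a b → + 1 ℤ.* a ℤ.- + 0 ℤ.* b ≡ a
  re = solve-∀
  im : ∀ a b → + 1 ℤ.* b ℤ.+ + 0 ℤ.* a ℤ.+ + 0 ℤ.* b ≡ b
  im = solve-∀

⊗-distribˡ-⊕ : ∀ x y z → x ⊗ (y ⊕ z) ≡ x ⊗ y ⊕ x ⊗ z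
⊗-distribˡ-⊕ (a +ω b) (c +ω d) (e +ω f) = ≡.cong₂ _+ω_ (re a b c d e f) (im a b c d e f)
  where
  re : ∀ a b c d e f → a ℤ.* (c ℤ.+ e) ℤ.- b ℤ.* (d ℤ.+ f) ≡ (a ℤ.* c ℤ.- b ℤ.* d) ℤ.+ (a ℤ.* e ℤ.- b ℤ.* f)
  re = solve-∀
  im : ∀ a b c d e f → a ℤ.* (d ℤ.+ f) ℤ.+ b ℤ.* (c ℤ.+ e) ℤ.+ b ℤ.* (d ℤ.+ f) ≡
       (a ℤ.* d ℤ.+ b ℤ.* c ℤ.+ b ℤ.* d) ℤ.+ (a ℤ.* f ℤ.+ b ℤ.* e ℤ.+ b ℤ.* f)
  im = solve-∀

⊗-zeroʳ : ∀ x → x ⊗ ω0 ≡ ω0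
⊗-zeroʳ (a +ω b) = ≡.cong₂ _+ω_ (re a b) (im a b)
  where
  re : ∀ a b → a ℤ.* + 0 ℤ.- b ℤ.* + 0 ≡ + 0
  re = solve-∀
  im : ∀ a b → a ℤ.* + 0 ℤ.+ b ℤ.* + 0 ℤ.+ b ℤ.* + 0 ≡ + 0
  im = solve-∀

-- Opaque copies of the operations: _⊕_ and _⊗_ match on record patterns and hence always unfold.
infixl 6 _⊞_
infixl 7 _⊠_
infix  8 ⊟_

opaque
  _⊞_ _⊠_ : ℤω → ℤω → ℤω
  _⊞_ = _⊕_
  _⊠_ = _⊗_

  ⊟_ : ℤω → ℤω
  ⊟_ = ⊖_

  ⊞-def : ∀ x y → x ⊞ y ≡ x ⊕ y
  ⊞-def x y = ≡.refl

  ⊠-def : ∀ x y → x ⊠ y ≡ x ⊗ y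
  ⊠-def x y = ≡.refl

  ⊟-def : ∀ x → ⊟ x ≡ ⊖ x
  ⊟-def x = ≡.refl

  eisenstein-isCommutativeRing : IsCommutativeRing _≡_ _⊞_ _⊠_ ⊟_ ω0 ω1
  eisenstein-isCommutativeRing = record
    { isRing = record
      { +-isAbelianGroup = record
        { isGroup = record
          { isMonoid = record
            { isSemigroup = record
              { isMagma = record { isEquivalence = ≡.isEquivalence ; ∙-cong = ≡.cong₂ _⊕_ }
              ; assoc = λ { (a +ω b) (c +ω d) (e +ω f) → ≡.cong₂ _+ω_ (ℤ.+-assoc a c e) (ℤ.+-assoc b d f) }
              }
            ; identity = (λ { (a +ω b) → ≡.cong₂ _+ω_ (ℤ.+-identityˡ a) (ℤ.+-identityˡ b) })
                       , (λ { (a +ω b) → ≡.cong₂ _+ω_ (ℤ.+-identityʳ a) (ℤ.+-identityʳ b) })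
            }
          ; inverse = (λ { (a +ω b) → ≡.cong₂ _+ω_ (ℤ.+-inverseˡ a) (ℤ.+-inverseˡ b) })
                    , (λ { (a +ω b) → ≡.cong₂ _+ω_ (ℤ.+-inverseʳ a) (ℤ.+-inverseʳ b) })
          ; ⁻¹-cong = ≡.cong ⊖_
          }
        ; comm = λ { (a +ω b) (c +ω d) → ≡.cong₂ _+ω_ (ℤ.+-comm a c) (ℤ.+-comm b d) }
        }
      ; *-cong = ≡.cong₂ _⊗_
      ; *-assoc = ⊗-assoc
      ; *-identity = ⊗-identityˡ , λ x → ≡.trans (⊗-comm x ω1) (⊗-identityˡ x)
      ; distrib = ⊗-distribˡ-⊕ , λ x y z → ≡.trans (⊗-comm (y ⊕ z) x)
          (≡.trans (⊗-distribˡ-⊕ x y z) (≡.cong₂ _⊕_ (⊗-comm x y) (⊗-comm x z)))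
      }
    ; *-comm = ⊗-comm
    }

eisenstein : CommutativeRing Level.0ℓ Level.0ℓ
eisenstein = record
  { Carrier = ℤω ; _≈_ = _≡_ ; _+_ = _⊞_ ; _*_ = _⊠_ ; -_ = ⊟_ ; 0# = ω0 ; 1# = ω1
  ; isCommutativeRing = eisenstein-isCommutativeRing }

infix 4 _≟ω_
_≟ω_ : (x y : ℤω) → Dec (x ≡ y)
(a +ω b) ≟ω (c +ω d) with a ℤ.≟ c | b ℤ.≟ d
... | yes ≡.refl | yes ≡.refl = yes ≡.refl
... | no ne      | _          = no λ { ≡.refl → ne ≡.refl }
... | _          | no ne      = no λ { ≡.refl → ne ≡.refl }

conj : ℤω → ℤω
conj (a +ω b) = (a ℤ.+ b) +ω (ℤ.- b)

norm : ℤω → ℤ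
norm (a +ω b) = a ℤ.* a ℤ.+ a ℤ.* b ℤ.+ b ℤ.* b

conj-⊗ : ∀ x → conj x ⊗ x ≡ fromℤ (norm x)
conj-⊗ (a +ω b) = ≡.cong₂ _+ω_ (re a b) (im a b)
  where
  re : ∀ a b → (a ℤ.+ b) ℤ.* a ℤ.- (ℤ.- b) ℤ.* b ≡ a ℤ.* a ℤ.+ a ℤ.* b ℤ.+ b ℤ.* b
  re = solve-∀
  im : ∀ a b → (a ℤ.+ b) ℤ.* b ℤ.+ (ℤ.- b) ℤ.* a ℤ.+ (ℤ.- b) ℤ.* b ≡ + 0
  im = solve-∀

fromℤ-⊗ : ∀ n a b → fromℤ n ⊗ (a +ω b) ≡ (n ℤ.* a) +ω (n ℤ.* b)
fromℤ-⊗ n a b = ≡.cong₂ _+ω_ (re n a b) (im n a b)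
  where
  re : ∀ n a b → n ℤ.* a ℤ.- + 0 ℤ.* b ≡ n ℤ.* a
  re = solve-∀
  im : ∀ n a b → n ℤ.* b ℤ.+ + 0 ℤ.* a ℤ.+ + 0 ℤ.* b ≡ n ℤ.* b
  im = solve-∀

square≡∣∣ : ∀ a → a ℤ.* a ≡ + (∣ a ∣ ℕ.* ∣ a ∣)
square≡∣∣ (+ zero)  = ≡.refl
square≡∣∣ (+ suc n) = ≡.refl
square≡∣∣ -[1+ n ]  = ≡.refl

∣∣²≡0 : ∀ a → ∣ a ∣ ℕ.* ∣ a ∣ ≡ 0 → a ≡ + 0
∣∣²≡0 a eq with ℕ.m*n≡0⇒m≡0∨n≡0 ∣ a ∣ eq
... | inj₁ z = ℤ.∣i∣≡0⇒i≡0 z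
... | inj₂ z = ℤ.∣i∣≡0⇒i≡0 z

-- 2 (a² + ab + b²) = a² + b² + (a + b)²
norm≡0 : ∀ x → norm x ≡ + 0 → x ≡ ω0
norm≡0 (a +ω b) eq = ≡.cong₂ _+ω_
  (∣∣²≡0 a (ℕ.m+n≡0⇒m≡0 _ (ℕ.m+n≡0⇒m≡0 _ sum≡0)))
  (∣∣²≡0 b (ℕ.m+n≡0⇒n≡0 (∣ a ∣ ℕ.* ∣ a ∣) (ℕ.m+n≡0⇒m≡0 _ sum≡0)))
  where
  identity : ∀ a b → a ℤ.* a ℤ.+ b ℤ.* b ℤ.+ (a ℤ.+ b) ℤ.* (a ℤ.+ b) ≡ + 2 ℤ.* (a ℤ.* a ℤ.+ a ℤ.* b ℤ.+ b ℤ.* b)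
  identity = solve-∀

  sum≡0 : ∣ a ∣ ℕ.* ∣ a ∣ ℕ.+ ∣ b ∣ ℕ.* ∣ b ∣ ℕ.+ ∣ a ℤ.+ b ∣ ℕ.* ∣ a ℤ.+ b ∣ ≡ 0
  sum≡0 = ℤ.+-injective (≡.trans
    (≡.sym (≡.cong₂ ℤ._+_ (≡.cong₂ ℤ._+_ (square≡∣∣ a) (square≡∣∣ b)) (square≡∣∣ (a ℤ.+ b))))
    (≡.trans (identity a b) (≡.cong (+ 2 ℤ.*_) eq)))

-- Multiplication by `conj x` turns the factor x into the integer `norm x`, which is zero only for x
-- = 0.
⊗-zero-divisor : ∀ x y → x ⊗ y ≡ ω0 → x ≡ ω0 ⊎ y ≡ ω0
⊗-zero-divisor x y@(c +ω d) eq = cases (norm x ℤ.≟ + 0)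
  where
  N·y≡0 : (norm x ℤ.* c) +ω (norm x ℤ.* d) ≡ ω0
  N·y≡0 = ≡.trans (≡.sym (fromℤ-⊗ (norm x) c d)) (≡.trans (≡.cong (_⊗ y) (≡.sym (conj-⊗ x)))
    (≡.trans (⊗-assoc (conj x) x y) (≡.trans (≡.cong (conj x ⊗_) eq) (⊗-zeroʳ (conj x)))))

  component : ∀ n e → n ≢ + 0 → n ℤ.* e ≡ + 0 → e ≡ + 0
  component n e ne eq with ℤ.i*j≡0⇒i≡0∨j≡0 n eq
  ... | inj₁ z = ⊥-elim (ne z)
  ... | inj₂ z = z

  cases : Dec (norm x ≡ + 0) → x ≡ ω0 ⊎ y ≡ ω0
  cases (yes z) = inj₁ (norm≡0 x z)
  cases (no ne) = inj₂ (≡.cong₂ _+ω_ (component (norm x) c ne (≡.cong ℤω.re N·y≡0)) (component (norm x) d ne (≡.cong ℤω.im N·y≡0)))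

⊠-zero-divisor : ∀ x y → x ⊠ y ≡ ω0 → x ≡ ω0 ⊎ y ≡ ω0
⊠-zero-divisor x y eq = ⊗-zero-divisor x y (≡.trans (≡.sym (⊠-def x y)) eq)

⊠-cancelˡ-0 : ∀ x y → x ≢ ω0 → x ⊠ y ≡ ω0 → y ≡ ω0
⊠-cancelˡ-0 x y x≢0 eq with ⊠-zero-divisor x y eq
... | inj₁ x≡0 = ⊥-elim (x≢0 x≡0)
... | inj₂ y≡0 = y≡0

fromℤ-+ : ∀ a b → fromℤ (a ℤ.+ b) ≡ fromℤ a ⊞ fromℤ b
fromℤ-+ a b = ≡.sym (⊞-def (fromℤ a) (fromℤ b))

fromℤ-* : ∀ a b → fromℤ (a ℤ.* b) ≡ fromℤ a ⊠ fromℤ b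
fromℤ-* a b = ≡.sym (≡.trans (⊠-def (fromℤ a) (fromℤ b)) (≡.trans (fromℤ-⊗ a b (+ 0)) (≡.cong ((a ℤ.* b) +ω_) (ℤ.*-zeroʳ a))))

fromℤ-neg : ∀ a → fromℤ (ℤ.- a) ≡ ⊟ fromℤ a
fromℤ-neg a = ≡.sym (⊟-def (fromℤ a))

fromℤ-injective : ∀ {a b} → fromℤ a ≡ fromℤ b → a ≡ b
fromℤ-injective ≡.refl = ≡.refl

-- Quotient by a principal ideal

module Quotient {c ℓ} (K : CommutativeRing c ℓ) (a : CommutativeRing.Carrier K) where
  open CommutativeRing K hiding (zero)
  open Algebra.Properties.Ring ring
  open Algebra.Solver.Ring.NaturalCoefficients.Default commutativeSemiring
  open Relation.Binary.Reasoning.Setoid setoid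

  infix 4 _≋_
  -- The quotient keeps the carrier and coarsens equality, so reduction modulo a is the identity on
  -- elements.
  _≋_ : Carrier → Carrier → Set (c Level.⊔ ℓ)
  x ≋ y = ∃ λ z → x ≈ y + a * z

  ≈⇒≋ : ∀ {x y} → x ≈ y → x ≋ y
  ≈⇒≋ eq = 0# , trans eq (solve 2 (λ y a → y := y :+ a :* con 0) refl _ a)

  ≋-sym : ∀ {x y} → x ≋ y → y ≋ x
  ≋-sym {x} {y} (z , eq) = - z , (begin
    y                          ≈⟨ +-identityʳ y ⟨
    y + 0#                     ≈⟨ +-congˡ (-‿inverseʳ (a * z)) ⟨
    y + (a * z - a * z)        ≈⟨ +-assoc _ _ _ ⟨
    y + a * z - a * z          ≈⟨ +-cong eq (sym (-‿distribʳ-* a z)) ⟨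
    x + a * - z                ∎)

  ≋-trans : ∀ {x y z} → x ≋ y → y ≋ z → x ≋ z
  ≋-trans {z = z} (s , eq) (t , eq′) = s + t , trans eq (trans (+-congʳ eq′)
    (solve 4 (λ z a s t → (z :+ a :* t) :+ a :* s := z :+ a :* (s :+ t)) refl z a s t))

  ≋-+ : ∀ {x x′ y y′} → x ≋ x′ → y ≋ y′ → x + y ≋ x′ + y′
  ≋-+ {x′ = x′} {y′ = y′} (s , eq) (t , eq′) = s + t , trans (+-cong eq eq′)
    (solve 5 (λ x y a s t → (x :+ a :* s) :+ (y :+ a :* t) := (x :+ y) :+ a :* (s :+ t)) refl x′ y′ a s t)

  ≋-* : ∀ {x x′ y y′} → x ≋ x′ → y ≋ y′ → x * y ≋ x′ * y′
  ≋-* {x′ = x′} {y′ = y′} (s , eq) (t , eq′) = x′ * t + s * y′ + a * (s * t) , trans (*-cong eq eq′)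
    (solve 5 (λ x y a s t → (x :+ a :* s) :* (y :+ a :* t) := (x :* y) :+ a :* (x :* t :+ s :* y :+ a :* (s :* t))) refl x′ y′ a s t)

  ≋-neg : ∀ {x x′} → x ≋ x′ → - x ≋ - x′
  ≋-neg {x} {x′} (s , eq) = - s , trans (-‿cong eq) (trans (sym (-‿+-comm x′ (a * s))) (+-congˡ (-‿distribʳ-* a s)))

  quotient : CommutativeRing c (c Level.⊔ ℓ)
  quotient = record
    { Carrier = Carrier ; _≈_ = _≋_ ; _+_ = _+_ ; _*_ = _*_ ; -_ = -_ ; 0# = 0# ; 1# = 1#
    ; isCommutativeRing = record
      { isRing = record
        { +-isAbelianGroup = record
          { isGroup = record
            { isMonoid = record
              { isSemigroup = record
                { isMagma = record
                  { isEquivalence = record { refl = ≈⇒≋ refl ; sym = ≋-sym ; trans = ≋-trans }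
                  ; ∙-cong = ≋-+
                  }
                ; assoc = λ x y z → ≈⇒≋ (+-assoc x y z)
                }
              ; identity = (λ x → ≈⇒≋ (+-identityˡ x)) , (λ x → ≈⇒≋ (+-identityʳ x))
              }
            ; inverse = (λ x → ≈⇒≋ (-‿inverseˡ x)) , (λ x → ≈⇒≋ (-‿inverseʳ x))
            ; ⁻¹-cong = ≋-neg
            }
          ; comm = λ x y → ≈⇒≋ (+-comm x y)
          }
        ; *-cong = ≋-*
        ; *-assoc = λ x y z → ≈⇒≋ (*-assoc x y z)
        ; *-identity = (λ x → ≈⇒≋ (*-identityˡ x)) , (λ x → ≈⇒≋ (*-identityʳ x))
        ; distrib = (λ x y z → ≈⇒≋ (distribˡ x y z)) , (λ x y z → ≈⇒≋ (distribʳ x y z))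
        }
      ; *-comm = λ x y → ≈⇒≋ (*-comm x y)
      }
    }

-- Polynomials over ℤ[ω] and their values in an algebra

Poly : Set
Poly = List ℤω

infixl 6 _+ₚ_
infixl 7 _·ₚ_ _*ₚ_

_+ₚ_ : Poly → Poly → Poly
[]      +ₚ d       = d
(a ∷ c) +ₚ []      = a ∷ c
(a ∷ c) +ₚ (b ∷ d) = (a ⊞ b) ∷ (c +ₚ d)

_·ₚ_ : ℤω → Poly → Poly
a ·ₚ []      = []
a ·ₚ (b ∷ c) = (a ⊠ b) ∷ (a ·ₚ c)

_*ₚ_ : Poly → Poly → Poly
[]      *ₚ d = []
(a ∷ c) *ₚ d = a ·ₚ d +ₚ (ω0 ∷ (c *ₚ d))

module Eval {c ℓ} (A : CommutativeRing c ℓ) (ι : ℤω → CommutativeRing.Carrier A)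
            (ι-0 : CommutativeRing._≈_ A (ι ω0) (CommutativeRing.0# A))
            (ι-+ : ∀ x y → CommutativeRing._≈_ A (ι (x ⊞ y)) (CommutativeRing._+_ A (ι x) (ι y)))
            (ι-* : ∀ x y → CommutativeRing._≈_ A (ι (x ⊠ y)) (CommutativeRing._*_ A (ι x) (ι y)))
            (t : CommutativeRing.Carrier A) where
  open CommutativeRing A hiding (zero)
  open Algebra.Solver.Ring.NaturalCoefficients.Default commutativeSemiring
  open Relation.Binary.Reasoning.Setoid setoid

  eval : Poly → Carrier
  eval []      = 0#
  eval (a ∷ c) = ι a + t * eval c

  eval-+ : ∀ c d → eval (c +ₚ d) ≈ eval c + eval d
  eval-+ []      d       = sym (+-identityˡ _)
  eval-+ (a ∷ c) []      = sym (+-identityʳ _)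
  eval-+ (a ∷ c) (b ∷ d) = begin
    ι (a ⊞ b) + t * eval (c +ₚ d)         ≈⟨ +-cong (ι-+ a b) (*-congˡ (eval-+ c d)) ⟩
    ι a + ι b + t * (eval c + eval d)     ≈⟨ solve 5 (λ a b t c d → a :+ b :+ t :* (c :+ d) := (a :+ t :* c) :+ (b :+ t :* d)) refl (ι a) (ι b) t _ _ ⟩
    eval (a ∷ c) + eval (b ∷ d)           ∎

  eval-· : ∀ a c → eval (a ·ₚ c) ≈ ι a * eval c
  eval-· a []      = sym (zeroʳ _)
  eval-· a (b ∷ c) = begin
    ι (a ⊠ b) + t * eval (a ·ₚ c)         ≈⟨ +-cong (ι-* a b) (*-congˡ (eval-· a c)) ⟩
    ι a * ι b + t * (ι a * eval c)        ≈⟨ solve 4 (λ a b t c → a :* b :+ t :* (a :* c) := a :* (b :+ t :* c)) refl (ι a) (ι b) t _ ⟩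
    ι a * eval (b ∷ c)                    ∎

  eval-* : ∀ c d → eval (c *ₚ d) ≈ eval c * eval d
  eval-* []      d = sym (zeroˡ _)
  eval-* (a ∷ c) d = begin
    eval (a ·ₚ d +ₚ (ω0 ∷ (c *ₚ d)))            ≈⟨ eval-+ (a ·ₚ d) (ω0 ∷ (c *ₚ d)) ⟩
    eval (a ·ₚ d) + (ι ω0 + t * eval (c *ₚ d))  ≈⟨ +-cong (eval-· a d) (+-cong ι-0 (*-congˡ (eval-* c d))) ⟩
    ι a * eval d + (0# + t * (eval c * eval d)) ≈⟨ solve 4 (λ a d t c → a :* d :+ (con 0 :+ t :* (c :* d)) := (a :+ t :* c) :* d) refl (ι a) _ t _ ⟩
    eval (a ∷ c) * eval d                       ∎

  eval-zero : ∀ {c} → All (_≡ ω0) c → eval c ≈ 0#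
  eval-zero []               = refl
  eval-zero (≡.refl ∷ zeros) = trans (+-cong ι-0 (*-congˡ (eval-zero zeros))) (solve 1 (λ t → con 0 :+ t :* con 0 := con 0) refl t)

module ℤωEval = Eval eisenstein id ≡.refl (λ _ _ → ≡.refl) (λ _ _ → ≡.refl)

evalℤ : Poly → ℤ → ℤω
evalℤ c x = ℤωEval.eval (fromℤ x) c

-- The modulus exceeds |a|, so among its multiples only 0 has absolute value |a|.
small-multiple : ∀ m a b → a ℤ.+ + suc (∣ a ∣ ℕ.+ m) ℤ.* b ≡ + 0 → a ≡ + 0
small-multiple m a b eq = ℤ.∣i∣≡0⇒i≡0 (bound ∣ b ∣ abs)
  where
  abs : ∣ a ∣ ≡ suc (∣ a ∣ ℕ.+ m) ℕ.* ∣ b ∣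
  abs = ≡.trans (≡.cong ∣_∣ (ℤ.i-j≡0⇒i≡j a (ℤ.- (+ suc (∣ a ∣ ℕ.+ m) ℤ.* b))
                  (≡.trans (≡.cong (λ z → a ℤ.+ z) (ℤ.neg-involutive _)) eq)))
        (≡.trans (ℤ.∣-i∣≡∣i∣ (+ suc (∣ a ∣ ℕ.+ m) ℤ.* b)) (ℤ.abs-* (+ suc (∣ a ∣ ℕ.+ m)) b))

  bound : ∀ k → ∣ a ∣ ≡ suc (∣ a ∣ ℕ.+ m) ℕ.* k → ∣ a ∣ ≡ 0
  bound zero    eq = ≡.trans eq (ℕ.*-zeroʳ (suc (∣ a ∣ ℕ.+ m)))
  bound (suc k) eq = ⊥-elim (ℕ.<-irrefl eq (ℕ.≤-trans (ℕ.s≤s (ℕ.m≤m+n ∣ a ∣ m)) (ℕ.m≤m*n (suc (∣ a ∣ ℕ.+ m)) (suc k))))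

-- The constant coefficient is divisible by every positive integer.
vanishing⇒zeros : ∀ c → (∀ n → evalℤ c (+ suc n) ≡ ω0) → All (_≡ ω0) c
vanishing⇒zeros []                 van = []
vanishing⇒zeros (a@(a₁ +ω a₂) ∷ c) van = a≡0 ∷ vanishing⇒zeros c tail
  where
  components : ∀ n → let q₁ +ω q₂ = evalℤ c (+ suc n) in
               (a₁ ℤ.+ + suc n ℤ.* q₁) +ω (a₂ ℤ.+ + suc n ℤ.* q₂) ≡ ω0
  components n = ≡.trans (≡.sym (⊞-def a _)) (≡.trans (≡.cong (a ⊞_) (≡.sym (≡.trans (⊠-def _ _) (fromℤ-⊗ (+ suc n) _ _)))) (van n))

  a≡0 : a ≡ ω0
  a≡0 = ≡.cong₂ _+ω_
    (small-multiple ∣ a₂ ∣ a₁ _ (≡.cong ℤω.re (components (∣ a₁ ∣ ℕ.+ ∣ a₂ ∣))))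
    (small-multiple ∣ a₁ ∣ a₂ _ (≡.cong ℤω.im (components (∣ a₂ ∣ ℕ.+ ∣ a₁ ∣))))

  -- With the constant coefficient gone, the value is `suc n` times that of the rest; the points are
  -- positive so that this factor can be cancelled.
  tail : ∀ n → evalℤ c (+ suc n) ≡ ω0
  tail n = ⊠-cancelˡ-0 (fromℤ (+ suc n)) (evalℤ c (+ suc n)) (λ ())
    (≡.trans (≡.sym (CommutativeRing.+-identityˡ eisenstein _))
    (≡.trans (≡.cong (_⊞ (fromℤ (+ suc n) ⊠ evalℤ c (+ suc n))) (≡.sym a≡0)) (van n)))

module Polynomial {c ℓ} (A : CommutativeRing c ℓ) (ι : ℤω → CommutativeRing.Carrier A)
            (ι-0 : CommutativeRing._≈_ A (ι ω0) (CommutativeRing.0# A))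
            (ι-1 : CommutativeRing._≈_ A (ι ω1) (CommutativeRing.1# A))
            (ι-+ : ∀ x y → CommutativeRing._≈_ A (ι (x ⊞ y)) (CommutativeRing._+_ A (ι x) (ι y)))
            (ι-* : ∀ x y → CommutativeRing._≈_ A (ι (x ⊠ y)) (CommutativeRing._*_ A (ι x) (ι y)))
            (t : CommutativeRing.Carrier A) where
  open CommutativeRing A hiding (zero)
  open Algebra.Properties.Ring ring
  open Eval A ι ι-0 ι-+ ι-* t
  private
    module E = CommutativeRing eisenstein
    module DetA = Determinant A
    module Detω = Determinant eisenstein
    module Sum = FiniteSum A
    module Sumω = FiniteSum eisenstein

  -- u depends polynomially on an integer, and w is the value of the same polynomial at t.
  Represents : (ℤ → ℤω) → Carrier → Set ℓ
  Represents u w = ∃ λ c → (∀ x → u x ≡ evalℤ c x) × w ≈ eval c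

  represents-cong : ∀ {u u′ w w′} → (∀ x → u′ x ≡ u x) → w′ ≈ w → Represents u w → Represents u′ w′
  represents-cong eq eq′ (c , p , q) = c , (λ x → ≡.trans (eq x) (p x)) , trans eq′ q

  represents-const : ∀ a → Represents (λ _ → a) (ι a)
  represents-const a = a ∷ [] , (λ x → ≡.sym (≡.trans (≡.cong (a ⊞_) (E.zeroʳ (fromℤ x))) (E.+-identityʳ a))) ,
    sym (trans (+-congˡ (zeroʳ t)) (+-identityʳ _))

  represents-id : Represents fromℤ t
  represents-id = ω0 ∷ ω1 ∷ [] ,
    (λ x → ≡.sym (≡.trans (E.+-identityˡ _) (≡.trans (≡.cong (fromℤ x ⊠_) (≡.trans (≡.cong (ω1 ⊞_) (E.zeroʳ (fromℤ x))) (E.+-identityʳ ω1))) (E.*-identityʳ (fromℤ x))))) ,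
    sym (trans (+-congʳ ι-0) (trans (+-identityˡ _) (trans (*-congˡ (trans (+-cong ι-1 (zeroʳ t)) (+-identityʳ 1#))) (*-identityʳ t))))

  represents-+ : ∀ {u v w z} → Represents u w → Represents v z → Represents (λ x → u x ⊞ v x) (w + z)
  represents-+ (c , p , q) (d , p′ , q′) = c +ₚ d ,
    (λ x → ≡.trans (≡.cong₂ _⊞_ (p x) (p′ x)) (≡.sym (ℤωEval.eval-+ (fromℤ x) c d))) ,
    trans (+-cong q q′) (sym (eval-+ c d))

  represents-* : ∀ {u v w z} → Represents u w → Represents v z → Represents (λ x → u x ⊠ v x) (w * z)
  represents-* (c , p , q) (d , p′ , q′) = c *ₚ d ,
    (λ x → ≡.trans (≡.cong₂ _⊠_ (p x) (p′ x)) (≡.sym (ℤωEval.eval-* (fromℤ x) c d))) ,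
    trans (*-cong q q′) (sym (eval-* c d))

  ι-neg : ∀ a → ι (⊟ a) ≈ - ι a
  ι-neg a = +-inverseʳ-unique (ι a) _ (trans (sym (ι-+ a (⊟ a))) (trans (reflexive (≡.cong ι (E.-‿inverseʳ a))) ι-0))

  represents-neg : ∀ {u w} → Represents u w → Represents (λ x → ⊟ u x) (- w)
  represents-neg {u} {w} r = represents-cong
    (λ x → ≡.trans (≡.cong ⊟_ (≡.sym (E.*-identityˡ (u x)))) (Algebra.Properties.Ring.-‿distribˡ-* E.ring ω1 (u x)))
    (trans (-‿cong (sym (*-identityˡ w))) (trans (-‿distribˡ-* 1# w) (*-congʳ (trans (-‿cong (sym ι-1)) (sym (ι-neg ω1))))))
    (represents-* (represents-const (⊟ ω1)) r)

  represents-∑ : ∀ {n} {u : Fin n → ℤ → ℤω} {w : Fin n → Carrier} → (∀ i → Represents (u i) (w i)) →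
                 Represents (λ x → Sumω.∑ λ i → u i x) (Sum.∑ w)
  represents-∑ {zero}  r = represents-cong (λ x → Sumω.∑-empty _) (trans (Sum.∑-empty _) (sym ι-0)) (represents-const ω0)
  represents-∑ {suc n} r = represents-cong (λ x → Sumω.∑-suc _) (Sum.∑-suc _) (represents-+ (r zero) (represents-∑ (r ∘ suc)))

  represents-sgn : ∀ k {u w} → Represents u w → Represents (λ x → Detω.sgn k (u x)) (DetA.sgn k w)
  represents-sgn zero    r = r
  represents-sgn (suc k) r = represents-neg (represents-sgn k r)

  represents-det : ∀ n {M : Fin n → Fin n → ℤ → ℤω} {W : DetA.Matrix n n} → (∀ i j → Represents (M i j) (W i j)) →
                   Represents (λ x → Detω.det n λ i j → M i j x) (DetA.det n W)
  represents-det zero    r = represents-cong (λ x → Detω.det-zero _) (trans (DetA.det-zero _) (sym ι-1)) (represents-const ω1)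
  represents-det (suc n) r = represents-cong (λ x → Detω.det-suc n _) (DetA.det-suc n _)
    (represents-∑ λ j → represents-sgn (toℕ j) (represents-* (r zero j) (represents-det n λ i k → r (suc i) (punchIn j k))))

  -- A polynomial is determined by its values at the positive integers. This carries an identity
  -- known only at integer points over to the point t of the algebra A; it will be applied with t
  -- the symbol in the group ring.
  represents-unique : ∀ {u w z} → Represents u w → Represents u z → w ≈ z
  represents-unique {u} {w} {z} r r′ = x∙y⁻¹≈ε⇒x≈y w z (difference (represents-+ r (represents-neg r′)))
    where
    difference : Represents (λ x → u x ⊞ ⊟ u x) (w - z) → w - z ≈ 0#
    difference (d , p , q) = trans q (eval-zero (vanishing⇒zeros d λ n →
      ≡.trans (≡.sym (p (+ suc n))) (E.-‿inverseʳ (u (+ suc n)))))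

-- A primitive cube root of unity: its powers depend on the exponent modulo 3, whereas ω has order
-- 6.
ζ : ℤω
ζ = ⊟ ωω

opaque
  unfolding _⊞_

  ζ³≡1 : ζ ⊠ (ζ ⊠ (ζ ⊠ ω1)) ≡ ω1
  ζ³≡1 = ≡.refl

  ⊟ζ²≡ω̄ : ⊟ (ζ ⊠ (ζ ⊠ ω1)) ≡ ωω̄
  ⊟ζ²≡ω̄ = ≡.refl

  ⊟ζ≡ω : ⊟ ζ ≡ ωω
  ⊟ζ≡ω = ≡.refl

  decompose : ∀ a b → a +ω b ≡ fromℤ a ⊞ fromℤ b ⊠ ωω
  decompose a b = ≡.cong₂ _+ω_ (re a b) (im b)
    where
    re : ∀ a b → a ≡ a ℤ.+ (b ℤ.* + 0 ℤ.- + 0 ℤ.* + 1)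
    re = solve-∀
    im : ∀ b → b ≡ + 0 ℤ.+ (b ℤ.* + 1 ℤ.+ + 0 ℤ.* + 0 ℤ.+ + 0 ℤ.* + 1)
    im = solve-∀

  decompose-conj : ∀ a b → conj (a +ω b) ≡ fromℤ a ⊞ fromℤ b ⊠ ωω̄
  decompose-conj a b = ≡.cong₂ _+ω_ (re a b) (im b)
    where
    re : ∀ a b → a ℤ.+ b ≡ a ℤ.+ (b ℤ.* + 1 ℤ.- + 0 ℤ.* -[1+ 0 ])
    re = solve-∀
    im : ∀ b → ℤ.- b ≡ + 0 ℤ.+ (b ℤ.* -[1+ 0 ] ℤ.+ + 0 ℤ.* + 1 ℤ.+ + 0 ℤ.* -[1+ 0 ])
    im = solve-∀

  multiple-components : ∀ n y z → y ⊞ fromℤ n ⊠ z ≡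
    (ℤω.re y ℤ.+ n ℤ.* ℤω.re z) +ω (ℤω.im y ℤ.+ n ℤ.* ℤω.im z)
  multiple-components n (a +ω b) (c +ω d) = ≡.cong ((a +ω b) ⊕_) (fromℤ-⊗ n c d)

  conj-multiple : ∀ n x z → conj x ≡ ω0 ⊞ fromℤ n ⊠ z → x ≡ ω0 ⊞ fromℤ n ⊠ conj z
  conj-multiple n x@(a +ω b) z@(c +ω d) eq = ≡.trans (conj-involutive a b)
    (≡.trans (≡.cong conj (≡.trans eq (multiple-components n ω0 z)))
    (≡.trans (≡.cong₂ _+ω_ (re n c d) (im n d)) (≡.sym (multiple-components n ω0 (conj z)))))
    where
    conj-involutive : ∀ a b → a +ω b ≡ conj (conj (a +ω b))
    conj-involutive a b = ≡.cong₂ _+ω_ (p a b) (≡.sym (ℤ.neg-involutive b))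
      where
      p : ∀ a b → a ≡ a ℤ.+ b ℤ.+ ℤ.- b
      p = solve-∀
    re : ∀ n c d → (+ 0 ℤ.+ n ℤ.* c) ℤ.+ (+ 0 ℤ.+ n ℤ.* d) ≡ + 0 ℤ.+ n ℤ.* (c ℤ.+ d)
    re = solve-∀
    im : ∀ n d → ℤ.- (+ 0 ℤ.+ n ℤ.* d) ≡ + 0 ℤ.+ n ℤ.* (ℤ.- d)
    im = solve-∀

-- Frobenius on ℤ[ω] modulo a prime

module ModPrime {p} (pr : Prime p) where
  open Quotient eisenstein (fromℤ (+ p)) public using (_≋_; ≈⇒≋; ≋-sym; ≋-trans) renaming (quotient to Kₚ)
  open CommutativeRing Kₚ hiding (zero; _≈_)
  open Algebra.Properties.CommutativeSemiring.Exp commutativeSemiring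
  open Algebra.Properties.Semiring.Mult semiring using () renaming (_×_ to _·_)
  open Relation.Binary.Reasoning.Setoid setoid

  ×-ω1 : ∀ n → n · ω1 ≡ fromℤ (+ n)
  ×-ω1 zero    = ≡.refl
  ×-ω1 (suc n) = ≡.trans (≡.cong (ω1 ⊞_) (×-ω1 n)) (≡.sym (fromℤ-+ (+ 1) (+ n)))

  charₚ : p · ω1 ≋ ω0
  charₚ = ω1 , ≡.trans (×-ω1 p) (≡.sym (≡.trans (E.+-identityˡ _) (E.*-identityʳ (fromℤ (+ p)))))
    where module E = CommutativeRing eisenstein

  private module F = Frobenius Kₚ pr charₚ

  fermatℤ : ∀ a → fromℤ a ^ p ≋ fromℤ a
  fermatℤ (+ n) = begin
    fromℤ (+ n) ^ p          ≈⟨ ^-congˡ p (≈⇒≋ (×-ω1 n)) ⟨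
    (n · ω1) ^ p             ≈⟨ F.fermat n ⟩
    n · ω1                   ≈⟨ ≈⇒≋ (×-ω1 n) ⟩
    fromℤ (+ n)              ∎
  fermatℤ -[1+ n ] = begin
    fromℤ -[1+ n ] ^ p       ≈⟨ ^-congˡ p (≈⇒≋ (fromℤ-neg (+ suc n))) ⟩
    (⊟ fromℤ (+ suc n)) ^ p  ≈⟨ F.frob-neg (fromℤ (+ suc n)) ⟩
    ⊟ (fromℤ (+ suc n) ^ p)  ≈⟨ -‿cong (fermatℤ (+ suc n)) ⟩
    ⊟ fromℤ (+ suc n)        ≈⟨ ≈⇒≋ (fromℤ-neg (+ suc n)) ⟨
    fromℤ -[1+ n ]           ∎

  ζ^p : ∀ r → p % 3 ≡ r → ζ ^ p ≋ ζ ^ r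
  ζ^p r eq = begin
    ζ ^ p                              ≡⟨ ≡.cong (ζ ^_) (m≡m%n+[m/n]*n p 3) ⟩
    ζ ^ (p % 3 ℕ.+ p / 3 ℕ.* 3)        ≡⟨ ≡.cong₂ (λ k l → ζ ^ (k ℕ.+ l)) eq (ℕ.*-comm (p / 3) 3) ⟩
    ζ ^ (r ℕ.+ 3 ℕ.* (p / 3))          ≈⟨ ^-homo-* ζ r (3 ℕ.* (p / 3)) ⟩
    ζ ^ r * ζ ^ (3 ℕ.* (p / 3))        ≈⟨ *-congˡ {ζ ^ r} (^-assocʳ ζ 3 (p / 3)) ⟨
    ζ ^ r * (ζ ^ 3) ^ (p / 3)          ≈⟨ *-congˡ {ζ ^ r} (≋-trans (^-congˡ (p / 3) (≈⇒≋ ζ³≡1)) (one (p / 3))) ⟩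
    ζ ^ r * ω1                         ≈⟨ *-identityʳ (ζ ^ r) ⟩
    ζ ^ r                              ∎
    where
    one : ∀ n → ω1 ^ n ≋ ω1
    one zero    = ≈⇒≋ ≡.refl
    one (suc n) = ≋-trans (*-identityˡ (ω1 ^ n)) (one n)

  ωω^p : ωω ^ p ≋ ⊟ (ζ ^ p)
  ωω^p = ≋-trans (^-congˡ p (≈⇒≋ (≡.sym ⊟ζ≡ω))) (F.frob-neg ζ)

  frob-ℤω : ∀ w → ωω ^ p ≋ w → ∀ a b → (a +ω b) ^ p ≋ fromℤ a ⊞ fromℤ b ⊠ w
  frob-ℤω w eq a b = begin
    (a +ω b) ^ p                           ≈⟨ ^-congˡ p (≈⇒≋ (decompose a b)) ⟩
    (fromℤ a ⊞ fromℤ b ⊠ ωω) ^ p           ≈⟨ F.frob-+ (fromℤ a) (fromℤ b ⊠ ωω) ⟩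
    fromℤ a ^ p + (fromℤ b ⊠ ωω) ^ p       ≈⟨ +-cong (fermatℤ a) (≋-trans (^-distrib-* (fromℤ b) ωω p) (*-cong (fermatℤ b) eq)) ⟩
    fromℤ a ⊞ fromℤ b ⊠ w                  ∎

  frob-id : p % 3 ≡ 1 → ∀ x → x ^ p ≋ x
  frob-id r (a +ω b) = ≋-trans
    (frob-ℤω ωω (≋-trans ωω^p (≋-trans (-‿cong (≋-trans (ζ^p 1 r) (*-identityʳ ζ))) (≈⇒≋ ⊟ζ≡ω))) a b)
    (≈⇒≋ (≡.sym (decompose a b)))

  frob-conj : p % 3 ≡ 2 → ∀ x → x ^ p ≋ conj x
  frob-conj r (a +ω b) = ≋-trans
    (frob-ℤω ωω̄ (≋-trans ωω^p (≋-trans (-‿cong (ζ^p 2 r)) (≈⇒≋ ⊟ζ²≡ω̄))) a b)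
    (≈⇒≋ (≡.sym (decompose-conj a b)))

  -- Frobenius is the identity or conjugation here, hence injective. Modulo 3 the conclusion fails:
  -- (1 + ω)² = 3ω.
  Kₚ-reduced : p % 3 ≡ 1 ⊎ p % 3 ≡ 2 → ∀ x → x ^ p ≋ ω0 → x ≋ ω0
  Kₚ-reduced (inj₁ r) x eq = ≋-trans (≋-sym (frob-id r x)) eq
  Kₚ-reduced (inj₂ r) x eq = unconj (≋-trans (≋-sym (frob-conj r x)) eq)
    where
    unconj : conj x ≋ ω0 → x ≋ ω0
    unconj (z , e) = conj z , conj-multiple (+ p) x z e

  ∣-difference : ∀ a b c → a ≡ b ℤ.+ + p ℤ.* c → p ∣ ∣ a ℤ.- b ∣
  ∣-difference a b c eq = divides ∣ c ∣ (≡.trans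
    (≡.cong ∣_∣ (≡.trans (≡.cong (λ t → t ℤ.- b) eq) (cancel b (+ p) c))) (ℤ.abs-* c (+ p)))
    where
    cancel : ∀ b n c → b ℤ.+ n ℤ.* c ℤ.- b ≡ c ℤ.* n
    cancel = solve-∀

  ≋⇒∣re : ∀ x y → x ≋ y → p ∣ ∣ ℤω.re x ℤ.- ℤω.re y ∣
  ≋⇒∣re x y (z , eq) = ∣-difference (ℤω.re x) (ℤω.re y) (ℤω.re z) (≡.cong ℤω.re (≡.trans eq (multiple-components (+ p) y z)))

  ≋⇒∣im : ∀ x y → x ≋ y → p ∣ ∣ ℤω.im x ℤ.- ℤω.im y ∣
  ≋⇒∣im x y (z , eq) = ∣-difference (ℤω.im x) (ℤω.im y) (ℤω.im z) (≡.cong ℤω.im (≡.trans eq (multiple-components (+ p) y z)))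

-- Coprimality and cyclic subgroups

least : ∀ {P : ℕ → Set} → Decidable P → ∀ n → P n → ∃ λ m → P m × (∀ k → k < m → ¬ P k)
least {P} P? = <-rec _ step
  where
  step : ∀ n → (∀ {k} → k < n → P k → ∃ λ m → P m × (∀ k → k < m → ¬ P k)) → P n → ∃ λ m → P m × (∀ k → k < m → ¬ P k)
  step n ih Pn with ℕ.anyUpTo? P? n
  ... | yes (k , k<n , Pk) = ih k<n Pk
  ... | no none            = n , Pn , λ k k<n Pk → none (k , k<n , Pk)

prime-divisor : ∀ d .{{_ : NonZero d}} → d ≢ 1 → ∃ λ p → Prime p × p ∣ d
prime-divisor d d≢1 with factorise d
... | record { factors = []     ; isFactorisation = eq } = ⊥-elim (d≢1 eq)
... | record { factors = p ∷ ps ; isFactorisation = eq ; factorsPrime = pr ∷ _ } =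
  p , pr , ≡.subst (p ∣_) (≡.sym eq) (m∣m*n (product ps))

no-common-prime⇒coprime : ∀ {a n} → n ≢ 0 → (∀ p → Prime p → p ∣ a → ¬ (p ∣ n)) → Coprime a n
no-common-prime⇒coprime n≢0 none {zero}  (_ , 0∣n)     = ⊥-elim (n≢0 (0∣⇒≡0 0∣n))
no-common-prime⇒coprime n≢0 none {suc d} (d∣a , d∣n) with suc d ℕ.≟ 1
... | yes d≡1 = d≡1
... | no  d≢1 with prime-divisor (suc d) d≢1
...   | p , pr , p∣d = ⊥-elim (none p pr (∣-trans p∣d d∣a) (∣-trans p∣d d∣n))

prime∤coprime : ∀ {p m n} → Prime p → Coprime m n → p ∣ m → ¬ (p ∣ n)
prime∤coprime pr cop p∣m p∣n = ℕ.nonTrivial⇒≢1 {{prime⇒nonTrivial pr}} (cop (p∣m , p∣n))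

-- The multiplier t is the product of the prime factors of n that do not divide k.
lift-coprime : ∀ k m n .{{_ : NonZero n}} → Coprime k m → ∃ λ t → Coprime (k ℕ.+ t ℕ.* m) n
lift-coprime k m n cop = t , no-common-prime⇒coprime (ℕ.≢-nonZero⁻¹ n) common
  where
  open PrimeFactorisation (factorise n)

  ∤k? : Decidable (λ p → ¬ (p ∣ k))
  ∤k? p = ¬? (p ∣? k)

  t : ℕ
  t = product (filter ∤k? factors)

  -- A prime factor of n divides exactly one of the two summands: if it does not divide k, it is a
  -- factor of t; if it does, it divides neither m, by coprimality, nor t.
  common : ∀ p → Prime p → p ∣ k ℕ.+ t ℕ.* m → ¬ (p ∣ n)
  common p pr p∣ p∣n with p ∣? k
  ... | no p∤k = p∤k (∣m+n∣m⇒∣n (≡.subst (p ∣_) (ℕ.+-comm k (t ℕ.* m)) p∣)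
    (∣m⇒∣m*n m (∈⇒∣product (∈-filter⁺ ∤k?
      (factorisationHasAllPrimeFactors pr (≡.subst (p ∣_) isFactorisation p∣n) factorsPrime) p∤k))))
  ... | yes p∣k with euclidsLemma t m pr (∣m+n∣m⇒∣n p∣ p∣k)
  ...   | inj₂ p∣m = prime∤coprime pr cop p∣k p∣m
  ...   | inj₁ p∣t = proj₂ (∈-filter⁻ ∤k? {xs = factors} (factorisationHasAllPrimeFactors pr p∣t (filter⁺ ∤k? factorsPrime))) p∣k

mod-3 : ∀ k → k % 3 ≡ 0 ⊎ k % 3 ≡ 1 ⊎ k % 3 ≡ 2
mod-3 k = cases (k % 3) (m%n<n k 3)
  where
  cases : ∀ r → r < 3 → r ≡ 0 ⊎ r ≡ 1 ⊎ r ≡ 2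
  cases 0 _ = inj₁ ≡.refl
  cases 1 _ = inj₂ (inj₁ ≡.refl)
  cases 2 _ = inj₂ (inj₂ ≡.refl)
  cases (suc (suc (suc _))) (s≤s (s≤s (s≤s ())))

unit-mod-3 : ∀ {k n} → 3 ∣ n → Coprime k n → k % 3 ≡ 1 ⊎ k % 3 ≡ 2
unit-mod-3 {k} 3∣n cop with mod-3 k
... | inj₂ r  = r
... | inj₁ r with cop (m%n≡0⇒n∣m k 3 r , 3∣n)
...   | ()

-- Modulo 3, subtracting 1 is adding 2.
pred-mod-3 : ∀ k r → suc k % 3 ≡ r % 3 → k % 3 ≡ (r ℕ.+ 2) % 3
pred-mod-3 k r eq = ≡.trans (≡.sym ([m+kn]%n≡m%n k 1 3)) (≡.trans (≡.cong (_% 3) (ℕ.+-suc k 2))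
  (≡.trans (%-distribˡ-+ (suc k) 2 3) (≡.trans (≡.cong (λ z → (z ℕ.+ 2) % 3) eq) (≡.sym (%-distribˡ-+ r 2 3)))))

-- Multiples and orders of group elements

module Multiples (Γ : FiniteAbelianGroup) where
  open GroupFacts Γ
  open ≡.≡-Reasoning

  infixr 8 _·_
  _·_ : ℕ → G → G
  _·_ = Defs._·_ Γ

  ·-homo-+ : ∀ m n x → (m ℕ.+ n) · x ≡ m · x +ᴳ n · x
  ·-homo-+ zero    n x = ≡.sym (+ᴳ-identityˡ _)
  ·-homo-+ (suc m) n x = ≡.trans (≡.cong (x +ᴳ_) (·-homo-+ m n x)) (≡.sym (+ᴳ-assoc x _ _))

  ·-assoc : ∀ m n x → (m ℕ.* n) · x ≡ m · (n · x)
  ·-assoc zero    n x = ≡.refl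
  ·-assoc (suc m) n x = ≡.trans (·-homo-+ n (m ℕ.* n) x) (≡.cong (n · x +ᴳ_) (·-assoc m n x))

  ·-comm : ∀ m n x → m · (n · x) ≡ n · (m · x)
  ·-comm m n x = ≡.trans (≡.sym (·-assoc m n x)) (≡.trans (≡.cong (_· x) (ℕ.*-comm m n)) (·-assoc n m x))

  ·-identity : ∀ x → 1 · x ≡ x
  ·-identity = +ᴳ-identityʳ

  ·-0ᴳ : ∀ n → n · 0ᴳ ≡ 0ᴳ
  ·-0ᴳ zero    = ≡.refl
  ·-0ᴳ (suc n) = ≡.trans (+ᴳ-identityˡ _) (·-0ᴳ n)

  ·-distrib-+ᴳ : ∀ n x y → n · (x +ᴳ y) ≡ n · x +ᴳ n · y
  ·-distrib-+ᴳ zero    x y = ≡.sym (+ᴳ-identityˡ _)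
  ·-distrib-+ᴳ (suc n) x y = begin
    x +ᴳ y +ᴳ n · (x +ᴳ y)       ≡⟨ ≡.cong (x +ᴳ y +ᴳ_) (·-distrib-+ᴳ n x y) ⟩
    x +ᴳ y +ᴳ (n · x +ᴳ n · y)   ≡⟨ +ᴳ-assoc x y _ ⟩
    x +ᴳ (y +ᴳ (n · x +ᴳ n · y)) ≡⟨ ≡.cong (x +ᴳ_) (≡.trans (≡.sym (+ᴳ-assoc y _ _)) (≡.trans (≡.cong (_+ᴳ n · y) (+ᴳ-comm y _)) (+ᴳ-assoc _ y _))) ⟩
    x +ᴳ (n · x +ᴳ (y +ᴳ n · y)) ≡⟨ +ᴳ-assoc x _ _ ⟨
    x +ᴳ n · x +ᴳ (y +ᴳ n · y)   ∎

  ·-neg : ∀ n x → n · (-ᴳ x) ≡ -ᴳ (n · x)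
  ·-neg n x = +ᴳ-inverseʳ-unique (n · x) _
    (≡.trans (≡.sym (·-distrib-+ᴳ n x (-ᴳ x))) (≡.trans (≡.cong (n ·_) (+ᴳ-inverseʳ x)) (·-0ᴳ n)))

  -- Translation by x permutes the summands of the sum of all elements of the group.
  order-· : ∀ x → order · x ≡ 0ᴳ
  order-· x = +ᴳ-cancelʳ (sum to) _ _ (begin
    order · x +ᴳ sum to                  ≡⟨ ≡.cong (_+ᴳ sum to) (·-sum order) ⟩
    sum {order} (λ _ → x) +ᴳ sum to      ≡⟨ ∑-distrib-+ (λ _ → x) to ⟨
    sum (λ i → x +ᴳ to i)                ≡⟨ sum-cong-≗ (λ i → ≡.sym (to-from (x +ᴳ to i))) ⟩
    sum (λ i → to (from (x +ᴳ to i)))    ≡⟨ sum-permute to translation ⟨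
    sum to                               ≡⟨ +ᴳ-identityˡ _ ⟨
    0ᴳ +ᴳ sum to                         ∎)
    where
    open Algebra.Properties.CommutativeMonoid.Sum (AbelianGroup.commutativeMonoid abelianGroup)

    ·-sum : ∀ n → n · x ≡ sum {n} (λ _ → x)
    ·-sum zero    = ≡.refl
    ·-sum (suc n) = ≡.cong (x +ᴳ_) (·-sum n)

    translation = permutation (λ i → from (x +ᴳ to i)) (λ i → from (-ᴳ x +ᴳ to i))
      (λ i → ≡.trans (≡.cong (λ y → from (x +ᴳ y)) (to-from _)) (≡.trans (≡.cong from
        (≡.trans (≡.sym (+ᴳ-assoc x (-ᴳ x) (to i))) (≡.trans (≡.cong (_+ᴳ to i) (+ᴳ-inverseʳ x)) (+ᴳ-identityˡ _)))) (from-to i)))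
      (λ i → ≡.trans (≡.cong (λ y → from (-ᴳ x +ᴳ y)) (to-from _)) (≡.trans (≡.cong from
        (≡.trans (≡.sym (+ᴳ-assoc (-ᴳ x) x (to i))) (≡.trans (≡.cong (_+ᴳ to i) (+ᴳ-inverseˡ x)) (+ᴳ-identityˡ _)))) (from-to i)))

  order≢0 : order ≢ 0
  order≢0 eq with ≡.subst Fin eq (from 0ᴳ)
  ... | ()

  coprime-inverse : ∀ p → Coprime p order → ∃ λ q → ∀ x → q · (p · x) ≡ x
  coprime-inverse p cop with coprime-Bézout cop
  ... | Bézout.+- q y eq = q , λ x → begin
    q · (p · x)                     ≡⟨ ·-assoc q p x ⟨
    (q ℕ.* p) · x                     ≡⟨ ≡.cong (_· x) eq ⟨
    (1 ℕ.+ y ℕ.* order) · x             ≡⟨ ≡.cong (x +ᴳ_) (≡.trans (·-assoc y order x) (≡.trans (≡.cong (y ·_) (order-· x)) (·-0ᴳ y))) ⟩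
    x +ᴳ 0ᴳ                         ≡⟨ +ᴳ-identityʳ x ⟩
    x                               ∎
  -- In this case q p acts as -1, so its square acts as the identity and q p q inverts p.
  ... | Bézout.-+ q y eq = q ℕ.* p ℕ.* q , λ x → begin
    (q ℕ.* p ℕ.* q) · (p · x)           ≡⟨ ≡.trans (·-assoc (q ℕ.* p) q (p · x)) (≡.cong ((q ℕ.* p) ·_) (≡.sym (·-assoc q p x))) ⟩
    (q ℕ.* p) · ((q ℕ.* p) · x)         ≡⟨ ≡.cong ((q ℕ.* p) ·_) (negates x) ⟩
    (q ℕ.* p) · (-ᴳ x)                ≡⟨ negates (-ᴳ x) ⟩
    -ᴳ (-ᴳ x)                       ≡⟨ -ᴳ-involutive x ⟩
    x                               ∎
    where
    negates : ∀ x → (q ℕ.* p) · x ≡ -ᴳ x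
    negates x = +ᴳ-inverseʳ-unique x _ (≡.trans (≡.cong (_· x) eq)
      (≡.trans (·-assoc y order x) (≡.trans (≡.cong (y ·_) (order-· x)) (·-0ᴳ y))))

  has-order : ∀ x → ∃ λ m → HasOrder Γ x m
  -- The search runs over `suc k` to exclude the multiple 0, and starts from the order of the group,
  -- which annihilates x.
  has-order x with least (λ k → suc k · x ≟ᴳ 0ᴳ) (ℕ.pred order)
                     (≡.subst (λ n → n · x ≡ 0ᴳ) (≡.sym (ℕ.suc-pred order {{ℕ.≢-nonZero order≢0}})) (order-· x))
  ... | m , zero-m , minimal = suc m , s≤s z≤n , zero-m , λ { (suc k) _ (s≤s k<m) → minimal k k<m }

  module _ {x m} (ord : HasOrder Γ x m) where
    private
      instance
        m-nonZero : NonZero m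
        m-nonZero = ℕ.>-nonZero (proj₁ ord)

    order-multiple : ∀ t → (t ℕ.* m) · x ≡ 0ᴳ
    order-multiple t = ≡.trans (·-assoc t m x) (≡.trans (≡.cong (t ·_) (proj₁ (proj₂ ord))) (·-0ᴳ t))

    ·-shift : ∀ k t → (k ℕ.+ t ℕ.* m) · x ≡ k · x
    ·-shift k t = ≡.trans (·-homo-+ k (t ℕ.* m) x) (≡.trans (≡.cong (k · x +ᴳ_) (order-multiple t)) (+ᴳ-identityʳ _))

    ·-% : ∀ k → (k % m) · x ≡ k · x
    ·-% k = ≡.sym (≡.trans (≡.cong (_· x) (m≡m%n+[m/n]*n k m)) (·-shift (k % m) (k / m)))

    order-∣ : ∀ k → k · x ≡ 0ᴳ → m ∣ k
    order-∣ k eq = remainder (k % m) ≡.refl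
      where
      remainder : ∀ r → k % m ≡ r → m ∣ k
      remainder zero    r≡ = m%n≡0⇒n∣m k m r≡
      remainder (suc r) r≡ = ⊥-elim (proj₂ (proj₂ ord) (suc r) (s≤s z≤n) (≡.subst (_< m) r≡ (m%n<n k m))
        (≡.trans (≡.cong (_· x) (≡.sym r≡)) (≡.trans (·-% k) eq)))

    -- The product l k is 1 modulo m, so a common divisor of k and m divides 1. If l k is 0, then x
    -- is zero and m itself divides 1.
    generator-coprime : ∀ k l → l · (k · x) ≡ x → Coprime k m
    generator-coprime k l eq {d} (d∣k , d∣m) = unit (l ℕ.* k) ≡.refl
      where
      unit : ∀ n → l ℕ.* k ≡ n → d ≡ 1
      unit zero    n≡ = ∣1⇒≡1 (∣-trans d∣m (order-∣ 1 (≡.trans (·-identity x)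
        (≡.trans (≡.sym eq) (≡.trans (≡.sym (·-assoc l k x)) (≡.cong (_· x) n≡))))))
      unit (suc n) n≡ = ∣1⇒≡1 (∣m+n∣m⇒∣n {m = n} (≡.subst (d ∣_) (≡.trans n≡ (ℕ.+-comm 1 n)) (∣n⇒∣m*n l d∣k))
        (∣-trans d∣m (order-∣ n (+ᴳ-cancelˡ x _ _
          (≡.trans (≡.cong (_· x) (≡.sym n≡)) (≡.trans (·-assoc l k x) (≡.trans eq (≡.sym (+ᴳ-identityʳ x)))))))))

-- From integral eigenvalues to invariance

-- The sign function of Defs.det is local to that definition; it is reached by unification.
det-tail : ∀ n M → ∃ λ (f : Fin n → ℤω) →
           Defs.det (suc n) M ≡ M zero zero ⊗ Defs.det n (λ i k → M (suc i) (suc k)) ⊕ Defs.Σω f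
det-tail n M = _ , ≡.refl

module _ where
  open Determinant eisenstein

  -- `s k` stands for the local sign at `suc k`, hence the start with a negation. The sign has no
  -- name in scope and is therefore characterised by its equations.
  sign≡sgn : (s : ℕ → ℤω → ℤω) → (∀ z → s 0 z ≡ ⊖ z) → (∀ z → s 1 z ≡ z) →
             (∀ k z → s (suc (suc k)) z ≡ s k z) → ∀ k z → s k z ≡ sgn (suc k) z
  sign≡sgn s s0 s1 s2 zero          z = ≡.trans (s0 z) (≡.sym (⊟-def z))
  sign≡sgn s s0 s1 s2 (suc zero)    z = ≡.trans (s1 z) (≡.sym (Algebra.Properties.Ring.-‿involutive (CommutativeRing.ring eisenstein) z))
  sign≡sgn s s0 s1 s2 (suc (suc k)) z = ≡.trans (s2 k z) (≡.trans (sign≡sgn s s0 s1 s2 k z)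
    (≡.sym (Algebra.Properties.Ring.-‿involutive (CommutativeRing.ring eisenstein) (sgn (suc k) z))))

  det-tail-sgn : ∀ n M i → proj₁ (det-tail n M) i ≡
                 sgn (suc (toℕ i)) (M zero (suc i) ⊗ Defs.det n (minor M (suc i)))
  det-tail-sgn n M i with sign≡sgn _ (λ _ → ≡.refl) (λ _ → ≡.refl) (λ _ _ → ≡.refl)
  -- Abstracting the index and the entry to variables lets the goal determine the hidden sign
  -- function by pattern unification.
  ... | sign≡ with toℕ i | M zero (suc i) ⊗ Defs.det n (λ i′ k → M (suc i′) (punchIn (suc i) k))
  ...   | k | z = sign≡ k z

  Σω≡∑ : ∀ {n} (f : Fin n → ℤω) → Defs.Σω f ≡ FiniteSum.∑ eisenstein f
  Σω≡∑ {zero}  f = ≡.sym (FiniteSum.∑-empty eisenstein f)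
  Σω≡∑ {suc n} f = ≡.trans (≡.cong (f zero ⊕_) (Σω≡∑ (f ∘ suc)))
    (≡.trans (≡.sym (⊞-def (f zero) _)) (≡.sym (FiniteSum.∑-suc eisenstein f)))

  det≡det : ∀ n M → Defs.det n M ≡ det n M
  det≡det zero    M = ≡.sym (det-zero M)
  det≡det (suc n) M = begin
    Defs.det (suc n) M                                      ≡⟨ proj₂ (det-tail n M) ⟩
    M zero zero ⊗ Defs.det n (minor M zero) ⊕ Defs.Σω tail  ≡⟨ ⊞-def _ (Defs.Σω tail) ⟨
    M zero zero ⊗ Defs.det n (minor M zero) ⊞ Defs.Σω tail  ≡⟨ ≡.cong₂ _⊞_ (term zero) (Σω≡∑ tail) ⟩
    M zero zero ⊠ det n (minor M zero) ⊞ ∑ tail             ≡⟨ ≡.cong (M zero zero ⊠ det n (minor M zero) ⊞_) (∑-cong λ i →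
                                                                 ≡.trans (det-tail-sgn n M i) (≡.cong (sgn (suc (toℕ i))) (term (suc i)))) ⟩
    M zero zero ⊠ det n (minor M zero) ⊞ ∑ (λ i → sgn (suc (toℕ i)) (M zero (suc i) ⊠ det n (minor M (suc i))))
                                                            ≡⟨ ∑-suc _ ⟨
    ∑ (λ j → sgn (toℕ j) (M zero j ⊠ det n (minor M j)))    ≡⟨ det-suc n M ⟨
    det (suc n) M                                           ∎
    where
    open FiniteSum eisenstein
    open ≡.≡-Reasoning

    tail : Fin n → ℤω
    tail = proj₁ (det-tail n M)

    term : ∀ j → M zero j ⊗ Defs.det n (minor M j) ≡ M zero j ⊠ det n (minor M j)
    term j = ≡.trans (≡.cong (M zero j ⊗_) (det≡det n (minor M j))) (≡.sym (⊠-def _ _))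

Πω≡∏ : ∀ {n} (f : Fin n → ℤω) → Πω f ≡ Product.∏ eisenstein f
Πω≡∏ {zero}  f = ≡.refl
Πω≡∏ {suc n} f = ≡.trans (≡.cong (f zero ⊗_) (Πω≡∏ (f ∘ suc))) (≡.sym (⊠-def (f zero) _))

charPoly≡det : ∀ Γ S x → charPolyAt Γ S x ≡
               Determinant.det eisenstein _ (λ i j → fromℤ x ⊠ δ i j ⊞ ⊟ HS Γ S i j)
charPoly≡det Γ S x = ≡.trans (det≡det _ _) (Determinant.det-cong eisenstein _ λ i j →
  ≡.sym (≡.trans (⊞-def _ _) (≡.cong₂ _⊕_ (⊠-def (fromℤ x) (δ i j)) (⊟-def (HS Γ S i j)))))

-- Frobenius in the group ring

module GroupRingFrobenius {c ℓ} (K : CommutativeRing c ℓ) (Γ : FiniteAbelianGroup) {p} (pr : Prime p)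
         (char : CommutativeRing._≈_ K
           (Algebra.Properties.Semiring.Mult._×_ (CommutativeRing.semiring K) p (CommutativeRing.1# K))
           (CommutativeRing.0# K))
         (cop : Coprime p (FiniteAbelianGroup.order Γ)) where
  open CommutativeRing K hiding (zero)
  open GroupFacts Γ
  open GroupSum K Γ
  open GroupRing K Γ
  open Multiples Γ
  open FiniteSum K
  open Algebra.Properties.CommutativeSemiring.Exp commutativeSemiring
  open Relation.Binary.Reasoning.Setoid setoid
  private
    module R = CommutativeRing groupRing
    module ∑ᴿ = FiniteSum groupRing
    module ^ᴿ = Algebra.Properties.CommutativeSemiring.Exp R.commutativeSemiring
    open ^ᴿ using () renaming (_^_ to infixr 8 _^ᴿ_)
    module ×ᴿ = Algebra.Properties.Semiring.Mult R.semiring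
    module ×ᴷ = Algebra.Properties.Semiring.Mult semiring

  charᴿ : p ×ᴿ.× R.1# R.≈ R.0#
  charᴿ y = trans (eval p) (Frobenius.char-∣ K pr char ∣-refl (R.1# y))
    where
    eval : ∀ n → (n ×ᴿ.× R.1#) y ≈ n ×ᴷ.× (R.1# y)
    eval zero    = refl
    eval (suc n) = +-congˡ (eval n)

  scalar-^ : ∀ a n → scalar a ^ᴿ n R.≈ scalar (a ^ n)
  scalar-^ a zero    = R.sym scalar-1
  scalar-^ a (suc n) = R.trans (⋆-cong (λ _ → refl) (scalar-^ a n)) (R.sym (scalar-* a (a ^ n)))

  indicator-^ : ∀ x n → indicator x ^ᴿ n R.≈ indicator (n · x)
  indicator-^ x zero    = λ _ → refl
  indicator-^ x (suc n) = R.trans (⋆-cong (λ _ → refl) (indicator-^ x n)) (indicator-⋆-indicator x (n · x))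

  frob-expansion : ∀ u → u ^ᴿ p R.≈ ∑ᴿ.∑ (λ i → scalar (u (to i) ^ p) ⋆ indicator (p · to i))
  frob-expansion u = R.trans (^ᴿ.^-congˡ p (R.sym (basis-expansion u)))
    (R.trans (Frobenius.frob-∑ groupRing pr charᴿ (λ i → scalar (u (to i)) ⋆ indicator (to i)))
    (∑ᴿ.∑-cong λ i → R.trans (^ᴿ.^-distrib-* (scalar (u (to i))) (indicator (to i)) p)
      (⋆-cong (scalar-^ (u (to i)) p) (indicator-^ (to i) p))))

  -- Since p is prime to the order, p x = p a only for x = a, so a single term of the expansion
  -- survives.
  frob-eval : ∀ u a → (u ^ᴿ p) (p · a) ≈ u a ^ p
  frob-eval u a = begin
    (u ^ᴿ p) (p · a)                                                   ≈⟨ frob-expansion u (p · a) ⟩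
    ∑ᴿ.∑ (λ i → scalar (u (to i) ^ p) ⋆ indicator (p · to i)) (p · a)  ≈⟨ ∑ᴿ-eval _ (p · a) ⟩
    ∑ (λ i → (scalar (u (to i) ^ p) ⋆ indicator (p · to i)) (p · a))   ≈⟨ ∑-cong (λ i → scalar-⋆ (u (to i) ^ p) (indicator (p · to i)) (p · a)) ⟩
    ∑ᴳ (λ x → u x ^ p * indicator (p · x) (p · a))                     ≈⟨ ∑ᴳ-single a {λ x → u x ^ p * indicator (p · x) (p · a)} off ⟩
    u a ^ p * indicator (p · a) (p · a)                                ≈⟨ trans (*-congˡ (indicator-≡ ≡.refl)) (*-identityʳ _) ⟩
    u a ^ p                                                            ∎
    where
    off : ∀ x → x ≢ a → u x ^ p * indicator (p · x) (p · a) ≈ 0#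
    off x x≢a = trans (*-congˡ (indicator-≢ λ eq → x≢a (injective eq))) (zeroʳ _)
      where
      injective : p · x ≡ p · a → x ≡ a
      injective eq = let q , inv = coprime-inverse p cop in
        ≡.trans (≡.sym (inv x)) (≡.trans (≡.cong (q ·_) eq) (inv a))

  module _ (K-reduced : ∀ x → x ^ p ≈ 0# → x ≈ 0#) where
    groupRing-reduced : ∀ u → u ^ᴿ p R.≈ R.0# → u R.≈ R.0#
    groupRing-reduced u eq x = K-reduced (u x) (trans (sym (frob-eval u x)) (eq (p · x)))

    open Product groupRing
    frob-root : ∀ {n} u (e : Fin n → Carrier) → (∀ i → e i ^ p ≈ e i) →
                ∏ (λ i → u R.- scalar (e i)) R.≈ R.0# → ∀ a → u (p · a) ≈ u a ^ p
    frob-root u e fixed root a = trans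
      (sym (Frobenius.frob-fixed groupRing pr charᴿ groupRing-reduced u (λ i → scalar (e i))
        (λ i → R.trans (scalar-^ (e i) p) (scalar-cong (fixed i))) root (p · a)))
      (frob-eval u a)

-- The matrix of multiplication by this element of the group ring is HS.
symbol : (Γ : FiniteAbelianGroup) → Subset Γ → FiniteAbelianGroup.Carrier Γ → ℤω
symbol Γ S x = hEntry Γ (S x) (S (FiniteAbelianGroup.-_ Γ x))

HS≡symbol : ∀ Γ S i j → let open GroupFacts Γ in HS Γ S i j ≡ symbol Γ S (to j +ᴳ -ᴳ to i)
HS≡symbol Γ S i j = ≡.cong (hEntry Γ _) (≡.cong S (≡.sym (-[x-y] (to j) (to i))))
  where open GroupFacts Γ

δ-≡ : ∀ {n} (i : Fin n) → δ i i ≡ ω1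
δ-≡ zero    = ≡.refl
δ-≡ (suc i) = δ-≡ i

δ-≢ : ∀ {n} {i j : Fin n} → i ≢ j → δ i j ≡ ω0
δ-≢ {i = zero}  {zero}  ne = ⊥-elim (ne ≡.refl)
δ-≢ {i = zero}  {suc j} ne = ≡.refl
δ-≢ {i = suc i} {zero}  ne = ≡.refl
δ-≢ {i = suc i} {suc j} ne = δ-≢ (ne ∘ ≡.cong suc)

conj-symbol : ∀ Γ S x → conj (symbol Γ S x) ≡ symbol Γ S (FiniteAbelianGroup.-_ Γ x)
conj-symbol Γ S x = ≡.trans (conj-hEntry (S x) (S (-ᴳ x)))
  (≡.cong (hEntry Γ (S (-ᴳ x)) ∘ S) (≡.sym (-ᴳ-involutive x)))
  where
  open GroupFacts Γ

  conj-hEntry : ∀ a b → conj (hEntry Γ a b) ≡ hEntry Γ b a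
  conj-hEntry true  true  = ≡.refl
  conj-hEntry true  false = ≡.refl
  conj-hEntry false true  = ≡.refl
  conj-hEntry false false = ≡.refl

prime∤1 : ∀ {p} → Prime p → ¬ (p ∣ 1)
prime∤1 pr p∣1 = ℕ.nonTrivial⇒≢1 {{prime⇒nonTrivial pr}} (∣1⇒≡1 p∣1)

-- The symbol under a prime multiplier

module PrimeStep (Γ : FiniteAbelianGroup) (S : Subset Γ) (integral : HSIntegral Γ S) {p} (pr : Prime p)
                 (cop : Coprime p (FiniteAbelianGroup.order Γ)) where
  open ModPrime pr
  open GroupFacts Γ
  open Multiples Γ
  open GroupSum Kₚ Γ
  open GroupRing Kₚ Γ
  open GroupRingFrobenius Kₚ Γ pr charₚ cop
  private
    module R = CommutativeRing groupRing
    module K = CommutativeRing Kₚ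
    module ∑ᴷ = FiniteSum Kₚ
    module ∑ᴿ = FiniteSum groupRing
    module Detᴿ = Determinant groupRing
    open Algebra.Properties.CommutativeSemiring.Exp K.commutativeSemiring using (_^_)
    open Product groupRing using (∏)

    f : G → ℤω
    f = symbol Γ S

  open Polynomial groupRing scalar scalar-0 scalar-1 scalar-+ scalar-* f

  ev : Fin order → ℤ
  ev = proj₁ integral

  -- The matrix xI - H with the group ring element `f` in place of x; its determinant is the value
  -- of the characteristic polynomial at `f`.
  W : Detᴿ.Matrix order order
  W i j = f ⋆ scalar (δ i j) R.+ (R.- scalar (HS Γ S i j))

  charPoly-represents : Represents (charPolyAt Γ S) (Detᴿ.det order W)
  charPoly-represents = represents-cong (charPoly≡det Γ S) (λ _ → K.refl)
    (represents-det order λ i j → represents-+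
      (represents-* represents-id (represents-const (δ i j)))
      (represents-neg (represents-const (HS Γ S i j))))

  Πω-represents : ∀ {n} (e : Fin n → ℤ) →
                  Represents (λ x → Πω (λ i → fromℤ (x ℤ.- e i))) (∏ (λ i → f R.- scalar (fromℤ (e i))))
  Πω-represents {n} e = represents-cong (λ x → Πω≡∏ (λ i → fromℤ (x ℤ.- e i))) (λ _ → K.refl) (go e)
    where
    go : ∀ {n} (e : Fin n → ℤ) →
         Represents (λ x → Product.∏ eisenstein (λ i → fromℤ (x ℤ.- e i))) (∏ (λ i → f R.- scalar (fromℤ (e i))))
    go {zero}  e = represents-cong (λ _ → ≡.refl) (R.sym scalar-1) (represents-const ω1)
    go {suc n} e = represents-* (represents-cong
        (λ x → ≡.trans (fromℤ-+ x (ℤ.- e zero)) (≡.cong (fromℤ x ⊞_) (fromℤ-neg (e zero)))) (λ _ → K.refl)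
        (represents-+ represents-id (represents-neg (represents-const (fromℤ (e zero))))))
      (go (e ∘ suc))

  -- In column j both parts give [-g] ⋆ f for g = `to j`: the diagonal part directly, and the
  -- entries f(g - x) of H weighted by [-x] by collecting coefficients.
  W-null : ∀ j → ∑ᴿ.∑ (λ i → indicator (-ᴳ to i) ⋆ W i j) R.≈ R.0#
  W-null j = R.trans (∑ᴿ.∑-cong λ i → R.distribˡ (indicator (-ᴳ to i)) _ _)
    (R.trans (∑ᴿ.∑-+ _ _) (R.trans (R.+-cong diagonal off-diagonal) (R.-‿inverseʳ translate)))
    where
    translate : G → ℤω
    translate y = f (y +ᴳ to j)

    diagonal : ∑ᴿ.∑ (λ i → indicator (-ᴳ to i) ⋆ (f ⋆ scalar (δ i j))) R.≈ translate
    diagonal = R.trans (∑ᴿ.∑-single j λ i i≢j → R.trans (⋆-cong (λ _ → K.refl)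
        (R.trans (⋆-cong (λ _ → K.refl) (R.trans (scalar-cong (≈⇒≋ (δ-≢ i≢j))) scalar-0)) (R.zeroʳ f))) (R.zeroʳ (indicator (-ᴳ to i))))
      λ y → K.trans (⋆-cong (λ _ → K.refl) (R.trans (⋆-cong (λ _ → K.refl) (R.trans (scalar-cong (≈⇒≋ (δ-≡ j))) scalar-1)) (R.*-identityʳ f)) y)
        (K.trans (indicator-⋆ (-ᴳ to j) f y) (≈⇒≋ (≡.cong (λ z → f (y +ᴳ z)) (-ᴳ-involutive (to j)))))

    off-diagonal : ∑ᴿ.∑ (λ i → indicator (-ᴳ to i) ⋆ (R.- scalar (HS Γ S i j))) R.≈ R.- translate
    off-diagonal y = begin
      ∑ᴿ.∑ (λ i → indicator (-ᴳ to i) ⋆ (R.- scalar (HS Γ S i j))) y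
        ≈⟨ ∑ᴿ-eval (λ i → indicator (-ᴳ to i) ⋆ (R.- scalar (HS Γ S i j))) y ⟩
      ∑ᴷ.∑ (λ i → (indicator (-ᴳ to i) ⋆ (R.- scalar (HS Γ S i j))) y)
        ≈⟨ ∑ᴷ.∑-cong entry ⟩
      ∑ᴳ (λ x → K.- (f (to j +ᴳ -ᴳ x)) K.* indicator (-ᴳ x) y)
        ≈⟨ ∑ᴳ-single (-ᴳ y) {λ x → K.- (f (to j +ᴳ -ᴳ x)) K.* indicator (-ᴳ x) y}
             (λ x x≢ → K.trans (K.*-congˡ {K.- (f (to j +ᴳ -ᴳ x))} (indicator-≢ λ eq → x≢ (≡.trans (≡.sym (-ᴳ-involutive x)) (≡.cong -ᴳ_ eq))))
                               (K.zeroʳ (K.- (f (to j +ᴳ -ᴳ x))))) ⟩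
      K.- (f (to j +ᴳ -ᴳ (-ᴳ y))) K.* indicator (-ᴳ (-ᴳ y)) y
        ≈⟨ K.trans (K.*-congˡ {K.- (f (to j +ᴳ -ᴳ (-ᴳ y)))} (indicator-≡ (-ᴳ-involutive y))) (K.*-identityʳ (K.- (f (to j +ᴳ -ᴳ (-ᴳ y))))) ⟩
      K.- (f (to j +ᴳ -ᴳ (-ᴳ y)))
        ≈⟨ ≈⇒≋ (≡.cong (λ z → ⊟ f z) (≡.trans (≡.cong (to j +ᴳ_) (-ᴳ-involutive y)) (+ᴳ-comm (to j) y))) ⟩
      K.- (translate y) ∎
      where
      open Relation.Binary.Reasoning.Setoid K.setoid

      scalar-neg : ∀ a → R.- scalar a R.≈ scalar (⊟ a)
      scalar-neg a = R.sym (ι-neg a)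

      entry : ∀ i → (indicator (-ᴳ to i) ⋆ (R.- scalar (HS Γ S i j))) y ≋
                    K.- (f (to j +ᴳ -ᴳ to i)) K.* indicator (-ᴳ to i) y
      entry i = begin
        (indicator (-ᴳ to i) ⋆ (R.- scalar (HS Γ S i j))) y  ≈⟨ ⋆-cong (λ _ → K.refl) (scalar-neg (HS Γ S i j)) y ⟩
        (indicator (-ᴳ to i) ⋆ scalar (⊟ HS Γ S i j)) y      ≈⟨ ⋆-comm (indicator (-ᴳ to i)) (scalar (⊟ HS Γ S i j)) y ⟩
        (scalar (⊟ HS Γ S i j) ⋆ indicator (-ᴳ to i)) y      ≈⟨ scalar-⋆ (⊟ HS Γ S i j) (indicator (-ᴳ to i)) y ⟩
        ⊟ HS Γ S i j ⊠ indicator (-ᴳ to i) y                 ≈⟨ ≈⇒≋ (≡.cong (λ z → ⊟ z ⊠ indicator (-ᴳ to i) y) (HS≡symbol Γ S i j)) ⟩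
        K.- (f (to j +ᴳ -ᴳ to i)) K.* indicator (-ᴳ to i) y  ∎

  det-W : Detᴿ.det order W R.≈ R.0#
  det-W = Detᴿ.det-vanishes (from 0ᴳ) (λ i → indicator (-ᴳ to i)) W unit W-null
    where
    -- A group element acts on the group ring by translation, which can be undone.
    unit : ∀ i u → indicator (-ᴳ to i) ⋆ u R.≈ R.0# → u R.≈ R.0#
    unit i u eq y = K.trans (≈⇒≋ (≡.cong u (≡.sym (≡.trans (≡.cong (y +ᴳ -ᴳ to i +ᴳ_) (-ᴳ-involutive (to i))) ([y-x]+x (to i) y)))))
      (K.trans (K.sym (indicator-⋆ (-ᴳ to i) u (y +ᴳ -ᴳ to i))) (eq (y +ᴳ -ᴳ to i)))

  root : ∏ (λ i → f R.- scalar (fromℤ (ev i))) R.≈ R.0#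
  root = R.trans (represents-unique (Πω-represents ev)
    (represents-cong (λ x → ≡.sym (proj₂ integral x)) (λ _ → K.refl) charPoly-represents)) det-W

  symbol-frob : p % 3 ≡ 1 ⊎ p % 3 ≡ 2 → ∀ a → f (p · a) ≋ f a ^ p
  symbol-frob r = frob-root (Kₚ-reduced r) f (fromℤ ∘ ev) (λ i → fermatℤ (ev i)) root

  -- Entries with different first arguments differ by 1 or -1 in some coordinate, and no prime
  -- divides 1.
  hEntry-injectiveˡ : ∀ a b c d → hEntry Γ a b ≋ hEntry Γ c d → a ≡ c
  hEntry-injectiveˡ true  _ true  _ _  = ≡.refl
  hEntry-injectiveˡ false _ false _ _  = ≡.refl
  hEntry-injectiveˡ true  b false d eq = ⊥-elim (separated b d eq)
    where
    separated : ∀ b d → ¬ (hEntry Γ true b ≋ hEntry Γ false d)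
    separated true  true  e = prime∤1 pr (≋⇒∣im ω1 ωω̄ e)
    separated true  false e = prime∤1 pr (≋⇒∣re ω1 ω0 e)
    separated false true  e = prime∤1 pr (≋⇒∣re ωω ωω̄ e)
    separated false false e = prime∤1 pr (≋⇒∣im ωω ω0 e)
  hEntry-injectiveˡ false b true  d eq = ≡.sym (hEntry-injectiveˡ true d false b (≋-sym eq))

  invariant₁ : p % 3 ≡ 1 → ∀ a → S (p · a) ≡ S a
  invariant₁ r a = hEntry-injectiveˡ _ _ _ _ (≋-trans (symbol-frob (inj₁ r) a) (frob-id r (f a)))

  invariant₂ : p % 3 ≡ 2 → ∀ a → S (p · a) ≡ S (-ᴳ a)
  invariant₂ r a = hEntry-injectiveˡ _ _ _ _ (≋-trans (symbol-frob (inj₂ r) a)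
    (≋-trans (frob-conj r (f a)) (≈⇒≋ (conj-symbol Γ S a))))

coprime-∣ˡ : ∀ {a b n} → a ∣ b → Coprime b n → Coprime a n
coprime-∣ˡ a∣b cop (d∣a , d∣n) = cop (∣-trans d∣a a∣b , d∣n)

coprime-∣ʳ : ∀ {a m n} → m ∣ n → Coprime a n → Coprime a m
coprime-∣ʳ m∣n cop (d∣a , d∣m) = cop (d∣a , ∣-trans d∣m m∣n)

-- Invariance under multipliers prime to 3|Γ|

module Invariance (Γ : FiniteAbelianGroup) (S : Subset Γ) (integral : HSIntegral Γ S) where
  open GroupFacts Γ
  open Multiples Γ

  -- Multipliers ≡ 1 preserve S, and those ≡ 2 carry it to -S. Both kinds are needed for closure
  -- under products, since 2 · 2 ≡ 1 (mod 3).
  Invariant : ℕ → Set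
  Invariant k = (k % 3 ≡ 1 × (∀ a → S (k · a) ≡ S a)) ⊎ (k % 3 ≡ 2 × (∀ a → S (k · a) ≡ S (-ᴳ a)))

  prime-invariant : ∀ {p} → Prime p → Coprime p (3 ℕ.* order) → Invariant p
  prime-invariant {p} pr cop with unit-mod-3 (m∣m*n order) cop
  ... | inj₁ r = inj₁ (r , PrimeStep.invariant₁ Γ S integral pr (coprime-∣ʳ (n∣m*n 3) cop) r)
  ... | inj₂ r = inj₂ (r , PrimeStep.invariant₂ Γ S integral pr (coprime-∣ʳ (n∣m*n 3) cop) r)

  *-invariant : ∀ j k → Invariant j → Invariant k → Invariant (j ℕ.* k)
  *-invariant j k J K = combine J K
    where
    residue : ∀ {a b} → j % 3 ≡ a → k % 3 ≡ b → (j ℕ.* k) % 3 ≡ (a ℕ.* b) % 3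
    residue p q = ≡.trans (%-distribˡ-* j k 3) (≡.cong₂ (λ a b → (a ℕ.* b) % 3) p q)

    step : ∀ {a} → S ((j ℕ.* k) · a) ≡ S (j · (k · a))
    step {a} = ≡.cong S (·-assoc j k a)

    combine : Invariant j → Invariant k → Invariant (j ℕ.* k)
    combine (inj₁ (p , P)) (inj₁ (q , Q)) = inj₁ (residue p q , λ a → ≡.trans step (≡.trans (P (k · a)) (Q a)))
    combine (inj₁ (p , P)) (inj₂ (q , Q)) = inj₂ (residue p q , λ a → ≡.trans step (≡.trans (P (k · a)) (Q a)))
    combine (inj₂ (p , P)) (inj₁ (q , Q)) = inj₂ (residue p q , λ a → ≡.trans step (≡.trans (P (k · a))
      (≡.trans (≡.cong S (≡.sym (·-neg k a))) (Q (-ᴳ a)))))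
    combine (inj₂ (p , P)) (inj₂ (q , Q)) = inj₁ (residue p q , λ a → ≡.trans step (≡.trans (P (k · a))
      (≡.trans (≡.cong S (≡.sym (·-neg k a))) (≡.trans (Q (-ᴳ a)) (≡.cong S (-ᴳ-involutive a))))))

  invariant : ∀ k → Coprime k (3 ℕ.* order) → Invariant k
  invariant zero      cop = ⊥-elim (3n≢1 order (cop ((3 ℕ.* order) ∣0 , ∣-refl)))
    where
    3n≢1 : ∀ n → 3 ℕ.* n ≢ 1
    3n≢1 n eq with ∣1⇒≡1 (≡.subst (3 ∣_) eq (m∣m*n n))
    ... | ()
  invariant k@(suc _) cop = ≡.subst Invariant (≡.sym isFactorisation)
    (go factorsPrime (≡.subst (λ k → Coprime k (3 ℕ.* order)) isFactorisation cop))
    where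
    open PrimeFactorisation (factorise k)

    go : ∀ {ps} → All Prime ps → Coprime (product ps) (3 ℕ.* order) → Invariant (product ps)
    go []                   cop = inj₁ (≡.refl , λ a → ≡.cong S (·-identity a))
    go {p ∷ ps} (pr ∷ prs) cop = *-invariant p (product ps)
      (prime-invariant pr (coprime-∣ˡ (m∣m*n (product ps)) cop))
      (go prs (coprime-∣ˡ (n∣m*n p) cop))

∧-true : ∀ {a b} → a ∧ b ≡ true → a ≡ true × b ≡ true
∧-true {true} {true} _ = ≡.refl , ≡.refl

true-∧ : ∀ {a b} → a ≡ true → b ≡ true → a ∧ b ≡ true
true-∧ ≡.refl ≡.refl = ≡.refl

Bool-≡ : ∀ {a b} → (a ≡ true → b ≡ true) → (b ≡ true → a ≡ true) → a ≡ b
Bool-≡ {true}  {true}  _ _ = ≡.refl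
Bool-≡ {true}  {false} f _ = ≡.sym (f ≡.refl)
Bool-≡ {false} {true}  _ g = g ≡.refl
Bool-≡ {false} {false} _ _ = ≡.refl

does-true⁻ : ∀ {P : Set} (d : Dec P) → does d ≡ true → P
does-true⁻ (yes p) _ = p

-- A common divisor of k and 3m is coprime to m, so it divides 3, and with k and 3 it divides the
-- remainder 1.
coprime-3* : ∀ {k m} → k % 3 ≡ 1 → Coprime k m → Coprime k (3 ℕ.* m)
coprime-3* {k} {m} k≡1 cop {d} (d∣k , d∣3m) = ∣1⇒≡1 (≡.subst (d ∣_) k≡1 (%-presˡ-∣ d∣k
  (Coprime.coprime-divisor (λ (e∣d , e∣m) → cop (∣-trans e∣d d∣k , e∣m)) (≡.subst (d ∣_) (ℕ.*-comm 3 m) d∣3m))))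

-- If 3 does not divide m, the class of -1 modulo m contains some k ≡ 1 (mod 3): take k = t m - 1
-- with t m ≡ 2, that is, t = 2 for m ≡ 1 and t = 1 for m ≡ 2.
minus-one : ∀ m → 1 ≤ m → ¬ (3 ∣ m) → ∃ λ k → ∃ λ t → suc k ≡ t ℕ.* m × k % 3 ≡ 1 × Coprime k (3 ℕ.* m)
minus-one m 1≤m 3∤m = residue (mod-3 m)
  where
  finish : ∀ k t → suc k ≡ t ℕ.* m → k % 3 ≡ 1 → ∃ λ k → ∃ λ t → suc k ≡ t ℕ.* m × k % 3 ≡ 1 × Coprime k (3 ℕ.* m)
  finish k t eq k≡1 = k , t , eq , k≡1 , coprime-3* k≡1 λ {d} (d∣k , d∣m) →
    ∣1⇒≡1 (∣m+n∣m⇒∣n (≡.subst (d ∣_) (≡.trans (≡.sym eq) (ℕ.+-comm 1 k)) (∣n⇒∣m*n t d∣m)) d∣k)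

  from-multiple : ∀ t → 1 ≤ t → (t ℕ.* m) % 3 ≡ 2 → ∃ λ k → ∃ λ t → suc k ≡ t ℕ.* m × k % 3 ≡ 1 × Coprime k (3 ℕ.* m)
  from-multiple t 1≤t eq = finish (ℕ.pred (t ℕ.* m)) t suc-pred (pred-mod-3 (ℕ.pred (t ℕ.* m)) 2 (≡.trans (≡.cong (_% 3) suc-pred) eq))
    where
    suc-pred : suc (ℕ.pred (t ℕ.* m)) ≡ t ℕ.* m
    suc-pred = ℕ.suc-pred (t ℕ.* m) {{ℕ.>-nonZero (ℕ.*-mono-≤ 1≤t 1≤m)}}

  residue : m % 3 ≡ 0 ⊎ m % 3 ≡ 1 ⊎ m % 3 ≡ 2 → ∃ λ k → ∃ λ t → suc k ≡ t ℕ.* m × k % 3 ≡ 1 × Coprime k (3 ℕ.* m)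
  residue (inj₁ r)        = ⊥-elim (3∤m (m%n≡0⇒n∣m m 3 r))
  residue (inj₂ (inj₁ r)) = from-multiple 2 (s≤s z≤n) (≡.trans (%-distribˡ-* 2 m 3) (≡.cong (λ z → (2 ℕ.* z) % 3) r))
  residue (inj₂ (inj₂ r)) = from-multiple 1 (s≤s z≤n) (≡.trans (≡.cong (_% 3) (ℕ.*-identityˡ m)) r)

-- Cyclic subgroups and atoms

module BooleanAlgebra (Γ : FiniteAbelianGroup) where
  open GroupFacts Γ
  open Multiples Γ

  cyclic? : ∀ x y → Dec (Defs.InCyclic Γ x y)
  cyclic? x y with has-order x
  ... | m , ord = map′ (λ { (k , eq) → toℕ k , eq }) reduce (Fin.any? λ (k : Fin m) → y ≟ᴳ toℕ k · x)
    where
    instance _ = ℕ.>-nonZero (proj₁ ord)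

    reduce : Defs.InCyclic Γ x y → ∃ λ (k : Fin m) → y ≡ toℕ k · x
    reduce (k , eq) = fromℕ< (m%n<n k m) ,
      ≡.trans eq (≡.trans (≡.sym (·-% ord k)) (≡.cong (_· x) (≡.sym (Fin.toℕ-fromℕ< (m%n<n k m)))))

  opaque
    cyclic : G → Subset Γ
    cyclic x y = does (cyclic? x y)

    cyclic⁺ : ∀ {x y} → Defs.InCyclic Γ x y → cyclic x y ≡ true
    cyclic⁺ {x} {y} = dec-true (cyclic? x y)

    cyclic⁻ : ∀ {x y} → cyclic x y ≡ true → Defs.InCyclic Γ x y
    cyclic⁻ {x} {y} = does-true⁻ (cyclic? x y)

  cyclic-refl : ∀ x → cyclic x x ≡ true
  cyclic-refl x = cyclic⁺ (1 , ≡.sym (·-identity x))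

  cyclic-trans : ∀ {x y z} → cyclic x y ≡ true → cyclic y z ≡ true → cyclic x z ≡ true
  cyclic-trans p q with cyclic⁻ p | cyclic⁻ q
  ... | k , ≡.refl | l , ≡.refl = cyclic⁺ (l ℕ.* k , ≡.sym (·-assoc l k _))

  cyclic-neg : ∀ x → cyclic x (-ᴳ x) ≡ true
  cyclic-neg x with has-order x
  ... | suc m , _ , zero-m , _ = cyclic⁺ (m , ≡.sym (+ᴳ-inverseʳ-unique x (m · x) zero-m))

  cyclic-subgroup : ∀ x → IsSubgroup Γ (cyclic x)
  cyclic-subgroup x = cyclic⁺ (0 , ≡.refl) ,
    (λ y z p q → add (cyclic⁻ p) (cyclic⁻ q)) ,
    (λ y p → cyclic-trans p (cyclic-neg y))
    where
    add : ∀ {y z} → Defs.InCyclic Γ x y → Defs.InCyclic Γ x z → cyclic x (y +ᴳ z) ≡ true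
    add (k , ≡.refl) (l , ≡.refl) = cyclic⁺ (k ℕ.+ l , ≡.sym (·-homo-+ k l x))

  cyclic-InB : ∀ x → InB Γ (cyclic x)
  cyclic-InB x = subgrp _ (cyclic-subgroup x)

  ∅-InB : InB Γ (λ _ → false)
  ∅-InB = ext _ _ (λ x → Bool.∧-inverseʳ (cyclic 0ᴳ x)) (inter _ _ (cyclic-InB 0ᴳ) (compl _ (cyclic-InB 0ᴳ)))

  ⋃ : ∀ {n} → (Fin n → Subset Γ) → Subset Γ
  ⋃ {zero}  T x = false
  ⋃ {suc n} T x = T zero x ∨ ⋃ (T ∘ suc) x

  ⋃-InB : ∀ {n} (T : Fin n → Subset Γ) → (∀ i → InB Γ (T i)) → InB Γ (⋃ T)
  ⋃-InB {zero}  T TB = ∅-InB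
  ⋃-InB {suc n} T TB = union _ _ (TB zero) (⋃-InB (T ∘ suc) (TB ∘ suc))

  ⋃⁺ : ∀ {n} (T : Fin n → Subset Γ) i {x} → T i x ≡ true → ⋃ T x ≡ true
  ⋃⁺ T zero    eq rewrite eq = ≡.refl
  ⋃⁺ T (suc i) {x} eq = ≡.trans (≡.cong (T zero x ∨_) (⋃⁺ (T ∘ suc) i eq)) (Bool.∨-zeroʳ (T zero x))

  ⋃⁻ : ∀ {n} (T : Fin n → Subset Γ) {x} → ⋃ T x ≡ true → ∃ λ i → T i x ≡ true
  ⋃⁻ {suc n} T {x} eq with T zero x in e
  ... | true  = zero , e
  ... | false with ⋃⁻ (T ∘ suc) eq
  ...   | i , e′ = suc i , e′

  -- Selects members of a family while the union still runs over all indices: a rejected member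
  -- becomes empty.
  guard : Bool → Subset Γ → Subset Γ
  guard b T x = b ∧ T x

  guard-InB : ∀ b {T} → InB Γ T → InB Γ (guard b T)
  guard-InB true  TB = TB
  guard-InB false TB = ∅-InB

  atom : G → Subset Γ
  atom x y = cyclic x y ∧ cyclic y x

  -- The atom of x is ⟨x⟩ minus the subgroups ⟨z⟩ of ⟨x⟩ that do not contain x.
  atom-InB : ∀ x → InB Γ (atom x)
  atom-InB x = ext _ _ equal (inter _ _ (cyclic-InB x) (compl _ (⋃-InB proper
    λ i → guard-InB (cyclic x (to i) ∧ not (cyclic (to i) x)) (cyclic-InB (to i)))))
    where
    proper : Fin order → Subset Γ
    proper i = guard (cyclic x (to i) ∧ not (cyclic (to i) x)) (cyclic (to i))

    equal : ∀ y → cyclic x y ∧ not (⋃ proper y) ≡ atom x y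
    equal y with cyclic x y in xy | cyclic y x in yx | ⋃ proper y in u
    ... | false | _     | _     = ≡.refl
    ... | true  | true  | false = ≡.refl
    ... | true  | false | true  = ≡.refl
    ... | true  | true  | true with ⋃⁻ proper u
    ...   | i , e with ∧-true {cyclic x (to i) ∧ not (cyclic (to i) x)} e
    ...     | e₁ , iy with ∧-true {cyclic x (to i)} e₁
    ...       | _ , e₂ = ⊥-elim (Bool.not-¬ {true} ≡.refl (≡.trans (≡.sym e₂) (≡.cong not (cyclic-trans iy yx))))
    -- Here ⟨y⟩ is itself one of the removed subgroups.
    equal y | true | false | false = ≡.trans (≡.sym (⋃⁺ proper (from y) member)) u
      where
      member : proper (from y) y ≡ true
      member = ≡.subst (λ z → guard (cyclic x z ∧ not (cyclic z x)) (cyclic z) y ≡ true) (≡.sym (to-from y))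
        (true-∧ (true-∧ xy (≡.cong not yx)) (cyclic-refl y))

  atom-refl : ∀ x → atom x x ≡ true
  atom-refl x = true-∧ (cyclic-refl x) (cyclic-refl x)

  atom-closed-InB : ∀ T → (∀ {x y} → atom x y ≡ true → T x ≡ true → T y ≡ true) → InB Γ T
  atom-closed-InB T closed = ext _ _ equal (⋃-InB _ λ i → guard-InB (T (to i)) (atom-InB (to i)))
    where
    equal : ∀ y → ⋃ (λ i → guard (T (to i)) (atom (to i))) y ≡ T y
    equal y = Bool-≡
      (λ e → let i , e′ = ⋃⁻ (λ i → guard (T (to i)) (atom (to i))) e
                 Ti , a = ∧-true {T (to i)} e′ in closed a Ti)
      (λ Ty → ⋃⁺ (λ i → guard (T (to i)) (atom (to i))) (from y)
        (≡.subst (λ z → T z ∧ atom z y ≡ true) (≡.sym (to-from y)) (true-∧ Ty (atom-refl y))))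

-- The conditions on S from invariance

module Consequences (Γ : FiniteAbelianGroup) (S : Subset Γ) (integral : HSIntegral Γ S) where
  open GroupFacts Γ
  open Multiples Γ
  open BooleanAlgebra Γ
  open Invariance Γ S integral
  private
    instance
      3n-nonZero : NonZero (3 ℕ.* order)
      3n-nonZero = ℕ.m*n≢0 3 order {{_}} {{ℕ.≢-nonZero order≢0}}

  -- y = k x with k prime to the order m of x, and k lifts modulo m to a multiplier prime to 3|Γ|.
  -- Its residue modulo 3 is not controlled, but x and -x both lie in S, so preserving S and
  -- negating it have the same effect on them.
  symmetric : ∀ {x y} → atom x y ≡ true → symPart Γ S x ≡ true → symPart Γ S y ≡ true
  symmetric {x} {y} a sx = go (cyclic⁻ (proj₁ (∧-true a))) (cyclic⁻ (proj₂ (∧-true {cyclic x y} a)))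
    where
    go : Defs.InCyclic Γ x y → Defs.InCyclic Γ y x → symPart Γ S y ≡ true
    go (k , ≡.refl) (l , eq) = unit (invariant (k ℕ.+ t ℕ.* m) cop)
      where
      m = proj₁ (has-order x)
      ord = proj₂ (has-order x)
      lifted = lift-coprime k m (3 ℕ.* order) (generator-coprime ord k l (≡.sym eq))
      t = proj₁ lifted
      cop = proj₂ lifted

      Sx = proj₁ (∧-true {S x} sx)
      S-x = proj₂ (∧-true {S x} sx)

      shift : (k ℕ.+ t ℕ.* m) · x ≡ k · x
      shift = ·-shift ord k t

      shift-neg : (k ℕ.+ t ℕ.* m) · (-ᴳ x) ≡ -ᴳ (k · x)
      shift-neg = ≡.trans (·-neg (k ℕ.+ t ℕ.* m) x) (≡.cong -ᴳ_ shift)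

      unit : Invariant (k ℕ.+ t ℕ.* m) → symPart Γ S (k · x) ≡ true
      unit (inj₁ (_ , inv)) = true-∧
        (≡.trans (≡.cong S (≡.sym shift)) (≡.trans (inv x) Sx))
        (≡.trans (≡.cong S (≡.sym shift-neg)) (≡.trans (inv (-ᴳ x)) S-x))
      unit (inj₂ (_ , inv)) = true-∧
        (≡.trans (≡.cong S (≡.sym shift)) (≡.trans (inv x) S-x))
        (≡.trans (≡.cong S (≡.sym shift-neg)) (≡.trans (inv (-ᴳ x)) (≡.trans (≡.cong S (-ᴳ-involutive x)) Sx)))

  symPart-InB : InB Γ (symPart Γ S)
  symPart-InB = atom-closed-InB (symPart Γ S) symmetric

  bar⁻ : ∀ {x} → bar Γ S x ≡ true → S x ≡ true × S (-ᴳ x) ≡ false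
  bar⁻ {x} e with S x | S (-ᴳ x)
  ... | true | false = ≡.refl , ≡.refl

  -- The lift is taken modulo 3m instead of m, so that the residue 1 modulo 3 survives.
  invariant-≡1 : ∀ {x m} → HasOrder Γ x m → ∀ k → Coprime k (3 ℕ.* m) → k % 3 ≡ 1 → S (k · x) ≡ S x
  invariant-≡1 {x} {m} ord k cop k≡1 = unit (invariant k′ cop′)
    where
    lifted = lift-coprime k (3 ℕ.* m) (3 ℕ.* order) cop
    t = proj₁ lifted
    k′ = k ℕ.+ t ℕ.* (3 ℕ.* m)
    cop′ = proj₂ lifted

    rearrange : ∀ u → t ℕ.* (u ℕ.* m) ≡ t ℕ.* u ℕ.* m
    rearrange u = ≡.sym (ℕ.*-assoc t u m)

    k′≡1 : k′ % 3 ≡ 1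
    k′≡1 = ≡.trans (≡.cong (λ z → (k ℕ.+ z) % 3)
      (≡.trans (≡.cong (t ℕ.*_) (ℕ.*-comm 3 m)) (≡.sym (ℕ.*-assoc t m 3)))) (≡.trans ([m+kn]%n≡m%n k (t ℕ.* m) 3) k≡1)

    shift : k′ · x ≡ k · x
    shift = ≡.trans (≡.cong (λ z → (k ℕ.+ z) · x) (rearrange 3)) (·-shift ord k (t ℕ.* 3))

    unit : Invariant k′ → S (k · x) ≡ S x
    unit (inj₁ (_ , inv)) = ≡.trans (≡.cong S (≡.sym shift)) (inv x)
    unit (inj₂ (k′≡2 , _)) with ≡.trans (≡.sym k′≡1) k′≡2
    ... | ()

  -- Otherwise `minus-one` gives a multiplier ≡ 1 (mod 3) that sends x to -x, and invariance puts
  -- both or neither in S.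
  bar-order : ∀ {x m} → bar Γ S x ≡ true → HasOrder Γ x m → 3 ∣ m
  bar-order {x} {m} b ord with 3 ∣? m
  ... | yes 3∣m = 3∣m
  ... | no  3∤m = ⊥-elim (absurd (minus-one m (proj₁ ord) 3∤m))
    where
    absurd : ¬ (∃ λ k → ∃ λ t → suc k ≡ t ℕ.* m × k % 3 ≡ 1 × Coprime k (3 ℕ.* m))
    absurd (k , t , eq , k≡1 , cop) = Bool.not-¬ {true} ≡.refl (begin
      true         ≡⟨ proj₁ (bar⁻ b) ⟨
      S x          ≡⟨ invariant-≡1 ord k cop k≡1 ⟨
      S (k · x)    ≡⟨ ≡.cong S (+ᴳ-inverseʳ-unique x (k · x) (≡.trans (≡.cong (_· x) eq) (order-multiple ord t))) ⟩
      S (-ᴳ x)     ≡⟨ proj₂ (bar⁻ b) ⟩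
      false        ∎)
      where open ≡.≡-Reasoning

  bar-closed : ∀ {x y} → bar Γ S x ≡ true → InDoubleBracket Γ x y → bar Γ S y ≡ true
  bar-closed {x} b (m , k , ord , _ , _ , gcd≡1 , k≡1 , ≡.refl) = ≡.cong₂ (λ s t → s ∧ not t)
    (≡.trans (invariant-≡1 ord k cop k≡1) (proj₁ (bar⁻ b)))
    (≡.trans (≡.cong S (≡.sym (·-neg k x))) (≡.trans (invariant-≡1 ord-neg k cop k≡1) (proj₂ (bar⁻ b))))
    where
    -ᴳ-zero : ∀ j → j · (-ᴳ x) ≡ 0ᴳ → j · x ≡ 0ᴳ
    -ᴳ-zero j eq = -ᴳ-injective (≡.trans (≡.sym (·-neg j x)) (≡.trans eq (≡.sym -ᴳ-0ᴳ)))

    ord-neg : HasOrder Γ (-ᴳ x) m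
    ord-neg = proj₁ ord , ≡.trans (·-neg m x) (≡.trans (≡.cong -ᴳ_ (proj₁ (proj₂ ord))) -ᴳ-0ᴳ) ,
      λ j 1≤j j<m eq → proj₂ (proj₂ ord) j 1≤j j<m (-ᴳ-zero j eq)

    cop : Coprime k (3 ℕ.* m)
    cop = coprime-3* k≡1 (gcd≡1⇒coprime gcd≡1)

  bar-InE : InE Γ (bar Γ S)
  bar-InE = skew , elements , All.tabulate Γ3 , λ y → generated y , closed y
    where
    bar? : ∀ x → Dec (bar Γ S x ≡ true)
    bar? x = bar Γ S x Bool.≟ true

    -- The set generates itself: x lies in ⟨⟨x⟩⟩ with exponent 1, which is below the order of x
    -- because that order is divisible by 3.
    elements : List G
    elements = filter bar? (map to (allFin order))

    skew : SkewSymmetric Γ (bar Γ S)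
    skew a p q with ≡.trans (≡.sym (proj₂ (bar⁻ p))) (proj₁ (bar⁻ q))
    ... | ()

    Γ3 : ∀ {x} → x ∈ elements → InΓ3 Γ x
    Γ3 {x} x∈ = m , ord , bar-order (proj₂ (∈-filter⁻ bar? {xs = map to (allFin order)} x∈)) ord
      where
      m = proj₁ (has-order x)
      ord = proj₂ (has-order x)

    generated : ∀ y → bar Γ S y ≡ true → Any (λ x → InDoubleBracket Γ x y) elements
    generated y b = lose (∈-filter⁺ bar? (≡.subst (_∈ map to (allFin order)) (to-from y) (∈-map⁺ to (∈-allFin (from y)))) b)
      (m , 1 , ord , ℕ.≤-refl , 1<m , coprime⇒gcd≡1 (Coprime.1-coprimeTo m) , ≡.refl , ≡.sym (·-identity y))
      where
      m = proj₁ (has-order y)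
      ord = proj₂ (has-order y)

      1<m : 1 < m
      1<m = ℕ.≤-trans (s≤s (s≤s z≤n)) (∣⇒≤ {{ℕ.>-nonZero (proj₁ ord)}} (bar-order b ord))

    closed : ∀ y → Any (λ x → InDoubleBracket Γ x y) elements → bar Γ S y ≡ true
    closed y any = let x , x∈ , db = find any in
      bar-closed (proj₂ (∈-filter⁻ bar? {xs = map to (allFin order)} x∈)) db

-- From invariance to integral eigenvalues

module Eigenvectors (Γ : FiniteAbelianGroup) where
  open GroupFacts Γ
  open GroupSum eisenstein Γ
  open GroupRing eisenstein Γ
  open FiniteSum eisenstein
  open Determinant eisenstein
  private
    module R = CommutativeRing groupRing
    module E = CommutativeRing eisenstein
    module RP = Algebra.Properties.Ring R.ring

  -- The characters with values in ℤ[ω] of the subgroups of Γ, extended by zero.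
  QuasiCharacter : (G → ℤω) → Set
  QuasiCharacter E = E 0ᴳ ≡ ω1 × (∀ x → E x ≡ ω0 ⊎ (∀ y → E (x +ᴳ y) ≡ E x ⊠ E y))

  data Span : (G → ℤω) → Set where
    character : ∀ {E} → QuasiCharacter E → Span E
    add       : ∀ {f g} → Span f → Span g → Span (λ y → f y ⊞ g y)
    scale     : ∀ a {f} → Span f → Span (λ y → fromℤ a ⊠ f y)
    cong      : ∀ {f g} → (∀ y → f y ≡ g y) → Span f → Span g

  QuasiCharacter-* : ∀ {E E′} → QuasiCharacter E → QuasiCharacter E′ → QuasiCharacter (λ y → E y ⊠ E′ y)
  QuasiCharacter-* {E} {E′} (E0 , mult) (E′0 , mult′) = ≡.trans (≡.cong₂ _⊠_ E0 E′0) (E.*-identityˡ ω1) , multiplicative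
    where
    interchange : ∀ a b c d → (a ⊠ b) ⊠ (c ⊠ d) ≡ (a ⊠ c) ⊠ (b ⊠ d)
    interchange a b c d = ≡.trans (E.*-assoc a b (c ⊠ d)) (≡.trans (≡.cong (a ⊠_)
      (≡.trans (≡.sym (E.*-assoc b c d)) (≡.trans (≡.cong (_⊠ d) (E.*-comm b c)) (E.*-assoc c b d)))) (≡.sym (E.*-assoc a c (b ⊠ d))))

    multiplicative : ∀ x → E x ⊠ E′ x ≡ ω0 ⊎ (∀ y → E (x +ᴳ y) ⊠ E′ (x +ᴳ y) ≡ (E x ⊠ E′ x) ⊠ (E y ⊠ E′ y))
    multiplicative x with mult x | mult′ x
    ... | inj₁ z | _      = inj₁ (≡.trans (≡.cong (_⊠ E′ x) z) (E.zeroˡ (E′ x)))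
    ... | inj₂ _ | inj₁ z = inj₁ (≡.trans (≡.cong (E x ⊠_) z) (E.zeroʳ (E x)))
    ... | inj₂ m | inj₂ n = inj₂ λ y → ≡.trans (≡.cong₂ _⊠_ (m y) (n y)) (interchange (E x) (E y) (E′ x) (E′ y))

  Span-* : ∀ {f g} → Span f → Span g → Span (λ y → f y ⊠ g y)
  Span-* (character p)  (character q)  = character (QuasiCharacter-* p q)
  Span-* {f} (character p) (add {g} {h} s t) = cong (λ y → ≡.sym (E.distribˡ (f y) (g y) (h y))) (add (Span-* (character p) s) (Span-* (character p) t))
  Span-* {f} (character p) (scale a {g} s)   = cong (λ y → ≡.trans (≡.sym (E.*-assoc (fromℤ a) (f y) (g y)))
    (≡.trans (≡.cong (_⊠ g y) (E.*-comm (fromℤ a) (f y))) (E.*-assoc (f y) (fromℤ a) (g y)))) (scale a (Span-* (character p) s))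
  Span-* {f} (character p) (cong eq s)       = cong (λ y → ≡.cong (f y ⊠_) (eq y)) (Span-* (character p) s)
  Span-* {g = g} (add {f} {h} s t) u         = cong (λ y → ≡.sym (E.distribʳ (g y) (f y) (h y))) (add (Span-* s u) (Span-* t u))
  Span-* {g = g} (scale a {f} s) u           = cong (λ y → ≡.sym (E.*-assoc (fromℤ a) (f y) (g y))) (scale a (Span-* s u))
  Span-* {g = g} (cong eq s) u               = cong (λ y → ≡.cong (_⊠ g y) (eq y)) (Span-* s u)

  ∑-count : ∀ {n} (c : Fin n → ℤω) → (∀ i → c i ≡ ω0 ⊎ c i ≡ ω1) →
            ∃ λ h → ∑ c ≡ fromℤ (+ h) × (∀ i → c i ≡ ω1 → 1 ≤ h)
  ∑-count {zero}  c bit = 0 , ∑-empty c , λ ()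
  ∑-count {suc n} c bit with bit zero | ∑-count (c ∘ suc) (bit ∘ suc)
  ... | inj₁ z | h , eq , pos = h , ≡.trans (∑-suc c) (≡.trans (≡.cong₂ _⊞_ z eq) (E.+-identityˡ _)) ,
    λ { zero o → ⊥-elim (ω0≢ω1 (≡.trans (≡.sym z) o)) ; (suc i) o → pos i o }
    where
    ω0≢ω1 : ω0 ≢ ω1
    ω0≢ω1 ()
  ... | inj₂ o | h , eq , _   = suc h , ≡.trans (∑-suc c) (≡.trans (≡.cong₂ _⊞_ o eq) (≡.sym (fromℤ-+ (+ 1) (+ h)))) , λ _ _ → s≤s z≤n

  -- When `E` is multiplicative at x, the term E(x) E(y - x) equals E(y); otherwise it vanishes. So
  -- h counts the x of the first kind, recorded by `c`, and 0 is one of them.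
  character-⋆ : ∀ {E} → QuasiCharacter E → ∃ λ h → 1 ≤ h × (∀ y → (E ⋆ E) y ≡ fromℤ (+ h) ⊠ E y)
  character-⋆ {E} (E0 , mult) = h , positive (from 0ᴳ) c₀ , λ y → begin
    (E ⋆ E) y                                 ≡⟨ ⋆-def E E y ⟩
    ∑ᴳ (λ x → E x ⊠ E (y +ᴳ -ᴳ x))            ≡⟨ ∑-cong (λ i → term (to i) y) ⟩
    ∑ (λ i → c (to i) ⊠ E y)                  ≡⟨ *-distribʳ-∑ (E y) (c ∘ to) ⟨
    ∑ (c ∘ to) ⊠ E y                          ≡⟨ ≡.cong (_⊠ E y) count ⟩
    fromℤ (+ h) ⊠ E y                         ∎
    where
    open ≡.≡-Reasoning

    c : G → ℤω
    c x with mult x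
    ... | inj₁ _ = ω0
    ... | inj₂ _ = ω1

    bit : ∀ x → c x ≡ ω0 ⊎ c x ≡ ω1
    bit x with mult x
    ... | inj₁ _ = inj₁ ≡.refl
    ... | inj₂ _ = inj₂ ≡.refl

    term : ∀ x y → E x ⊠ E (y +ᴳ -ᴳ x) ≡ c x ⊠ E y
    term x y with mult x
    ... | inj₁ z = ≡.trans (≡.cong (_⊠ E (y +ᴳ -ᴳ x)) z) (≡.trans (E.zeroˡ _) (≡.sym (E.zeroˡ _)))
    ... | inj₂ m = ≡.trans (≡.sym (m (y +ᴳ -ᴳ x))) (≡.trans (≡.cong E (x+[y-x] x y)) (≡.sym (E.*-identityˡ (E y))))

    c0≡1 : c 0ᴳ ≡ ω1
    c0≡1 with mult 0ᴳ
    ... | inj₂ _ = ≡.refl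
    ... | inj₁ z with ≡.trans (≡.sym E0) z
    ...   | ()

    c₀ : c (to (from 0ᴳ)) ≡ ω1
    c₀ = ≡.trans (≡.cong c (to-from 0ᴳ)) c0≡1

    counted = ∑-count (c ∘ to) (bit ∘ to)
    h = proj₁ counted
    count = proj₁ (proj₂ counted)
    positive = proj₂ (proj₂ counted)

  Rows : Set
  Rows = Fin order → G → ℤω

  detᴳ : Rows → ℤω
  detᴳ U = det order (λ i j → U i (to j))

  Eigenvector : (G → ℤω) → ℤ → (G → ℤω) → Set
  Eigenvector f a u = ∀ y → (u ⋆ f) y ≡ fromℤ a ⊠ u y

  -- u′ lies in the ideal generated by u. Passing to multiples preserves eigenvectors with their
  -- eigenvalues, which is how eigenvectors become simultaneous.
  Multiple : (G → ℤω) → (G → ℤω) → Set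
  Multiple u u′ = ∃ λ v → ∀ y → u′ y ≡ (u ⋆ v) y

  multiple-trans : ∀ {u u′ u″} → Multiple u u′ → Multiple u′ u″ → Multiple u u″
  multiple-trans {u} (v , p) (w , q) = v ⋆ w , λ y → ≡.trans (q y) (≡.trans (⋆-cong p (λ _ → ≡.refl) y) (⋆-assoc u v w y))

  eigenvector-multiple : ∀ {f a u u′} → Multiple u u′ → Eigenvector f a u → Eigenvector f a u′
  eigenvector-multiple {f} {a} {u} {u′} (v , p) eig y = begin
    (u′ ⋆ f) y                        ≡⟨ ⋆-cong p (λ _ → ≡.refl) y ⟩
    ((u ⋆ v) ⋆ f) y                   ≡⟨ ⋆-cong (⋆-comm u v) (λ _ → ≡.refl) y ⟩
    ((v ⋆ u) ⋆ f) y                   ≡⟨ ⋆-assoc v u f y ⟩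
    (v ⋆ (u ⋆ f)) y                   ≡⟨ ⋆-cong {v} (λ _ → ≡.refl) (λ x → ≡.trans (eig x) (≡.sym (scalar-⋆ (fromℤ a) u x))) y ⟩
    (v ⋆ (scalar (fromℤ a) ⋆ u)) y    ≡⟨ ⋆-assoc v (scalar (fromℤ a)) u y ⟨
    ((v ⋆ scalar (fromℤ a)) ⋆ u) y    ≡⟨ ⋆-cong (⋆-comm v (scalar (fromℤ a))) (λ _ → ≡.refl) y ⟩
    ((scalar (fromℤ a) ⋆ v) ⋆ u) y    ≡⟨ ⋆-assoc (scalar (fromℤ a)) v u y ⟩
    (scalar (fromℤ a) ⋆ (v ⋆ u)) y    ≡⟨ scalar-⋆ (fromℤ a) (v ⋆ u) y ⟩
    fromℤ a ⊠ (v ⋆ u) y               ≡⟨ ≡.cong (fromℤ a ⊠_) (≡.trans (⋆-comm v u y) (≡.sym (p y))) ⟩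
    fromℤ a ⊠ u′ y                    ∎
    where open ≡.≡-Reasoning

  -- Quantified over all starting rows, so that for a sum the second summand can be split starting
  -- from the eigenvectors of the first.
  Splits : (G → ℤω) → Set
  Splits f = ∀ U → detᴳ U ≢ ω0 → ∃ λ U′ → detᴳ U′ ≢ ω0 × (∀ i → Multiple (U i) (U′ i)) × (∀ i → ∃ λ a → Eigenvector f a (U′ i))

  module _ {E} (qc : QuasiCharacter E) where
    private
      h = proj₁ (character-⋆ qc)
      H = fromℤ (+ h)
      E⋆E = proj₂ (proj₂ (character-⋆ qc))

      H≢0 : H ≢ ω0
      H≢0 eq with h | proj₁ (proj₂ (character-⋆ qc)) | fromℤ-injective {b = + 0} eq
      ... | suc _ | _ | ()

    -- The element h - E, annihilated by `E` since E ⋆ E = h E: a substitute without denominators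
    -- for the idempotent 1 - E/h.
    complement : G → ℤω
    complement x = scalar H x ⊞ ⊟ E x

    ⋆-complement : ∀ u y → (u ⋆ complement) y ≡ H ⊠ u y ⊞ ⊟ (u ⋆ E) y
    ⋆-complement u y = ≡.trans (⋆-distribˡ u (scalar H) (λ x → ⊟ E x) y)
      (≡.cong₂ _⊞_ (≡.trans (⋆-comm u (scalar H) y) (scalar-⋆ H u y)) (≡.sym (RP.-‿distribʳ-* u E y)))

    eigen-E : ∀ u → Eigenvector E (+ h) (u ⋆ E)
    eigen-E u = eigenvector-multiple {E} {+ h} {E} (u , ⋆-comm u E) E⋆E

    eigen-complement : ∀ u → Eigenvector E (+ 0) (u ⋆ complement)
    eigen-complement u = eigenvector-multiple {E} {+ 0} {complement} (u , ⋆-comm u complement) λ y → ≡.trans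
      (⋆-comm complement E y) (≡.trans (⋆-complement E y) (≡.trans (≡.cong (λ z → H ⊠ E y ⊞ ⊟ z) (E⋆E y))
      (≡.trans (E.-‿inverseʳ (H ⊠ E y)) (≡.sym (E.zeroˡ (complement y))))))

    Split : (G → ℤω) → (G → ℤω) → Set
    Split u u′ = Multiple u u′ × ∃ λ a → Eigenvector E a u′

    -- h det U = det U₁ + det U₂, where the row u of U is replaced by u ⋆ E and h u − u ⋆ E respectively.
    split-row : ∀ U → detᴳ U ≢ ω0 → ∀ r → ∃ λ u → Split (U r) u × detᴳ (updateAt U r (const u)) ≢ ω0
    split-row U U≢0 r with detᴳ (updateAt U r (const (U r ⋆ E))) ≟ω ω0
    ... | no ≢0  = U r ⋆ E , ((E , λ _ → ≡.refl) , + h , eigen-E (U r)) , ≢0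
    ... | yes ≡0 = U r ⋆ complement , ((complement , λ _ → ≡.refl) , + 0 , eigen-complement (U r)) , λ ≡0′ →
      U≢0 (⊠-cancelˡ-0 H (detᴳ U) H≢0 (begin
        H ⊠ detᴳ U                                          ≡⟨ AlternatingForm.scale (det-form order) r H
                                                                 {λ i j → U i (to j)} {λ i j → row (λ x → H ⊠ U r x) i (to j)}
                                                                 (λ j → row-here (λ x → H ⊠ U r x) (to j))
                                                                 (λ i i≢r j → row-there (λ x → H ⊠ U r x) i i≢r (to j)) ⟨
        detᴳ (row (λ x → H ⊠ U r x))                        ≡⟨ det-linear order r ω1 ω1
                                                                 {λ i j → row (U r ⋆ E) i (to j)} {λ i j → row (U r ⋆ complement) i (to j)} {λ i j → row (λ x → H ⊠ U r x) i (to j)}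
                                                                 (λ j → ≡.trans (row-here (λ x → H ⊠ U r x) (to j)) (≡.trans (sum (U r) (to j))
                                                                   (≡.cong₂ (λ a b → ω1 ⊠ a ⊞ ω1 ⊠ b) (≡.sym (row-here (U r ⋆ E) (to j))) (≡.sym (row-here (U r ⋆ complement) (to j))))))
                                                                 (λ i i≢r j → ≡.trans (row-there (λ x → H ⊠ U r x) i i≢r (to j)) (≡.sym (row-there (U r ⋆ E) i i≢r (to j))))
                                                                 (λ i i≢r j → ≡.trans (row-there (λ x → H ⊠ U r x) i i≢r (to j)) (≡.sym (row-there (U r ⋆ complement) i i≢r (to j)))) ⟩
        ω1 ⊠ detᴳ (row (U r ⋆ E)) ⊞ ω1 ⊠ detᴳ (row (U r ⋆ complement)) ≡⟨ ≡.cong₂ (λ a b → ω1 ⊠ a ⊞ ω1 ⊠ b) ≡0 ≡0′ ⟩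
        ω1 ⊠ ω0 ⊞ ω1 ⊠ ω0                                   ≡⟨ ≡.trans (≡.cong₂ _⊞_ (E.zeroʳ ω1) (E.zeroʳ ω1)) (E.+-identityˡ ω0) ⟩
        ω0                                                  ∎))
      where
      open ≡.≡-Reasoning

      row : (G → ℤω) → Rows
      row u = updateAt U r (const u)

      row-here : ∀ u y → row u r y ≡ u y
      row-here u y = ≡.cong (λ v → v y) (updateAt-updates r U)

      row-there : ∀ u i → i ≢ r → ∀ y → row u i y ≡ U i y
      row-there u i i≢r y = ≡.cong (λ v → v y) (updateAt-minimal i r U i≢r)

      sum : ∀ u y → H ⊠ u y ≡ ω1 ⊠ (u ⋆ E) y ⊞ ω1 ⊠ (u ⋆ complement) y
      sum u y = ≡.sym (begin
        ω1 ⊠ (u ⋆ E) y ⊞ ω1 ⊠ (u ⋆ complement) y            ≡⟨ ≡.cong₂ _⊞_ (E.*-identityˡ _) (≡.trans (E.*-identityˡ _) (⋆-complement u y)) ⟩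
        (u ⋆ E) y ⊞ (H ⊠ u y ⊞ ⊟ (u ⋆ E) y)                 ≡⟨ ≡.cong ((u ⋆ E) y ⊞_) (E.+-comm _ _) ⟩
        (u ⋆ E) y ⊞ (⊟ (u ⋆ E) y ⊞ H ⊠ u y)                 ≡⟨ E.+-assoc _ _ _ ⟨
        (u ⋆ E) y ⊞ ⊟ (u ⋆ E) y ⊞ H ⊠ u y                   ≡⟨ ≡.cong (_⊞ H ⊠ u y) (E.-‿inverseʳ _) ⟩
        ω0 ⊞ H ⊠ u y                                        ≡⟨ E.+-identityˡ _ ⟩
        H ⊠ u y                                             ∎)

    -- The rows are treated in sequence because the choice in one row depends on a determinant
    -- containing the earlier choices. Rows from k on are still those of `U`, so the next split
    -- starts from the original row.
    split-rows : ∀ U → detᴳ U ≢ ω0 → ∀ k → k ≤ order → ∃ λ U′ → detᴳ U′ ≢ ω0 ×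
                 (∀ i → toℕ i < k → Split (U i) (U′ i)) × (∀ i → k ≤ toℕ i → U′ i ≡ U i)
    split-rows U U≢0 zero    _   = U , U≢0 , (λ _ ()) , (λ _ _ → ≡.refl)
    split-rows U U≢0 (suc k) k<n with split-rows U U≢0 k (ℕ.<⇒≤ k<n)
    ... | U′ , U′≢0 , done , rest with split-row U′ U′≢0 (fromℕ< k<n)
    ...   | u , split , ≢0 = updateAt U′ r (const u) , ≢0 , done′ , rest′
      where
      r = fromℕ< k<n

      toℕ-r : toℕ r ≡ k
      toℕ-r = Fin.toℕ-fromℕ< k<n

      done′ : ∀ i → toℕ i < suc k → Split (U i) (updateAt U′ r (const u) i)
      done′ i (s≤s i≤k) with i Fin.≟ r
      ... | yes ≡.refl = ≡.subst (Split (U r)) (≡.sym (updateAt-updates r U′))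
                           (≡.subst (λ w → Split w u) (rest r (ℕ.≤-reflexive (≡.sym toℕ-r))) split)
      ... | no i≢r = ≡.subst (Split (U i)) (≡.sym (updateAt-minimal i r U′ i≢r))
                       (done i (ℕ.≤∧≢⇒< i≤k λ eq → i≢r (Fin.toℕ-injective (≡.trans eq (≡.sym toℕ-r)))))

      rest′ : ∀ i → suc k ≤ toℕ i → updateAt U′ r (const u) i ≡ U i
      rest′ i k<i = ≡.trans (updateAt-minimal i r U′ λ { ≡.refl → ℕ.<-irrefl (≡.sym toℕ-r) k<i })
                      (rest i (ℕ.<⇒≤ k<i))

    character-splits : Splits E
    character-splits U U≢0 with split-rows U U≢0 order ℕ.≤-refl
    ... | U′ , U′≢0 , done , _ = U′ , U′≢0 , (λ i → proj₁ (done i (Fin.toℕ<n i))) , (λ i → proj₂ (done i (Fin.toℕ<n i)))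

  span-splits : ∀ {f} → Span f → Splits f
  span-splits (character qc) = character-splits qc
  span-splits (add {f} {g} s t) U U≢0 with span-splits s U U≢0
  ... | U₁ , U₁≢0 , mult₁ , eig₁ with span-splits t U₁ U₁≢0
  ...   | U₂ , U₂≢0 , mult₂ , eig₂ = U₂ , U₂≢0 , (λ i → multiple-trans (mult₁ i) (mult₂ i)) , λ i →
      let a , p = eig₁ i
          b , q = eig₂ i
      in a ℤ.+ b , λ y → ≡.trans (⋆-distribˡ (U₂ i) f g y)
        (≡.trans (≡.cong₂ _⊞_ (eigenvector-multiple {f} {a} (mult₂ i) p y) (q y))
        (≡.trans (≡.sym (E.distribʳ (U₂ i y) (fromℤ a) (fromℤ b))) (≡.cong (_⊠ U₂ i y) (≡.sym (fromℤ-+ a b)))))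
  span-splits (scale a {f} s) U U≢0 with span-splits s U U≢0
  ... | U′ , U′≢0 , mult , eig = U′ , U′≢0 , mult , λ i →
      let b , p = eig i
      in a ℤ.* b , λ y → ≡.trans (⋆-cong {U′ i} (λ _ → ≡.refl) (λ x → ≡.sym (scalar-⋆ (fromℤ a) f x)) y)
        (≡.trans (⋆-comm (U′ i) (scalar (fromℤ a) ⋆ f) y) (≡.trans (⋆-assoc (scalar (fromℤ a)) f (U′ i) y)
        (≡.trans (scalar-⋆ (fromℤ a) (f ⋆ U′ i) y) (≡.trans (≡.cong (fromℤ a ⊠_) (≡.trans (⋆-comm f (U′ i) y) (p y)))
        (≡.trans (≡.sym (E.*-assoc (fromℤ a) (fromℤ b) (U′ i y))) (≡.cong (_⊠ U′ i y) (≡.sym (fromℤ-* a b))))))))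
  span-splits (cong eq s) U U≢0 with span-splits s U U≢0
  ... | U′ , U′≢0 , mult , eig = U′ , U′≢0 , mult , λ i → proj₁ (eig i) , λ y →
      ≡.trans (⋆-cong {U′ i} (λ _ → ≡.refl) (λ x → ≡.sym (eq x)) y) (proj₂ (eig i) y)

-- The characteristic polynomial from eigenvectors

module Diagonalisation (Γ : FiniteAbelianGroup) (S : Subset Γ) where
  open GroupFacts Γ
  open GroupSum eisenstein Γ
  open GroupRing eisenstein Γ
  open Eigenvectors Γ
  open FiniteSum eisenstein
  open Determinant eisenstein
  open Product eisenstein using (∏)
  private
    module E = CommutativeRing eisenstein
    module EP = Algebra.Properties.Ring E.ring
    f = symbol Γ S

  identity≢0 : detᴳ (λ i → indicator (to i)) ≢ ω0
  identity≢0 eq with ≡.trans (≡.sym (det-identity order (λ i j → indicator (to i) (to j)) (λ i → indicator-≡ ≡.refl)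
    (λ i j i≢j → indicator-≢ λ e → i≢j (≡.trans (≡.sym (from-to i)) (≡.trans (≡.cong from e) (from-to j)))))) eq
  ... | ()

  char-matrix : ℤ → Matrix order order
  char-matrix x i j = fromℤ x ⊠ δ i j ⊞ ⊟ HS Γ S i j

  -- The value of u ⋆ f at `to j` is entry j of the row vector u H, so eigenvectors for ⋆ are left
  -- eigenvectors of H.
  eigenrow : ∀ {u a} → Eigenvector f a u → ∀ x j →
             ∑ (λ k → u (to k) ⊠ char-matrix x k j) ≡ fromℤ (x ℤ.- a) ⊠ u (to j)
  eigenrow {u} {a} eig x j = begin
    ∑ (λ k → u (to k) ⊠ (fromℤ x ⊠ δ k j ⊞ ⊟ HS Γ S k j))
      ≡⟨ ∑-cong (λ k → E.distribˡ _ _ _) ⟩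
    ∑ (λ k → u (to k) ⊠ (fromℤ x ⊠ δ k j) ⊞ u (to k) ⊠ ⊟ HS Γ S k j)
      ≡⟨ ∑-+ _ _ ⟩
    ∑ (λ k → u (to k) ⊠ (fromℤ x ⊠ δ k j)) ⊞ ∑ (λ k → u (to k) ⊠ ⊟ HS Γ S k j)
      ≡⟨ ≡.cong₂ _⊞_ diagonal off-diagonal ⟩
    fromℤ x ⊠ u (to j) ⊞ fromℤ (ℤ.- a) ⊠ u (to j)
      ≡⟨ E.distribʳ _ _ _ ⟨
    (fromℤ x ⊞ fromℤ (ℤ.- a)) ⊠ u (to j)
      ≡⟨ ≡.cong (_⊠ u (to j)) (fromℤ-+ x (ℤ.- a)) ⟨
    fromℤ (x ℤ.- a) ⊠ u (to j) ∎
    where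
    open ≡.≡-Reasoning

    diagonal : ∑ (λ k → u (to k) ⊠ (fromℤ x ⊠ δ k j)) ≡ fromℤ x ⊠ u (to j)
    diagonal = ≡.trans (∑-single j λ k k≢j → ≡.trans (≡.cong (λ d → u (to k) ⊠ (fromℤ x ⊠ d)) (δ-≢ k≢j))
        (≡.trans (≡.cong (u (to k) ⊠_) (E.zeroʳ (fromℤ x))) (E.zeroʳ (u (to k)))))
      (≡.trans (≡.cong (λ d → u (to j) ⊠ (fromℤ x ⊠ d)) (δ-≡ j))
        (≡.trans (≡.cong (u (to j) ⊠_) (E.*-identityʳ (fromℤ x))) (E.*-comm (u (to j)) (fromℤ x))))

    off-diagonal : ∑ (λ k → u (to k) ⊠ ⊟ HS Γ S k j) ≡ fromℤ (ℤ.- a) ⊠ u (to j)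
    off-diagonal = begin
      ∑ (λ k → u (to k) ⊠ ⊟ HS Γ S k j)                     ≡⟨ ∑-cong (λ k → ≡.trans (≡.cong (λ z → u (to k) ⊠ ⊟ z) (HS≡symbol Γ S k j)) (≡.trans (E.*-comm (u (to k)) (⊟ f (to j +ᴳ -ᴳ to k)))
                                                                  (≡.trans (≡.sym (EP.-‿distribˡ-* (f (to j +ᴳ -ᴳ to k)) (u (to k)))) (≡.trans (≡.cong ⊟_ (E.*-comm (f (to j +ᴳ -ᴳ to k)) (u (to k)))) (minus (u (to k) ⊠ f (to j +ᴳ -ᴳ to k))))))) ⟩
      ∑ (λ k → ⊟ ω1 ⊠ (u (to k) ⊠ f (to j +ᴳ -ᴳ to k)))     ≡⟨ *-distribˡ-∑ (⊟ ω1) _ ⟨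
      ⊟ ω1 ⊠ ∑ (λ k → u (to k) ⊠ f (to j +ᴳ -ᴳ to k))       ≡⟨ ≡.cong (⊟ ω1 ⊠_) (≡.trans (≡.sym (⋆-def u f (to j))) (eig (to j))) ⟩
      ⊟ ω1 ⊠ (fromℤ a ⊠ u (to j))                           ≡⟨ minus (fromℤ a ⊠ u (to j)) ⟨
      ⊟ (fromℤ a ⊠ u (to j))                                ≡⟨ EP.-‿distribˡ-* (fromℤ a) (u (to j)) ⟩
      ⊟ fromℤ a ⊠ u (to j)                                  ≡⟨ ≡.cong (_⊠ u (to j)) (fromℤ-neg a) ⟨
      fromℤ (ℤ.- a) ⊠ u (to j)                              ∎
      where
      minus : ∀ z → ⊟ z ≡ ⊟ ω1 ⊠ z
      minus z = ≡.trans (≡.cong ⊟_ (≡.sym (E.*-identityˡ z))) (EP.-‿distribˡ-* ω1 z)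

  -- With eigenvectors as the rows of U, U (xI - H) is U with row i scaled by x - aᵢ. Taking
  -- determinants and cancelling the nonzero det U gives the factorisation.
  span⇒integral : Span f → HSIntegral Γ S
  span⇒integral span = conclude (span-splits span (λ i → indicator (to i)) identity≢0)
    where
    conclude : (∃ λ U → detᴳ U ≢ ω0 × (∀ i → Multiple (indicator (to i)) (U i)) × (∀ i → ∃ λ a → Eigenvector f a (U i))) →
               HSIntegral Γ S
    conclude (U , U≢0 , _ , eig) = ev , λ x → ≡.trans (charPoly≡det Γ S x)
      (≡.trans (cancel x) (≡.sym (Πω≡∏ (λ i → fromℤ (x ℤ.- ev i)))))
      where
      open ≡.≡-Reasoning

      ev : Fin order → ℤ
      ev i = proj₁ (eig i)

      roots : ℤ → ℤω
      roots x = ∏ (λ i → fromℤ (x ℤ.- ev i))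

      products : ∀ x → detᴳ U ⊠ det order (char-matrix x) ≡ detᴳ U ⊠ roots x
      products x = begin
        detᴳ U ⊠ det order (char-matrix x)                   ≡⟨ det-mul order (λ i j → U i (to j)) (char-matrix x) ⟨
        det order ((λ i j → U i (to j)) ·ₘ char-matrix x)    ≡⟨ det-cong order (λ i j → eigenrow {U i} {ev i} (proj₂ (eig i)) x j) ⟩
        det order (λ i j → fromℤ (x ℤ.- ev i) ⊠ U i (to j))  ≡⟨ det-scale-rows order (λ i → fromℤ (x ℤ.- ev i)) (λ i j → U i (to j)) ⟩
        roots x ⊠ detᴳ U                                     ≡⟨ E.*-comm (roots x) (detᴳ U) ⟩
        detᴳ U ⊠ roots x                                     ∎

      cancel : ∀ x → det order (char-matrix x) ≡ roots x
      cancel x = EP.x∙y⁻¹≈ε⇒x≈y (det order (char-matrix x)) (roots x) (⊠-cancelˡ-0 (detᴳ U) _ U≢0 (begin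
        detᴳ U ⊠ (det order (char-matrix x) ⊞ ⊟ roots x)               ≡⟨ E.distribˡ (detᴳ U) (det order (char-matrix x)) (⊟ roots x) ⟩
        detᴳ U ⊠ det order (char-matrix x) ⊞ detᴳ U ⊠ ⊟ roots x        ≡⟨ ≡.cong₂ _⊞_ (products x) (≡.sym (EP.-‿distribʳ-* (detᴳ U) (roots x))) ⟩
        detᴳ U ⊠ roots x ⊞ ⊟ (detᴳ U ⊠ roots x)                        ≡⟨ E.-‿inverseʳ (detᴳ U ⊠ roots x) ⟩
        ω0                                                             ∎))

module ζ-powers where
  open CommutativeRing eisenstein using (*-identityˡ; *-identityʳ; commutativeSemiring)
  open Algebra.Properties.CommutativeSemiring.Exp commutativeSemiring public using (_^_; ^-homo-*; ^-assocʳ)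

  ζ^3∣ : ∀ {n} → 3 ∣ n → ζ ^ n ≡ ω1
  ζ^3∣ (divides q ≡.refl) = ≡.trans (≡.cong (ζ ^_) (ℕ.*-comm q 3)) (≡.trans (≡.sym (^-assocʳ ζ 3 q))
    (≡.trans (≡.cong (_^ q) ζ³≡1) (one q)))
    where
    one : ∀ n → ω1 ^ n ≡ ω1
    one zero    = ≡.refl
    one (suc n) = ≡.trans (*-identityˡ (ω1 ^ n)) (one n)

  ζ^% : ∀ k {r} → k % 3 ≡ r → ζ ^ k ≡ ζ ^ r
  ζ^% k {r} eq = ≡.trans (≡.cong (ζ ^_) (≡.trans (m≡m%n+[m/n]*n k 3) (≡.cong (ℕ._+ k / 3 ℕ.* 3) eq)))
    (≡.trans (^-homo-* ζ r (k / 3 ℕ.* 3)) (≡.trans (≡.cong (ζ ^ r ⊠_) (ζ^3∣ (divides (k / 3) ≡.refl))) (*-identityʳ (ζ ^ r))))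

-- The symbol as an integral combination of characters

module SymbolSpan (Γ : FiniteAbelianGroup) where
  open GroupFacts Γ
  open Multiples Γ
  open BooleanAlgebra Γ
  open Eigenvectors Γ
  open ζ-powers
  private module E = CommutativeRing eisenstein

  ⟦_⟧ : Bool → ℤω
  ⟦ true ⟧  = ω1
  ⟦ false ⟧ = ω0

  Span-1 : Span (λ _ → ω1)
  Span-1 = character (≡.refl , λ _ → inj₂ λ _ → ≡.sym (E.*-identityˡ ω1))

  Span-0 : Span (λ _ → ω0)
  Span-0 = cong (λ _ → E.zeroˡ ω1) (scale (+ 0) Span-1)

  Span-neg : ∀ {f} → Span f → Span (λ y → ⊟ f y)
  Span-neg {f} s = cong (λ y → ≡.trans (≡.cong (_⊠ f y) (fromℤ-neg (+ 1)))
    (≡.trans (≡.sym (Algebra.Properties.Ring.-‿distribˡ-* E.ring ω1 (f y))) (≡.cong ⊟_ (E.*-identityˡ (f y))))) (scale -[1+ 0 ] s)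

  -- The indicator of a subgroup is its trivial character extended by zero, and Boolean operations
  -- are integral polynomials in indicators.
  InB-span : ∀ {T} → InB Γ T → Span (λ y → ⟦ T y ⟧)
  InB-span (subgrp H (H0 , H+ , H-)) = character (≡.cong ⟦_⟧ H0 , mult)
    where
    mult : ∀ x → ⟦ H x ⟧ ≡ ω0 ⊎ (∀ y → ⟦ H (x +ᴳ y) ⟧ ≡ ⟦ H x ⟧ ⊠ ⟦ H y ⟧)
    mult x with H x in Hx
    ... | false = inj₁ ≡.refl
    ... | true  = inj₂ λ y → ≡.trans (≡.cong ⟦_⟧ (Bool-≡
        (λ Hxy → ≡.subst (λ z → H z ≡ true) (≡.trans (+ᴳ-comm (-ᴳ x) (x +ᴳ y)) (x+y-x x y)) (H+ (-ᴳ x) (x +ᴳ y) (H- x Hx) Hxy))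
        (H+ x y Hx))) (≡.sym (E.*-identityˡ ⟦ H y ⟧))
  InB-span (union S T s t) = cong (λ y → value (S y) (T y)) (add (add (InB-span s) (InB-span t)) (Span-neg (Span-* (InB-span s) (InB-span t))))
    where
    opaque
      unfolding _⊞_
      value : ∀ a b → ⟦ a ⟧ ⊞ ⟦ b ⟧ ⊞ ⊟ (⟦ a ⟧ ⊠ ⟦ b ⟧) ≡ ⟦ a ∨ b ⟧
      value true  true  = ≡.refl
      value true  false = ≡.refl
      value false true  = ≡.refl
      value false false = ≡.refl
  InB-span (inter S T s t) = cong (λ y → value (S y) (T y)) (Span-* (InB-span s) (InB-span t))
    where
    value : ∀ a b → ⟦ a ⟧ ⊠ ⟦ b ⟧ ≡ ⟦ a ∧ b ⟧
    value true  b = E.*-identityˡ ⟦ b ⟧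
    value false b = E.zeroˡ ⟦ b ⟧
  InB-span (compl S s) = cong (λ y → value (S y)) (add Span-1 (Span-neg (InB-span s)))
    where
    opaque
      unfolding _⊞_
      value : ∀ a → ω1 ⊞ ⊟ ⟦ a ⟧ ≡ ⟦ not a ⟧
      value true  = ≡.refl
      value false = ≡.refl
  InB-span (ext S T eq s) = cong (λ y → ≡.cong ⟦_⟧ (eq y)) (InB-span s)

  module _ {x m} (ord : HasOrder Γ x m) (3∣m : 3 ∣ m) where
    -- k and l agree modulo m, hence modulo 3. The natural number k + l (m - 1) plays the part of k
    -- - l.
    ζ-well-defined : ∀ k l → k · x ≡ l · x → ζ ^ k ≡ ζ ^ l
    ζ-well-defined k l eq = begin
      ζ ^ k                                 ≡⟨ E.*-identityʳ (ζ ^ k) ⟨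
      ζ ^ k ⊠ ω1                            ≡⟨ ≡.cong (ζ ^ k ⊠_) (ζ^3∣ (∣-trans 3∣m (∣n⇒∣m*n l ∣-refl))) ⟨
      ζ ^ k ⊠ ζ ^ (l ℕ.* m)                 ≡⟨ ^-homo-* ζ k (l ℕ.* m) ⟨
      ζ ^ (k ℕ.+ l ℕ.* m)                   ≡⟨ ≡.cong (ζ ^_) rearrange ⟩
      ζ ^ (k ℕ.+ l ℕ.* ℕ.pred m ℕ.+ l)      ≡⟨ ^-homo-* ζ (k ℕ.+ l ℕ.* ℕ.pred m) l ⟩
      ζ ^ (k ℕ.+ l ℕ.* ℕ.pred m) ⊠ ζ ^ l    ≡⟨ ≡.cong (_⊠ ζ ^ l) (ζ^3∣ (∣-trans 3∣m (order-∣ ord (k ℕ.+ l ℕ.* ℕ.pred m) vanishes))) ⟩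
      ω1 ⊠ ζ ^ l                            ≡⟨ E.*-identityˡ (ζ ^ l) ⟩
      ζ ^ l                                 ∎
      where
      open ≡.≡-Reasoning

      lm : l ℕ.* m ≡ l ℕ.+ l ℕ.* ℕ.pred m
      lm = ≡.trans (≡.cong (l ℕ.*_) (≡.sym (ℕ.suc-pred m {{ℕ.>-nonZero (proj₁ ord)}}))) (ℕ.*-suc l (ℕ.pred m))

      rearrange : k ℕ.+ l ℕ.* m ≡ k ℕ.+ l ℕ.* ℕ.pred m ℕ.+ l
      rearrange = ≡.trans (≡.cong (k ℕ.+_) (≡.trans lm (ℕ.+-comm l _))) (≡.sym (ℕ.+-assoc k _ l))

      vanishes : (k ℕ.+ l ℕ.* ℕ.pred m) · x ≡ 0ᴳ
      vanishes = ≡.trans (·-homo-+ k (l ℕ.* ℕ.pred m) x) (≡.trans (≡.cong (_+ᴳ (l ℕ.* ℕ.pred m) · x) eq)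
        (≡.trans (≡.sym (·-homo-+ l (l ℕ.* ℕ.pred m) x)) (≡.trans (≡.cong (_· x) (≡.sym lm)) (order-multiple ord l))))

    opaque
      -- The character of ⟨x⟩ with x ↦ ζ, extended by zero; it exists because 3 divides the order of
      -- x.
      θ : G → ℤω
      θ y with cyclic? x y
      ... | yes (k , _) = ζ ^ k
      ... | no _        = ω0

      θ-cyclic : ∀ k → θ (k · x) ≡ ζ ^ k
      θ-cyclic k with cyclic? x (k · x)
      ... | yes (l , eq) = ζ-well-defined l k (≡.sym eq)
      ... | no ∉         = ⊥-elim (∉ (k , ≡.refl))

      θ-outside : ∀ y → ¬ Defs.InCyclic Γ x y → θ y ≡ ω0
      θ-outside y ∉ with cyclic? x y
      ... | yes ∈ = ⊥-elim (∉ ∈)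
      ... | no _  = ≡.refl

    θ-quasiCharacter : QuasiCharacter θ
    θ-quasiCharacter = θ-cyclic 0 , λ y → mult y (cyclic? x y)
      where
      mult : ∀ y → Dec (Defs.InCyclic Γ x y) → θ y ≡ ω0 ⊎ (∀ w → θ (y +ᴳ w) ≡ θ y ⊠ θ w)
      mult y (no ∉)             = inj₁ (θ-outside y ∉)
      mult _ (yes (k , ≡.refl)) = inj₂ λ w → value w (cyclic? x w)
        where
        value : ∀ w → Dec (Defs.InCyclic Γ x w) → θ (k · x +ᴳ w) ≡ θ (k · x) ⊠ θ w
        value _ (yes (l , ≡.refl)) = ≡.trans (≡.cong θ (≡.sym (·-homo-+ k l x))) (≡.trans (θ-cyclic (k ℕ.+ l))
          (≡.trans (^-homo-* ζ k l) (≡.sym (≡.cong₂ _⊠_ (θ-cyclic k) (θ-cyclic l)))))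
        value w (no ∉) = ≡.trans (θ-outside (k · x +ᴳ w) outside) (≡.sym (≡.trans (≡.cong (θ (k · x) ⊠_) (θ-outside w ∉)) (E.zeroʳ _)))
          where
          outside : ¬ Defs.InCyclic Γ x (k · x +ᴳ w)
          outside ∈ = ∉ (cyclic⁻ (≡.subst (λ z → cyclic x z ≡ true) (≡.trans (+ᴳ-comm _ _) (x+y-x (k · x) w))
            (proj₁ (proj₂ (cyclic-subgroup x)) (-ᴳ (k · x)) (k · x +ᴳ w)
              (proj₂ (proj₂ (cyclic-subgroup x)) (k · x) (cyclic⁺ (k , ≡.refl))) (cyclic⁺ ∈))))

    -- `InDoubleBracket` asks for an exponent between 1 and m - 1, so j is reduced modulo m; as 3
    -- divides m, the residue modulo 3 is kept.
    bracket : ∀ j → Coprime j m → j % 3 ≡ 1 → InDoubleBracket Γ x (j · x)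
    bracket j cop j≡1 = m , j % m , ord , positive (j % m) ≡.refl , m%n<n j m , coprime⇒gcd≡1 cop′ ,
      ≡.trans (m∣n⇒o%n%m≡o%m 3 m j 3∣m) j≡1 , ≡.sym (·-% ord j)
      where
      instance _ = ℕ.>-nonZero (proj₁ ord)

      cop′ : Coprime (j % m) m
      cop′ {d} (d∣r , d∣m) = cop (≡.subst (d ∣_) (≡.sym (m≡m%n+[m/n]*n j m)) (∣m∣n⇒∣m+n d∣r (∣n⇒∣m*n (j / m) d∣m)) , d∣m)

      positive : ∀ r → j % m ≡ r → 1 ≤ r
      positive (suc r) _  = s≤s z≤n
      positive zero    eq with cop (m%n≡0⇒n∣m j m eq , ∣-refl)
      ... | ≡.refl with ∣⇒≤ 3∣m
      ...   | s≤s ()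

    pred-m%3 : ℕ.pred m % 3 ≡ 2
    pred-m%3 = pred-mod-3 (ℕ.pred m) 0
      (≡.trans (≡.cong (_% 3) (ℕ.suc-pred m {{ℕ.>-nonZero (proj₁ ord)}})) (n∣m⇒m%n≡0 m 3 3∣m))

    pred-m-neg : ∀ {y} → m · y ≡ 0ᴳ → ℕ.pred m · y ≡ -ᴳ y
    pred-m-neg {y} eq = +ᴳ-inverseʳ-unique y _ (≡.trans (≡.cong (_· y) (ℕ.suc-pred m {{ℕ.>-nonZero (proj₁ ord)}})) eq)

    -- The generators k x of ⟨x⟩ split by k modulo 3. For k ≡ 1 the value of -θ is -ζ = ω; for k ≡ 2
    -- it is -ζ² = 1 - ω, and (m - 1) k ≡ 1 puts -y into ⟨⟨x⟩⟩. So -θ has on the atom the values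
    -- required of the symbol.
    atom-bracket : ∀ {y} → atom x y ≡ true →
                   (InDoubleBracket Γ x y × ⊟ θ y ≡ ωω) ⊎ (InDoubleBracket Γ x (-ᴳ y) × ⊟ θ y ≡ ωω̄)
    atom-bracket {y} a = go (cyclic⁻ (proj₁ (∧-true a))) (cyclic⁻ (proj₂ (∧-true {cyclic x y} a)))
      where
      go : Defs.InCyclic Γ x y → Defs.InCyclic Γ y x →
           (InDoubleBracket Γ x y × ⊟ θ y ≡ ωω) ⊎ (InDoubleBracket Γ x (-ᴳ y) × ⊟ θ y ≡ ωω̄)
      go (k , ≡.refl) (l , eq) = cases (unit-mod-3 3∣m cop)
        where
        cop = generator-coprime ord k l (≡.sym eq)

        m·kx : m · (k · x) ≡ 0ᴳ
        m·kx = ≡.trans (·-comm m k x) (≡.trans (≡.cong (k ·_) (proj₁ (proj₂ ord))) (·-0ᴳ k))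

        negative : (ℕ.pred m ℕ.* k) · x ≡ -ᴳ (k · x)
        negative = ≡.trans (·-assoc (ℕ.pred m) k x) (pred-m-neg m·kx)

        cop-neg : Coprime (ℕ.pred m ℕ.* k) m
        cop-neg = generator-coprime ord (ℕ.pred m ℕ.* k) (ℕ.pred m ℕ.* l) (≡.trans (≡.cong ((ℕ.pred m ℕ.* l) ·_) negative)
          (≡.trans (·-neg (ℕ.pred m ℕ.* l) (k · x)) (≡.trans (≡.cong -ᴳ_ (≡.trans (·-assoc (ℕ.pred m) l (k · x))
            (≡.trans (≡.cong (ℕ.pred m ·_) (≡.sym eq)) (pred-m-neg (proj₁ (proj₂ ord)))))) (-ᴳ-involutive x))))

        cases : k % 3 ≡ 1 ⊎ k % 3 ≡ 2 →
                (InDoubleBracket Γ x (k · x) × ⊟ θ (k · x) ≡ ωω) ⊎ (InDoubleBracket Γ x (-ᴳ (k · x)) × ⊟ θ (k · x) ≡ ωω̄)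
        cases (inj₁ k≡1) = inj₁ (bracket k cop k≡1 ,
          ≡.trans (≡.cong ⊟_ (≡.trans (θ-cyclic k) (≡.trans (ζ^% k k≡1) (E.*-identityʳ ζ)))) ⊟ζ≡ω)
        cases (inj₂ k≡2) = inj₂ (≡.subst (InDoubleBracket Γ x) negative (bracket (ℕ.pred m ℕ.* k) cop-neg
            (≡.trans (%-distribˡ-* (ℕ.pred m) k 3) (≡.cong₂ (λ a b → (a ℕ.* b) % 3) pred-m%3 k≡2))) ,
          ≡.trans (≡.cong ⊟_ (≡.trans (θ-cyclic k) (ζ^% k k≡2))) ⊟ζ²≡ω̄)

  bracket-atom : ∀ {x y} → InDoubleBracket Γ x y → atom x y ≡ true
  bracket-atom {x} (m , k , ord , _ , _ , gcd≡1 , _ , ≡.refl) = true-∧ (cyclic⁺ (k , ≡.refl)) (inverse (coprime-Bézout (gcd≡1⇒coprime gcd≡1)))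
    where
    inverse : Bézout.Identity 1 k m → cyclic (k · x) x ≡ true
    inverse (Bézout.+- a b eq) = cyclic⁺ (a , ≡.sym (≡.trans (≡.sym (·-assoc a k x)) (≡.trans (≡.cong (_· x) (≡.sym eq))
      (≡.trans (≡.cong (x +ᴳ_) (order-multiple ord b)) (+ᴳ-identityʳ x)))))
    inverse (Bézout.-+ a b eq) = cyclic-trans {y = -ᴳ x} (cyclic⁺ (a , ≡.sym (≡.trans (≡.sym (·-assoc a k x))
      (+ᴳ-inverseʳ-unique x _ (≡.trans (≡.cong (_· x) eq) (order-multiple ord b))))))
      (≡.subst (λ z → cyclic (-ᴳ x) z ≡ true) (-ᴳ-involutive x) (cyclic-neg (-ᴳ x)))

  atom-neg : ∀ {x y} → atom x (-ᴳ y) ≡ true → atom x y ≡ true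
  atom-neg {x} {y} a = true-∧
    (cyclic-trans (proj₁ (∧-true a)) (≡.subst (λ z → cyclic (-ᴳ y) z ≡ true) (-ᴳ-involutive y) (cyclic-neg (-ᴳ y))))
    (cyclic-trans (cyclic-neg y) (proj₂ (∧-true {cyclic x (-ᴳ y)} a)))

  module _ (T : Subset Γ) (skew : SkewSymmetric Γ T) where
    symbol-pos : ∀ {y} → T y ≡ true → symbol Γ T y ≡ ωω
    symbol-pos {y} Ty with T (-ᴳ y) in T-y
    ... | true  = ⊥-elim (skew y Ty T-y)
    ... | false rewrite Ty = ≡.refl

    symbol-neg : ∀ {y} → T (-ᴳ y) ≡ true → symbol Γ T y ≡ ωω̄
    symbol-neg {y} T-y with T y in Ty
    ... | true  = ⊥-elim (skew y Ty T-y)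
    ... | false rewrite T-y = ≡.refl

    symbol-none : ∀ {y} → T y ≢ true → T (-ᴳ y) ≢ true → symbol Γ T y ≡ ω0
    symbol-none {y} ¬Ty ¬T-y with T y | T (-ᴳ y)
    ... | true  | _     = ⊥-elim (¬Ty ≡.refl)
    ... | false | true  = ⊥-elim (¬T-y ≡.refl)
    ... | false | false = ≡.refl

    Admissible : G → Set
    Admissible x = InΓ3 Γ x × (∀ y → InDoubleBracket Γ x y → T y ≡ true)

    -- Different generators in the list can have the same atom. Each new atom therefore overwrites
    -- the function built so far, through the factor 1 - indicator, instead of being added to it.
    span-atoms : ∀ xs → All Admissible xs → ∃ λ g → Span g ×
                 (∀ y → Any (λ x → atom x y ≡ true) xs → g y ≡ symbol Γ T y) ×
                 (∀ y → ¬ Any (λ x → atom x y ≡ true) xs → g y ≡ ω0)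
    span-atoms []       []               = (λ _ → ω0) , Span-0 , (λ _ ()) , (λ _ _ → ≡.refl)
    span-atoms (x ∷ xs) (((m , ord , 3∣m) , closed) ∷ rest) with span-atoms xs rest
    ... | g , span , inside , outside = g′ ,
      add (Span-* (Span-neg (character (θ-quasiCharacter ord 3∣m))) atom-span) (Span-* (add Span-1 (Span-neg atom-span)) span) ,
      inside′ , outside′
      where
      atom-span : Span (λ y → ⟦ atom x y ⟧)
      atom-span = InB-span (atom-InB x)

      g′ : G → ℤω
      g′ y = ⊟ θ ord 3∣m y ⊠ ⟦ atom x y ⟧ ⊞ (ω1 ⊞ ⊟ ⟦ atom x y ⟧) ⊠ g y

      combination : ℤω → ℤω → Bool → ℤω
      combination t z b = ⊟ t ⊠ ⟦ b ⟧ ⊞ (ω1 ⊞ ⊟ ⟦ b ⟧) ⊠ z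

      on : ∀ t z → combination t z true ≡ ⊟ t
      on t z = ≡.trans (≡.cong₂ _⊞_ (E.*-identityʳ (⊟ t)) (≡.trans (≡.cong (_⊠ z) (E.-‿inverseʳ ω1)) (E.zeroˡ z))) (E.+-identityʳ (⊟ t))

      off : ∀ t z → combination t z false ≡ z
      off t z = ≡.trans (≡.cong₂ _⊞_ (E.zeroʳ (⊟ t)) (≡.trans (≡.cong (_⊠ z)
        (≡.trans (≡.cong (ω1 ⊞_) (Algebra.Properties.Ring.-0#≈0# E.ring)) (E.+-identityʳ ω1))) (E.*-identityˡ z))) (E.+-identityˡ z)

      value : ∀ y → atom x y ≡ true → g′ y ≡ symbol Γ T y
      value y a = ≡.trans (≡.cong (combination (θ ord 3∣m y) (g y)) a) (≡.trans (on (θ ord 3∣m y) (g y)) (cases (atom-bracket ord 3∣m {y} a)))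
        where
        cases : (InDoubleBracket Γ x y × ⊟ θ ord 3∣m y ≡ ωω) ⊎ (InDoubleBracket Γ x (-ᴳ y) × ⊟ θ ord 3∣m y ≡ ωω̄) →
                ⊟ θ ord 3∣m y ≡ symbol Γ T y
        cases (inj₁ (db , eq)) = ≡.trans eq (≡.sym (symbol-pos (closed y db)))
        cases (inj₂ (db , eq)) = ≡.trans eq (≡.sym (symbol-neg (closed (-ᴳ y) db)))

      away : ∀ y → atom x y ≡ false → g′ y ≡ g y
      away y a = ≡.trans (≡.cong (combination (θ ord 3∣m y) (g y)) a) (off (θ ord 3∣m y) (g y))

      inside′ : ∀ y → Any (λ x → atom x y ≡ true) (x ∷ xs) → g′ y ≡ symbol Γ T y
      inside′ y (here a) = value y a
      inside′ y (there any) = cases (atom x y) ≡.refl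
        where
        cases : ∀ b → atom x y ≡ b → g′ y ≡ symbol Γ T y
        cases true  a = value y a
        cases false a = ≡.trans (away y a) (inside y any)

      outside′ : ∀ y → ¬ Any (λ x → atom x y ≡ true) (x ∷ xs) → g′ y ≡ ω0
      outside′ y none = cases (atom x y) ≡.refl
        where
        cases : ∀ b → atom x y ≡ b → g′ y ≡ ω0
        cases true  a = ⊥-elim (none (here a))
        cases false a = ≡.trans (away y a) (outside y (none ∘ there))

  -- A bracket lies in the atom of its generator, and atoms are closed under negation; so the symbol
  -- vanishes off the atoms of the listed generators.
  InE-span : ∀ {T} → InE Γ T → Span (symbol Γ T)
  InE-span {T} (skew , xs , Γ3 , generated) with span-atoms T skew xs (All.tabulate admissible)
    where
    admissible : ∀ {x} → x ∈ xs → Admissible T skew x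
    admissible x∈ = All.lookup Γ3 x∈ , λ y db → proj₂ (generated y) (lose x∈ db)
  ... | g , span , inside , outside = cong equal span
    where
    equal : ∀ y → g y ≡ symbol Γ T y
    equal y with Any.any? (λ x → atom x y Bool.≟ true) xs
    ... | yes any = inside y any
    ... | no none = ≡.trans (outside y none) (≡.sym (symbol-none T skew
      (λ Ty → none (Any.map bracket-atom (proj₁ (generated y) Ty)))
      (λ T-y → none (Any.map (atom-neg ∘ bracket-atom) (proj₁ (generated (-ᴳ y)) T-y)))))

  symbol-split : ∀ S y → ⟦ symPart Γ S y ⟧ ⊞ symbol Γ (bar Γ S) y ≡ symbol Γ S y
  symbol-split S y rewrite -ᴳ-involutive y with S y | S (-ᴳ y)
  ... | true  | true  = E.+-identityʳ ω1
  ... | true  | false = E.+-identityˡ ωω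
  ... | false | true  = E.+-identityˡ ωω̄
  ... | false | false = E.+-identityˡ ω0

  symbol-span : ∀ S → InB Γ (symPart Γ S) → InE Γ (bar Γ S) → Span (symbol Γ S)
  symbol-span S sym skew = cong (symbol-split S) (add (InB-span sym) (InE-span skew))

theorem4p7 : (Γ : FiniteAbelianGroup) (S : Subset Γ) →
    S (FiniteAbelianGroup.0# Γ) ≡ false →
    HSIntegral Γ S ⇔ (InB Γ (symPart Γ S) × InE Γ (bar Γ S))
theorem4p7 Γ S _ = mk⇔
  (λ integral → Consequences.symPart-InB Γ S integral , Consequences.bar-InE Γ S integral)
  (λ (sym , skew) → Diagonalisation.span⇒integral Γ S (SymbolSpan.symbol-span Γ S sym skew))
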